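{- Let $\mathcal{D}$ be a finite nonempty dataset of transactions over a finite set of items $\mathcal{I}$ with $|\mathcal{I}|=n$, let $w\ge 1$ be an integer, let $m=|U(\mathcal{I},w)|=\sum_{i=1}^{w}\binom{n}{i}$, and let $K$ be an integer with $1\le K\le m$. Fix $\varepsilon,\delta\in(0,1)$ and let $\mathcal{S}$ be a sample of $$t=\left\lceil \frac{2}{\varepsilon^2}\ln\frac{2m+K(m-K)}{\delta}\right\rceil$$ transactions drawn uniformly at random with replacement from $\mathcal{D}$. Then, with probability at least $1-\delta$, the set $W=\mathrm{TOPK}(\mathcal{S},\mathcal{I},K,w)$ is an $\varepsilon$-approximation to $\mathrm{TOPK}(\mathcal{D},\mathcal{I},K,w)$.
   Context: A dataset (or sample) is a finite multiset/sequence of transactions, each transaction being a subset of the item set $\mathcal{I}$. $U(\mathcal{I},w)$ is the family of all itemsets $x\subseteq\mathcal{I}$ with $1\le|x|\le w$. For a dataset or sample $\mathcal{T}$, $f_{\mathcal{T}}(x)$ is the fraction of transactions of $\mathcal{T}$ (counted with multiplicity) that contain $x$ as a subset, and $f_{\mathcal{T}}^{(K)}$ is the frequency of the $K$-th itemset when the itemsets of $U(\mathcal{I},w)$ are sorted by decreasing $f_{\mathcal{T}}$ (ties broken arbitrarily). Define $$\mathrm{TOPK}(\mathcal{T},\mathcal{I},K,w)=\{(x,f_{\mathcal{T}}(x)) : x\in U(\mathcal{I},w),\ f_{\mathcal{T}}(x)\ge f_{\mathcal{T}}^{(K)}\}.$$ For $\varepsilon\in(0,1)$, an $\varepsilon$-approximation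 to $\mathrm{TOPK}(\mathcal{D},\mathcal{I},K,w)$ is a set $W$ of $K$ or more ordered pairs $(x,f)$ with $x\in U(\mathcal{I},w)$, $f\in[0,1]$, such that: (P1) for each $(x,f)\in W$, $f_{\mathcal{D}}(x)\ge f_{\mathcal{D}}^{(K)}-\varepsilon$; (P2) for each $x\in U(\mathcal{I},w)$ that does not occur as first component of a pair in $W$, $f_{\mathcal{D}}(x)<f_{\mathcal{D}}^{(K)}+\varepsilon$; (P3) for each $(x,f)\in W$, $|f-f_{\mathcal{D}}(x)|\le\varepsilon$. -}

module Defs where

open import Algebra.Bundles using (CommutativeRing)
open import Data.Bool.Base using (Bool; true; false)
open import Data.Empty using (⊥)
open import Data.Fin.Base using (Fin)
open import Data.Fin.Subset as Subset using (Subset; inside; outside)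
import Data.Fin.Subset.Properties as Subset
import Data.Integer.Base as ℤ
import Data.Integer.Properties as ℤ
open import Data.List.Base as List using (List; []; _∷_; _++_; length)
import Data.List.Properties as List
import Data.List.Sort as Sort
open import Data.List.Membership.Propositional using (_∈_)
import Data.List.Membership.Propositional.Properties as ∈
import Data.List.Relation.Unary.All as All
open import Data.List.Relation.Unary.Any using (here)
open import Data.Maybe.Base using (fromMaybe)
open import Data.Nat.Base as ℕ using (ℕ; zero; suc)
open import Data.Nat.Combinatorics using (_C_; nCk+nC[k+1]≡[n+1]C[k+1])
open import Data.Nat.ListAction using (sum)
open import Data.Nat.ListAction.Properties using (sum-++)
import Data.Nat.Properties as ℕ
open import Data.Product using (Σ; ∃; ∃₂; _×_; _,_; proj₁; proj₂)
open import Data.Rational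
open import Data.Rational.Properties
open import Data.Rational.Solver using (module +-*-Solver)
import Data.Rational.Unnormalised as ℚᵘ
import Data.Rational.Unnormalised.Properties as ℚᵘ
open import Data.Sum as Sum using (_⊎_; inj₁; inj₂; swap)
import Data.Vec.Base as Vec
open import Function.Base using (_∘_)
open import Function.Bundles using (_⇔_; mk⇔)
open import Level using (Level; 0ℓ) renaming (suc to lsuc)
open import Relation.Binary.Bundles using (DecTotalOrder)
import Relation.Binary.Construct.Flip.EqAndOrd as Flip
import Relation.Binary.Construct.On as On
open import Relation.Binary.Definitions using (tri<; tri≈; tri>)
open import Relation.Binary.PropositionalEquality
open import Relation.Nullary using (¬_; Dec; yes; no; contradiction; _×-dec_)
open import Relation.Unary using (Pred; Decidable; _⊆_)

open import Algebra.Definitions.RawSemiring +-*-rawSemiring using (_^_)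
import Algebra.Properties.CommutativeSemiring.Exp
  (CommutativeRing.commutativeSemiring +-*-commutativeRing) as Exp

open +-*-Solver

private
  variable
    p q r s a b c d e : ℚ

  move : ∀ p q → p + (q - p) ≡ q
  move = solve 2 (λ p q → p :+ (q :- p) := q) refl

0<-diff : p < q → 0ℚ < q - p
0<-diff {p} {q} p<q = subst (_< q - p) (+-inverseʳ p) (+-monoˡ-< (- p) p<q)

diff-< : 0ℚ < q - p → p < q
diff-< {q} {p} 0<d = subst₂ _<_ (+-identityʳ p) (move p q) (+-monoʳ-< p 0<d)

0≤-diff : p ≤ q → 0ℚ ≤ q - p
0≤-diff {p} {q} p≤q = subst (_≤ q - p) (+-inverseʳ p) (+-monoˡ-≤ (- p) p≤q)

diff-≤ : 0ℚ ≤ q - p → p ≤ q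
diff-≤ {q} {p} 0≤d = subst₂ _≤_ (+-identityʳ p) (move p q) (+-monoʳ-≤ p 0≤d)

<-by : 0ℚ < r → q - p ≡ r → p < q
<-by 0<r eq = diff-< (subst (0ℚ <_) (sym eq) 0<r)

≤-by : 0ℚ ≤ r → q - p ≡ r → p ≤ q
≤-by 0≤r eq = diff-≤ (subst (0ℚ ≤_) (sym eq) 0≤r)

0<1 : 0ℚ < 1ℚ
0<1 = positive⁻¹ 1ℚ

0<½ : 0ℚ < ½
0<½ = positive⁻¹ ½

0≤1 : 0ℚ ≤ 1ℚ
0≤1 = <⇒≤ 0<1

+-0< : 0ℚ < p → 0ℚ < q → 0ℚ < p + q
+-0< 0<p 0<q = +-mono-< 0<p 0<q

+-0≤ : 0ℚ ≤ p → 0ℚ ≤ q → 0ℚ ≤ p + q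
+-0≤ 0≤p 0≤q = +-mono-≤ 0≤p 0≤q

*-0< : 0ℚ < p → 0ℚ < q → 0ℚ < p * q
*-0< {p} {q} 0<p 0<q =
  positive⁻¹ (p * q) {{pos*pos⇒pos p {{positive 0<p}} q {{positive 0<q}}}}

*-0≤ : 0ℚ ≤ p → 0ℚ ≤ q → 0ℚ ≤ p * q
*-0≤ {p} {q} 0≤p 0≤q =
  nonNegative⁻¹ (p * q)
    {{nonNeg*nonNeg⇒nonNeg p {{nonNegative 0≤p}} q {{nonNegative 0≤q}}}}

neg-0≤ : p ≤ 0ℚ → 0ℚ ≤ - p
neg-0≤ p≤0 = neg-antimono-≤ p≤0

neg-swap-< : p < q → - q < - p
neg-swap-< = neg-antimono-<

-‿inv : ∀ p → - (- p) ≡ p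
-‿inv = solve 1 (λ p → :- (:- p) := p) refl

*-monoʳ-< : 0ℚ < c → p < q → p * c < q * c
*-monoʳ-< {c} 0<c = *-monoˡ-<-pos c {{positive 0<c}}

*-monoˡ-< : 0ℚ < c → p < q → c * p < c * q
*-monoˡ-< {c} 0<c = *-monoʳ-<-pos c {{positive 0<c}}

*-monoʳ-≤ : 0ℚ ≤ c → p ≤ q → p * c ≤ q * c
*-monoʳ-≤ {c} 0≤c = *-monoʳ-≤-nonNeg c {{nonNegative 0≤c}}

*-monoˡ-≤ : 0ℚ ≤ c → p ≤ q → c * p ≤ c * q
*-monoˡ-≤ {c} 0≤c = *-monoˡ-≤-nonNeg c {{nonNegative 0≤c}}

*-cancelʳ-< : 0ℚ ≤ c → p * c < q * c → p < q
*-cancelʳ-< {c} 0≤c = *-cancelʳ-<-nonNeg c {{nonNegative 0≤c}}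

*-cancelˡ-< : 0ℚ ≤ c → c * p < c * q → p < q
*-cancelˡ-< {c} 0≤c = *-cancelˡ-<-nonNeg c {{nonNegative 0≤c}}

recip : 0ℚ < p → ℚ
recip {p} 0<p = (1/ p) {{>-nonZero 0<p}}

recip-0< : (0<p : 0ℚ < p) → 0ℚ < recip 0<p
recip-0< {p} 0<p =
  positive⁻¹ (recip 0<p) {{1/pos⇒pos p {{positive 0<p}}}}

recip-inv : (0<p : 0ℚ < p) → recip 0<p * p ≡ 1ℚ
recip-inv {p} 0<p = *-inverseˡ p {{>-nonZero 0<p}}

<-recip : (0<p : 0ℚ < p) → q * p < r → q < r * recip 0<p
<-recip {p} {q} {r} 0<p qp<r =
  *-cancelʳ-< (<⇒≤ 0<p) (subst (q * p <_) eq qp<r)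
  where
  eq : r ≡ r * recip 0<p * p
  eq = sym (trans (*-assoc r _ p) (trans (cong (r *_) (recip-inv 0<p)) (*-identityʳ r)))

recip-< : (0<p : 0ℚ < p) → r < q * p → r * recip 0<p < q
recip-< {p} {r} {q} 0<p r<qp =
  *-cancelʳ-< (<⇒≤ 0<p) (subst (_< q * p) eq r<qp)
  where
  eq : r ≡ r * recip 0<p * p
  eq = sym (trans (*-assoc r _ p) (trans (cong (r *_) (recip-inv 0<p)) (*-identityʳ r)))

recip-cancel : (0<p : 0ℚ < p) → ∀ r → r * recip 0<p * p ≡ r
recip-cancel {p} 0<p r =
  trans (*-assoc r _ p) (trans (cong (r *_) (recip-inv 0<p)) (*-identityʳ r))

smaller : ∀ a → ∃ λ q → q < a
smaller a = a - 1ℚ , <-by 0<1 (solve 1 (λ a → a :- (a :- con 1ℚ) := con 1ℚ) refl a)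

larger : ∀ a → ∃ λ q → a < q
larger a = a + 1ℚ , <-by 0<1 (solve 1 (λ a → a :+ con 1ℚ :- a := con 1ℚ) refl a)

halve : 0ℚ < p → ∃ λ e → 0ℚ < e × e + e ≡ p
halve {p} 0<p = ½ * p , *-0< 0<½ 0<p ,
  solve 1 (λ p → con ½ :* p :+ con ½ :* p := p) refl p

below : ∀ a b → ∃ λ r → r < a × r < b
below a b = let (r , r<) = smaller (a ⊓ b) in
  r , <-≤-trans r< (p⊓q≤p a b) , <-≤-trans r< (p⊓q≤q a b)

above : ∀ a b → ∃ λ r → a < r × b < r
above a b = let (r , <r) = larger (a ⊔ b) in
  r , ≤-<-trans (p≤p⊔q a b) <r , ≤-<-trans (p≤q⊔p a b) <r

between₂ : q < a → q < b → ∃ λ r → q < r × r < a × r < b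
between₂ {q} {a} {b} q<a q<b with ≤-total a b
... | inj₁ a≤b = let (r , q<r , r<a) = <-dense q<a in r , q<r , r<a , <-≤-trans r<a a≤b
... | inj₂ b≤a = let (r , q<r , r<b) = <-dense q<b in r , q<r , <-≤-trans r<b b≤a , r<b

between₂′ : a < q → b < q → ∃ λ r → r < q × a < r × b < r
between₂′ {a} {q} {b} a<q b<q with ≤-total a b
... | inj₁ a≤b = let (r , b<r , r<q) = <-dense b<q in r , r<q , ≤-<-trans a≤b b<r , b<r
... | inj₂ b≤a = let (r , a<r , r<q) = <-dense a<q in r , r<q , a<r , ≤-<-trans b≤a a<r

ℕ→ℚ : ℕ → ℚ
ℕ→ℚ n = ℤ.+ n / 1

ℕ→ℚ-suc : ∀ n → ℕ→ℚ (suc n) ≡ 1ℚ + ℕ→ℚ n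
ℕ→ℚ-suc n = toℚᵘ-injective (begin-equality
  toℚᵘ (ℕ→ℚ (suc n))                     ≃⟨ toℚᵘ-fromℚᵘ (ℚᵘ.mkℚᵘ (ℤ.+ suc n) 0) ⟩
  ℚᵘ.mkℚᵘ (ℤ.+ suc n) 0                     ≃⟨ ℚᵘ.*≡* (cong (ℤ._* ℤ.+ 1) (cong (ℤ._+_ (ℤ.+ 1)) (sym (ℤ.*-identityʳ (ℤ.+ n))))) ⟩
  ℚᵘ.1ℚᵘ ℚᵘ.+ ℚᵘ.mkℚᵘ (ℤ.+ n) 0             ≃⟨ ℚᵘ.+-congʳ ℚᵘ.1ℚᵘ (toℚᵘ-fromℚᵘ (ℚᵘ.mkℚᵘ (ℤ.+ n) 0)) ⟨
  toℚᵘ 1ℚ ℚᵘ.+ toℚᵘ (ℕ→ℚ n)              ≃⟨ toℚᵘ-homo-+ 1ℚ (ℕ→ℚ n) ⟨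
  toℚᵘ (1ℚ + ℕ→ℚ n)                       ∎)
  where open ℚᵘ.≤-Reasoning

ℕ→ℚ-0≤ : ∀ n → 0ℚ ≤ ℕ→ℚ n
ℕ→ℚ-0≤ zero = ≤-refl
ℕ→ℚ-0≤ (suc n) = subst (0ℚ ≤_) (sym (ℕ→ℚ-suc n)) (+-0≤ 0≤1 (ℕ→ℚ-0≤ n))

ℕ→ℚ-0< : ∀ n → 0ℚ < ℕ→ℚ (suc n)
ℕ→ℚ-0< n = subst (0ℚ <_) (sym (ℕ→ℚ-suc n)) (+-mono-<-≤ 0<1 (ℕ→ℚ-0≤ n))

archimedean : ∀ p → ∃ λ k → p < ℕ→ℚ (suc k)
archimedean p@record{} = ℤ.∣ ↥ p ∣ , toℚᵘ-cancel-< (ℚᵘ.<-respʳ-≃ (ℚᵘ.≃-sym (toℚᵘ-fromℚᵘ (ℚᵘ.mkℚᵘ (ℤ.+ suc ℤ.∣ ↥ p ∣) 0))) (ℚᵘ.*<* bound))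
  where
  i≤∣i∣ : ∀ i → i ℤ.≤ ℤ.+ ℤ.∣ i ∣
  i≤∣i∣ (ℤ.+ n)      = ℤ.≤-refl
  i≤∣i∣ ℤ.-[1+ n ] = ℤ.-≤+

  bound : ↥ p ℤ.* ℤ.+ 1 ℤ.< ℤ.+ suc ℤ.∣ ↥ p ∣ ℤ.* ↧ p
  bound = ℤ.<-≤-trans
    (subst (ℤ._< ℤ.+ suc ℤ.∣ ↥ p ∣) (sym (ℤ.*-identityʳ (↥ p)))
      (ℤ.≤-<-trans (i≤∣i∣ (↥ p)) (ℤ.+<+ (ℕ.n<1+n _))))
    (subst (ℤ._≤ ℤ.+ suc ℤ.∣ ↥ p ∣ ℤ.* ↧ p) (ℤ.*-identityʳ _)
      (ℤ.*-monoˡ-≤-nonNeg (ℤ.+ suc ℤ.∣ ↥ p ∣) (ℤ.+≤+ (ℕ.s≤s ℕ.z≤n))))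

p≤∣p∣ : ∀ p → p ≤ ∣ p ∣
p≤∣p∣ p with ≤-total 0ℚ p
... | inj₁ 0≤p = ≤-reflexive (sym (0≤p⇒∣p∣≡p 0≤p))
... | inj₂ p≤0 = ≤-trans p≤0 (0≤∣p∣ p)

-p≤∣p∣ : ∀ p → - p ≤ ∣ p ∣
-p≤∣p∣ p = subst (- p ≤_) (∣-p∣≡∣p∣ p) (p≤∣p∣ (- p))

∣∣-< : - a < p → p < a → ∣ p ∣ < a
∣∣-< {a} {p} -a<p p<a with ∣p∣≡p∨∣p∣≡-p p
... | inj₁ eq = subst (_< a) (sym eq) p<a
... | inj₂ eq = subst₂ _<_ (sym eq) (-‿inv a) (neg-swap-< -a<p)

*-mono-≤-0≤ : 0ℚ ≤ a → 0ℚ ≤ d → a ≤ b → c ≤ d → a * c ≤ b * d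
*-mono-≤-0≤ 0≤a 0≤d a≤b c≤d = ≤-trans (*-monoˡ-≤ 0≤a c≤d) (*-monoʳ-≤ 0≤d a≤b)

corner-lin : q < a * c → q < b * c → a ≤ p → p ≤ b → q < p * c
corner-lin {c = c} q<ac q<bc a≤p p≤b with ≤-total 0ℚ c
... | inj₁ 0≤c = <-≤-trans q<ac (*-monoʳ-≤ 0≤c a≤p)
... | inj₂ c≤0 = <-≤-trans q<bc (*-monoʳ-≤-nonPos c {{nonPositive c≤0}} p≤b)

corner-lin′ : a * c < q → b * c < q → a ≤ p → p ≤ b → p * c < q
corner-lin′ {c = c} ac<q bc<q a≤p p≤b with ≤-total 0ℚ c
... | inj₁ 0≤c = ≤-<-trans (*-monoʳ-≤ 0≤c p≤b) bc<q
... | inj₂ c≤0 = ≤-<-trans (*-monoʳ-≤-nonPos c {{nonPositive c≤0}} a≤p) ac<q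

corner : q < a * c → q < a * d → q < b * c → q < b * d →
         a ≤ p → p ≤ b → c ≤ s → s ≤ d → q < p * s
corner {q} {a} {c} {d} {b} {p} {s} ac ad bc bd a≤p p≤b c≤s s≤d =
  subst (q <_) (*-comm s p)
    (corner-lin {b = d} (subst (q <_) (*-comm p c) (corner-lin {a = a} ac bc a≤p p≤b))
                        (subst (q <_) (*-comm p d) (corner-lin {a = a} ad bd a≤p p≤b)) c≤s s≤d)

corner′ : a * c < q → a * d < q → b * c < q → b * d < q →
          a ≤ p → p ≤ b → c ≤ s → s ≤ d → p * s < q
corner′ {a} {c} {q} {d} {b} {p} {s} ac ad bc bd a≤p p≤b c≤s s≤d =
  subst (_< q) (*-comm s p)
    (corner-lin′ {a = c} {b = d} (subst (_< q) (*-comm p c) (corner-lin′ {a = a} ac bc a≤p p≤b))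
                         (subst (_< q) (*-comm p d) (corner-lin′ {a = a} ad bd a≤p p≤b)) c≤s s≤d)

product-close : ∀ {k} {p p′ s s′} → 0ℚ ≤ k → 0ℚ ≤ e →
  ∣ p ∣ ≤ k → ∣ s′ ∣ ≤ k → ∣ p - p′ ∣ ≤ e → ∣ s - s′ ∣ ≤ e →
  p * s ≤ p′ * s′ + (k * e + k * e)
product-close {e} {k} {p} {p′} {s} {s′} 0≤k 0≤e ∣p∣≤k ∣s′∣≤k dp ds =
  ≤-trans
    (≤-reflexive (solve 4 (λ p p′ s s′ → p :* s := p′ :* s′ :+ (p :* (s :- s′) :+ s′ :* (p :- p′))) refl p p′ s s′))
    (+-monoʳ-≤ (p′ * s′) (+-mono-≤ (bound ∣p∣≤k ds) (bound ∣s′∣≤k dp)))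
  where
  bound : ∀ {u v} → ∣ u ∣ ≤ k → ∣ v ∣ ≤ e → u * v ≤ k * e
  bound {u} {v} u≤ v≤ = ≤-trans (p≤∣p∣ (u * v))
    (subst (_≤ k * e) (sym (∣p*q∣≡∣p∣*∣q∣ u v)) (*-mono-≤-0≤ (0≤∣p∣ u) 0≤e u≤ v≤))

square-0≤ : ∀ p → 0ℚ ≤ p * p
square-0≤ p with ≤-total 0ℚ p
... | inj₁ 0≤p = *-0≤ 0≤p 0≤p
... | inj₂ p≤0 = subst (0ℚ ≤_) (solve 1 (λ p → (:- p) :* (:- p) := p :* p) refl p)
                   (*-0≤ (neg-0≤ p≤0) (neg-0≤ p≤0))

bernoulli : ∀ n → 0ℚ ≤ 1ℚ + p → 1ℚ + ℕ→ℚ n * p ≤ (1ℚ + p) ^ n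
bernoulli {p} zero 0≤1+p = ≤-reflexive (trans (cong (1ℚ +_) (*-zeroˡ p)) (+-identityʳ 1ℚ))
bernoulli {p} (suc n) 0≤1+p = ≤-trans
  (≤-by (*-0≤ (ℕ→ℚ-0≤ n) (square-0≤ p)) eq)
  (*-monoˡ-≤ 0≤1+p (bernoulli n 0≤1+p))
  where
  eq : (1ℚ + p) * (1ℚ + ℕ→ℚ n * p) - (1ℚ + ℕ→ℚ (suc n) * p) ≡ ℕ→ℚ n * (p * p)
  eq rewrite ℕ→ℚ-suc n =
    solve 2 (λ p n → (con 1ℚ :+ p) :* (con 1ℚ :+ n :* p) :- (con 1ℚ :+ (con 1ℚ :+ n) :* p) := n :* (p :* p))
      refl p (ℕ→ℚ n)

^-0≤ : ∀ n → 0ℚ ≤ a → 0ℚ ≤ a ^ n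
^-0≤ zero    0≤a = 0≤1
^-0≤ (suc n) 0≤a = *-0≤ 0≤a (^-0≤ n 0≤a)

^-0< : ∀ n → 0ℚ < a → 0ℚ < a ^ n
^-0< zero    0<a = 0<1
^-0< (suc n) 0<a = *-0< 0<a (^-0< n 0<a)

^-mono-≤ : ∀ n → 0ℚ ≤ a → a ≤ b → a ^ n ≤ b ^ n
^-mono-≤ zero    0≤a a≤b = ≤-refl
^-mono-≤ (suc n) 0≤a a≤b = *-mono-≤-0≤ 0≤a (^-0≤ n (≤-trans 0≤a a≤b)) a≤b (^-mono-≤ n 0≤a a≤b)

1^ : ∀ n → 1ℚ ^ n ≡ 1ℚ
1^ zero    = refl
1^ (suc n) = trans (*-identityˡ (1ℚ ^ n)) (1^ n)

^-≤1 : ∀ n → 0ℚ ≤ a → a ≤ 1ℚ → a ^ n ≤ 1ℚ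
^-≤1 n 0≤a a≤1 = ≤-trans (^-mono-≤ n 0≤a a≤1) (≤-reflexive (1^ n))

^-shrink : ∀ n → 0ℚ < c → p < c ^ n → ∃ λ c′ → 0ℚ < c′ × c′ < c × p < c′ ^ n
^-shrink {c} {p} n 0<c p<cⁿ = c * (1ℚ - h) , *-0< 0<c 0<1-h ,
    <-by (*-0< 0<c 0<h) (solve 2 (λ c h → c :- c :* (con 1ℚ :- h) := c :* h) refl c h) ,
    <-≤-trans p< (subst (cⁿ * (1ℚ + ℕ→ℚ n * (- h)) ≤_) (sym (Exp.^-distrib-* c (1ℚ - h) n))
      (*-monoˡ-≤ (^-0≤ n (<⇒≤ 0<c)) (bernoulli n (<⇒≤ 0<1-h))))
  where
  cⁿ = c ^ n
  D = cⁿ - p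
  E = ℕ→ℚ n * cⁿ

  0<D : 0ℚ < D
  0<D = 0<-diff p<cⁿ

  0≤E : 0ℚ ≤ E
  0≤E = *-0≤ (ℕ→ℚ-0≤ n) (^-0≤ n (<⇒≤ 0<c))

  0<F : 0ℚ < D + (D + E)
  0<F = +-0< 0<D (+-mono-<-≤ 0<D 0≤E)

  h = D * recip 0<F

  0<h : 0ℚ < h
  0<h = *-0< 0<D (recip-0< 0<F)

  0<1-h : 0ℚ < 1ℚ - h
  0<1-h = 0<-diff (recip-< {q = 1ℚ} 0<F (subst (D <_) (sym (*-identityˡ (D + (D + E))))
    (<-by (+-mono-<-≤ 0<D 0≤E) (solve 2 (λ D E → D :+ (D :+ E) :- D := D :+ E) refl D E))))

  hE<D : h * E < D
  hE<D = subst (h * E <_) (recip-cancel 0<F D)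
    (*-monoˡ-< 0<h (<-by (+-0< 0<D 0<D) (solve 2 (λ D E → D :+ (D :+ E) :- E := D :+ D) refl D E)))

  p< : p < cⁿ * (1ℚ + ℕ→ℚ n * (- h))
  p< = <-by (0<-diff hE<D)
    (solve 4 (λ C n h p → C :* (con 1ℚ :+ n :* (:- h)) :- p := (C :- p) :- h :* (n :* C)) refl
       cⁿ (ℕ→ℚ n) h p)

-- Dedekind reals: L is the set of rationals below the number, U the set
-- of rationals above it.

record ℝ : Set₁ where
  field
    L U       : ℚ → Set
    L-inhab   : ∃ L
    U-inhab   : ∃ U
    L-down    : ∀ {p q} → p < q → L q → L p
    U-up      : ∀ {p q} → p < q → U p → U q
    L-round   : ∀ {p} → L p → ∃ λ q → p < q × L q
    U-round   : ∀ {q} → U q → ∃ λ p → p < q × U p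
    disjoint  : ∀ {p} → L p → U p → ⊥
    located   : ∀ {p q} → p < q → L p ⊎ U q

open ℝ

infix 4 _<ᵣ_ _≤ᵣ_ _≃ᵣ_

_<ᵣ_ : ℝ → ℝ → Set
x <ᵣ y = ∃ λ q → U x q × L y q

_≤ᵣ_ : ℝ → ℝ → Set
x ≤ᵣ y = ¬ (y <ᵣ x)

_≃ᵣ_ : ℝ → ℝ → Set
x ≃ᵣ y = x ≤ᵣ y × y ≤ᵣ x

L<U : ∀ x → L x p → U x q → p < q
L<U {p} {q} x Lp Uq with p <? q
... | yes p<q = p<q
... | no p≮q with <-cmp p q
...   | tri< p<q _ _ = p<q
...   | tri≈ _ refl _ = contradiction Uq (disjoint x Lp)
...   | tri> _ _ q<p = contradiction Uq (disjoint x (L-down x q<p Lp))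

L-max : ∀ x → L x p → L x q → ∃ λ r → L x r × p ≤ r × q ≤ r
L-max {p} {q} x Lp Lq with ≤-total p q
... | inj₁ p≤q = q , Lq , p≤q , ≤-refl
... | inj₂ q≤p = p , Lp , ≤-refl , q≤p

approx-scan : ∀ x {h} → 0ℚ < h → ∀ n {l} → L x l → U x (l + ℕ→ℚ n * h) →
              ∃₂ λ l u → L x l × U x u × u < l + (h + (h + h))
approx-scan x {h} 0<h zero {l} Ll Uu = contradiction (L<U x Ll Uu) (<-irrefl (sym l+0h≡l))
  where
  l+0h≡l : l + ℕ→ℚ 0 * h ≡ l
  l+0h≡l = trans (cong (l +_) (*-zeroˡ h)) (+-identityʳ l)
approx-scan x {h} 0<h (suc n) {l} Ll Uu = step (located x l+h<l+2h)
  where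
  l+h<l+2h : l + h < l + (h + h)
  l+h<l+2h = +-monoʳ-< l (<-by 0<h (solve 1 (λ h → h :+ h :- h := h) refl h))

  2h<3h : h + h < h + (h + h)
  2h<3h = <-by 0<h (solve 1 (λ h → h :+ (h :+ h) :- (h :+ h) := h) refl h)

  eq : l + ℕ→ℚ (suc n) * h ≡ l + h + ℕ→ℚ n * h
  eq = trans (cong (λ m → l + m * h) (ℕ→ℚ-suc n))
    (solve 3 (λ l h m → l :+ (con 1ℚ :+ m) :* h := l :+ h :+ m :* h) refl l h (ℕ→ℚ n))

  step : L x (l + h) ⊎ U x (l + (h + h)) → ∃₂ λ l u → L x l × U x u × u < l + (h + (h + h))
  step (inj₁ Ll+h)  = approx-scan x 0<h n Ll+h (subst (U x) eq Uu)
  step (inj₂ Ul+2h) = l , l + (h + h) , Ll , Ul+2h , +-monoʳ-< l 2h<3h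

archimedean-* : ∀ p → 0ℚ < q → ∃ λ n → p < ℕ→ℚ (suc n) * q
archimedean-* {q} p 0<q =
  let (n , p/q<n) = archimedean (p * recip 0<q) in
  n , subst (_< ℕ→ℚ (suc n) * q) (recip-cancel 0<q p) (*-monoʳ-< 0<q p/q<n)

approx : ∀ x → 0ℚ < e → ∃₂ λ l u → L x l × U x u × u < l + e
approx {e} x 0<e =
  let (l₀ , Ll₀)    = L-inhab x
      (u₀ , Uu₀)    = U-inhab x
      (n , u-l<nh)  = archimedean-* (u₀ - l₀) 0<h
      (l , u , Ll , Uu , u<l+3h) = approx-scan x 0<h (suc n) Ll₀ (U-up x (shift u-l<nh) Uu₀)
  in l , u , Ll , Uu , <-trans u<l+3h (+-monoʳ-< l 3h<e)
  where
  h = ½ * (½ * e)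

  0<h : 0ℚ < h
  0<h = *-0< 0<½ (*-0< 0<½ 0<e)

  3h<e : h + (h + h) < e
  3h<e = <-by 0<h
    (solve 1 (λ e → let h = con ½ :* (con ½ :* e) in e :- (h :+ (h :+ h)) := h) refl e)

  shift : ∀ {u l v} → u - l < v → u < l + v
  shift {u} {l} {v} u-l<v =
    <-by (0<-diff u-l<v) (solve 3 (λ u l v → l :+ v :- u := v :- (u :- l)) refl u l v)

bound : ∀ x → ∃ λ k → 0ℚ < k × L x (- k) × U x k
bound x = let (l , Ll) = L-inhab x ; (u , Uu) = U-inhab x
              k = 1ℚ + (∣ l ∣ + ∣ u ∣)
              0≤l = 0≤∣p∣ l ; 0≤u = 0≤∣p∣ u
  in k , +-mono-<-≤ 0<1 (+-0≤ 0≤l 0≤u)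
   , L-down x (<-by (+-mono-<-≤ 0<1 (+-0≤ (0≤-diff (-p≤∣p∣ l)) 0≤u))
        (solve 3 (λ l a b → l :- (:- (con 1ℚ :+ (a :+ b))) := con 1ℚ :+ (a :- (:- l) :+ b)) refl l ∣ l ∣ ∣ u ∣)) Ll
   , U-up x (<-by (+-mono-<-≤ 0<1 (+-0≤ 0≤l (0≤-diff (p≤∣p∣ u))))
        (solve 3 (λ u a b → con 1ℚ :+ (a :+ b) :- u := con 1ℚ :+ (a :+ (b :- u))) refl u ∣ l ∣ ∣ u ∣)) Uu

ℚ→ℝ : ℚ → ℝ
ℚ→ℝ a = record
  { L = _< a
  ; U = a <_
  ; L-inhab = smaller a
  ; U-inhab = larger a
  ; L-down = <-trans
  ; U-up = λ p<q a<p → <-trans a<p p<q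
  ; L-round = <-dense
  ; U-round = λ a<q → let (r , a<r , r<q) = <-dense a<q in r , r<q , a<r
  ; disjoint = <-asym
  ; located = λ {p} {q} p<q → loc p<q
  }
  where
  loc : p < q → p < a ⊎ a < q
  loc {p} p<q with p <? a
  ... | yes p<a = inj₁ p<a
  ... | no  p≮a = inj₂ (≤-<-trans (≮⇒≥ p≮a) p<q)

ℕ→ℝ : ℕ → ℝ
ℕ→ℝ n = ℚ→ℝ (ℕ→ℚ n)

0ᵣ 1ᵣ : ℝ
0ᵣ = ℚ→ℝ 0ℚ
1ᵣ = ℚ→ℝ 1ℚ

infixl 6 _+ᵣ_ _-ᵣ_
infixl 7 _*ᵣ_
infix  8 -ᵣ_

_+ᵣ_ : ℝ → ℝ → ℝ
x +ᵣ y = record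
  { L = Lower
  ; U = Upper
  ; L-inhab = let (a , La) = L-inhab x ; (c , Lc) = L-inhab y ; (q , q<) = smaller (a + c)
              in q , a , c , La , Lc , q<
  ; U-inhab = let (b , Ub) = U-inhab x ; (d , Ud) = U-inhab y ; (q , <q) = larger (b + d)
              in q , b , d , Ub , Ud , <q
  ; L-down = λ p<q (a , c , La , Lc , q<) → a , c , La , Lc , <-trans p<q q<
  ; U-up = λ p<q (b , d , Ub , Ud , <p) → b , d , Ub , Ud , <-trans <p p<q
  ; L-round = λ (a , c , La , Lc , p<) →
      let (q , p<q , q<) = <-dense p< in q , p<q , a , c , La , Lc , q<
  ; U-round = λ (b , d , Ub , Ud , <q) →
      let (p , <p , p<q) = <-dense <q in p , p<q , b , d , Ub , Ud , <p
  ; disjoint = λ (a , c , La , Lc , p<) (b , d , Ub , Ud , <p) →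
      <-asym (+-mono-< (L<U x La Ub) (L<U y Lc Ud)) (<-trans <p p<)
  ; located = loc
  }
  where
  Lower Upper : ℚ → Set
  Lower q = ∃₂ λ a c → L x a × L y c × q < a + c
  Upper q = ∃₂ λ b d → U x b × U y d × b + d < q

  decide : ∀ {e p q a b c d} → e + e ≡ q - p → L x a → U x b → L y c → U y d →
           b < a + e → d < c + e → Dec (p < a + c) → Lower p ⊎ Upper q
  decide _ La _ Lc _ _ _ (yes p<a+c) = inj₁ (_ , _ , La , Lc , p<a+c)
  decide {e} {p} {q} {a} {b} {c} {d} 2e≡ _ Ub _ Ud b<a+e d<c+e (no p≮a+c) =
    inj₂ (b , d , Ub , Ud , <-≤-trans (+-mono-< b<a+e d<c+e) (begin
      (a + e) + (c + e)   ≡⟨ solve 3 (λ a c e → (a :+ e) :+ (c :+ e) := (a :+ c) :+ (e :+ e)) refl a c e ⟩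
      (a + c) + (e + e)   ≡⟨ cong (a + c +_) 2e≡ ⟩
      (a + c) + (q - p)   ≤⟨ +-monoˡ-≤ (q - p) (≮⇒≥ p≮a+c) ⟩
      p + (q - p)         ≡⟨ move p q ⟩
      q                   ∎))
    where open ≤-Reasoning

  loc : p < q → Lower p ⊎ Upper q
  loc {p} {q} p<q =
    let (e , 0<e , 2e≡)        = halve (0<-diff p<q)
        (a , b , La , Ub , b<) = approx x 0<e
        (c , d , Lc , Ud , d<) = approx y 0<e
    in decide 2e≡ La Ub Lc Ud b< d< (p <? a + c)

-ᵣ_ : ℝ → ℝ
-ᵣ x = record
  { L = λ q → U x (- q)
  ; U = λ q → L x (- q)
  ; L-inhab = let (u , Uu) = U-inhab x in - u , subst (U x) (sym (-‿inv u)) Uu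
  ; U-inhab = let (l , Ll) = L-inhab x in - l , subst (L x) (sym (-‿inv l)) Ll
  ; L-down = λ p<q → U-up x (neg-swap-< p<q)
  ; U-up = λ p<q → L-down x (neg-swap-< p<q)
  ; L-round = λ {p} U-p → let (r , r<-p , Ur) = U-round x U-p in
      - r , subst (_< - r) (-‿inv p) (neg-swap-< r<-p) , subst (U x) (sym (-‿inv r)) Ur
  ; U-round = λ {q} L-q → let (r , -q<r , Lr) = L-round x L-q in
      - r , subst (- r <_) (-‿inv q) (neg-swap-< -q<r) , subst (L x) (sym (-‿inv r)) Lr
  ; disjoint = λ U-p L-p → disjoint x L-p U-p
  ; located = λ p<q → swap (located x (neg-swap-< p<q))
  }

_-ᵣ_ : ℝ → ℝ → ℝ
x -ᵣ y = x +ᵣ -ᵣ y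

∣_∣ᵣ : ℝ → ℝ
∣ x ∣ᵣ = record
  { L = λ q → L x q ⊎ U x (- q)
  ; U = λ q → U x q × L x (- q)
  ; L-inhab = let (l , Ll) = L-inhab x in l , inj₁ Ll
  ; U-inhab = let (k , _ , L-k , Uk) = bound x in k , Uk , L-k
  ; L-down = λ { p<q (inj₁ Lq) → inj₁ (L-down x p<q Lq)
               ; p<q (inj₂ U-q) → inj₂ (U-up x (neg-swap-< p<q) U-q) }
  ; U-up = λ p<q (Up , L-p) → U-up x p<q Up , L-down x (neg-swap-< p<q) L-p
  ; L-round = λ { (inj₁ Lp) → let (r , p<r , Lr) = L-round x Lp in r , p<r , inj₁ Lr
                ; (inj₂ U-p) → let (r , p<r , Lr) = L-round (-ᵣ x) U-p in r , p<r , inj₂ Lr }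
  ; U-round = λ (Uq , L-q) →
      let (r , r<q , Ur) = U-round x Uq
          (s , s<q , L-s) = U-round (-ᵣ x) L-q
          (m , m<q , r<m , s<m) = between₂′ r<q s<q
      in m , m<q , U-up x r<m Ur , L-down x (neg-swap-< s<m) L-s
  ; disjoint = λ { (inj₁ Lp) (Up , _) → disjoint x Lp Up
                 ; (inj₂ U-p) (_ , L-p) → disjoint x L-p U-p }
  ; located = λ p<q → loc (located x p<q) (located (-ᵣ x) p<q)
  }
  where
  loc : L x p ⊎ U x q → U x (- p) ⊎ L x (- q) →
        (L x p ⊎ U x (- p)) ⊎ (U x q × L x (- q))
  loc (inj₁ Lp) _          = inj₁ (inj₁ Lp)
  loc (inj₂ Uq) (inj₁ U-p) = inj₁ (inj₂ U-p)
  loc (inj₂ Uq) (inj₂ L-q) = inj₂ (Uq , L-q)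

small : ∀ {k w} → 0ℚ < k → 0ℚ < w → ∃ λ e → 0ℚ < e × e < 1ℚ × k * e + k * e < w
small {k} {w} 0<k 0<w = w * recip 0<D , 0<e
  , recip-< {q = 1ℚ} 0<D (subst (w <_) (sym (*-identityˡ (w + (k + k))))
      (<-by (+-0< 0<k 0<k) (solve 2 (λ w k → w :+ (k :+ k) :- w := k :+ k) refl w k)))
  , subst (k * (w * recip 0<D) + k * (w * recip 0<D) <_) (recip-cancel 0<D w)
      (<-by (*-0< 0<e 0<w)
        (solve 3 (λ e w k → e :* (w :+ (k :+ k)) :- (k :* e :+ k :* e) := e :* w) refl (w * recip 0<D) w k))
  where
  0<D : 0ℚ < w + (k + k)
  0<D = +-0< 0<w (+-0< 0<k 0<k)

  0<e : 0ℚ < w * recip 0<D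
  0<e = *-0< 0<w (recip-0< 0<D)

narrow : ∀ x {k k′ l u} → 0ℚ ≤ k′ → e < 1ℚ → L x (- k) → U x k → L x l → U x u → u < l + e →
         let K = 1ℚ + (k + k′) in ∣ l ∣ ≤ K × ∣ u ∣ ≤ K × ∣ l - u ∣ ≤ e × ∣ u - l ∣ ≤ e
narrow {e} x {k} {k′} {l} {u} 0≤k′ e<1 L-k Uk Ll Uu u<l+e =
    <⇒≤ (∣∣-<
      (<-by (+-mono-<-≤ (+-0< -k<u u<l+1) 0≤k′) (solve 4 (λ l u k k′ →
        l :- :- (con 1ℚ :+ (k :+ k′)) := ((u :- :- k) :+ (l :+ con 1ℚ :- u)) :+ k′) refl l u k k′))
      (<-by (+-0< l<k (+-mono-<-≤ 0<1 0≤k′)) (solve 3 (λ l k k′ →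
        con 1ℚ :+ (k :+ k′) :- l := (k :- l) :+ (con 1ℚ :+ k′)) refl l k k′)))
  , <⇒≤ (∣∣-<
      (<-by (+-0< -k<u (+-mono-<-≤ 0<1 0≤k′)) (solve 3 (λ u k k′ →
        u :- :- (con 1ℚ :+ (k :+ k′)) := (u :- :- k) :+ (con 1ℚ :+ k′)) refl u k k′))
      (<-by (+-mono-<-≤ (+-0< l<k u<l+1) 0≤k′) (solve 4 (λ l u k k′ →
        con 1ℚ :+ (k :+ k′) :- u := ((k :- l) :+ (l :+ con 1ℚ :- u)) :+ k′) refl l u k k′)))
  , subst (_≤ e) swap-abs u-l≤e
  , u-l≤e
  where
  l<k : 0ℚ < k - l
  l<k = 0<-diff (L<U x Ll Uk)

  -k<u : 0ℚ < u - - k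
  -k<u = 0<-diff (L<U x L-k Uu)

  u<l+1 : 0ℚ < l + 1ℚ - u
  u<l+1 = 0<-diff (<-trans u<l+e (+-monoʳ-< l e<1))

  u-l≤e : ∣ u - l ∣ ≤ e
  u-l≤e = subst (_≤ e) (sym (0≤p⇒∣p∣≡p (0≤-diff (<⇒≤ (L<U x Ll Uu)))))
    (≤-by (<⇒≤ (0<-diff u<l+e)) (solve 3 (λ e u l → e :- (u :- l) := l :+ e :- u) refl e u l))

  swap-abs : ∣ u - l ∣ ≡ ∣ l - u ∣
  swap-abs = trans (sym (∣-p∣≡∣p∣ (u - l)))
    (cong ∣_∣ (solve 2 (λ u l → :- (u :- l) := l :- u) refl u l))

-- Interval multiplication: for a < x < b and c < y < d, the product x * y
-- lies between the least and the greatest of a*c, a*d, b*c, b*d.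

_*ᵣ_ : ℝ → ℝ → ℝ
x *ᵣ y = record
  { L = Lower
  ; U = Upper
  ; L-inhab = L₀
  ; U-inhab = U₀
  ; L-down = λ p<q (a , b , c , d , box , ac , ad , bc , bd) →
      a , b , c , d , box , <-trans p<q ac , <-trans p<q ad , <-trans p<q bc , <-trans p<q bd
  ; U-up = λ p<q (a , b , c , d , box , ac , ad , bc , bd) →
      a , b , c , d , box , <-trans ac p<q , <-trans ad p<q , <-trans bc p<q , <-trans bd p<q
  ; L-round = λ (a , b , c , d , box , ac , ad , bc , bd) →
      let (r , p<r , r<ac , r<ad) = between₂ ac ad
          (s , p<s , s<bc , s<bd) = between₂ bc bd
          (m , p<m , m<r , m<s)   = between₂ p<r p<s
      in m , p<m , a , b , c , d , box
       , <-trans m<r r<ac , <-trans m<r r<ad , <-trans m<s s<bc , <-trans m<s s<bd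
  ; U-round = λ (a , b , c , d , box , ac , ad , bc , bd) →
      let (r , r<q , ac<r , ad<r) = between₂′ ac ad
          (s , s<q , bc<s , bd<s) = between₂′ bc bd
          (m , m<q , r<m , s<m)   = between₂′ r<q s<q
      in m , m<q , a , b , c , d , box
       , <-trans ac<r r<m , <-trans ad<r r<m , <-trans bc<s s<m , <-trans bd<s s<m
  ; disjoint = disj
  ; located = loc
  }
  where
  Box : (a b c d : ℚ) → Set
  Box a b c d = L x a × U x b × L y c × U y d

  Lower Upper : ℚ → Set
  Lower q = ∃ λ a → ∃ λ b → ∃ λ c → ∃ λ d → Box a b c d ×
            q < a * c × q < a * d × q < b * c × q < b * d
  Upper q = ∃ λ a → ∃ λ b → ∃ λ c → ∃ λ d → Box a b c d ×
            a * c < q × a * d < q × b * c < q × b * d < q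

  a₀ = proj₁ (L-inhab x)
  b₀ = proj₁ (U-inhab x)
  c₀ = proj₁ (L-inhab y)
  d₀ = proj₁ (U-inhab y)

  box₀ : Box a₀ b₀ c₀ d₀
  box₀ = proj₂ (L-inhab x) , proj₂ (U-inhab x) , proj₂ (L-inhab y) , proj₂ (U-inhab y)

  L₀ : ∃ Lower
  L₀ = let (r , ac , ad) = below (a₀ * c₀) (a₀ * d₀)
           (s , bc , bd) = below (b₀ * c₀) (b₀ * d₀)
           (m , m<r , m<s) = below r s
       in m , a₀ , b₀ , c₀ , d₀ , box₀
        , <-trans m<r ac , <-trans m<r ad , <-trans m<s bc , <-trans m<s bd

  U₀ : ∃ Upper
  U₀ = let (r , ac , ad) = above (a₀ * c₀) (a₀ * d₀)
           (s , bc , bd) = above (b₀ * c₀) (b₀ * d₀)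
           (m , r<m , s<m) = above r s
       in m , a₀ , b₀ , c₀ , d₀ , box₀
        , <-trans ac r<m , <-trans ad r<m , <-trans bc s<m , <-trans bd s<m

  disj : Lower p → Upper p → ⊥
  disj (a , b , c , d , (La , Ub , Lc , Ud) , ac , ad , bc , bd)
       (a′ , b′ , c′ , d′ , (La′ , Ub′ , Lc′ , Ud′) , ac′ , ad′ , bc′ , bd′) =
    let (r , Lr , a≤r , a′≤r) = L-max x La La′
        (s , Ls , c≤s , c′≤s) = L-max y Lc Lc′
    in <-asym
         (corner {a = a} {d = d} ac ad bc bd
            a≤r (<⇒≤ (L<U x Lr Ub)) c≤s (<⇒≤ (L<U y Ls Ud)))
         (corner′ {a = a′} {c = c′} {d = d′} ac′ ad′ bc′ bd′
            a′≤r (<⇒≤ (L<U x Lr Ub′)) c′≤s (<⇒≤ (L<U y Ls Ud′)))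

  module Located {p q k k′ e : ℚ} (p<q : p < q) (0<k : 0ℚ < k) (0<k′ : 0ℚ < k′)
    (L-k : L x (- k)) (Uk : U x k) (L-k′ : L y (- k′)) (Uk′ : U y k′)
    (0<e : 0ℚ < e) (e<1 : e < 1ℚ)
    (Ke<w : (1ℚ + (k + k′)) * e + (1ℚ + (k + k′)) * e < q - p)
    {a b c d : ℚ} (La : L x a) (Ub : U x b) (Lc : L y c) (Ud : U y d) (b< : b < a + e) (d< : d < c + e)
    where

    K = 1ℚ + (k + k′)

    box : Box a b c d
    box = La , Ub , Lc , Ud

    X Y : Bool → ℚ
    X false = a
    X true  = b
    Y false = c
    Y true  = d

    x-inside : ∣ a ∣ ≤ K × ∣ b ∣ ≤ K × ∣ a - b ∣ ≤ e × ∣ b - a ∣ ≤ e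
    x-inside = narrow x {k′ = k′} (<⇒≤ 0<k′) e<1 L-k Uk La Ub b<

    y-inside : ∣ c ∣ ≤ K × ∣ d ∣ ≤ K × ∣ c - d ∣ ≤ e × ∣ d - c ∣ ≤ e
    y-inside = subst (λ K → ∣ c ∣ ≤ K × ∣ d ∣ ≤ K × ∣ c - d ∣ ≤ e × ∣ d - c ∣ ≤ e)
      (cong (1ℚ +_) (+-comm k′ k)) (narrow y {k′ = k} (<⇒≤ 0<k) e<1 L-k′ Uk′ Lc Ud d<)

    self : ∀ p → ∣ p - p ∣ ≤ e
    self p = subst (_≤ e) (sym (cong ∣_∣ (+-inverseʳ p))) (<⇒≤ 0<e)

    X-bound : ∀ i → ∣ X i ∣ ≤ K
    X-bound false = proj₁ x-inside
    X-bound true  = proj₁ (proj₂ x-inside)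

    Y-bound : ∀ i → ∣ Y i ∣ ≤ K
    Y-bound false = proj₁ y-inside
    Y-bound true  = proj₁ (proj₂ y-inside)

    X-close : ∀ i j → ∣ X i - X j ∣ ≤ e
    X-close false false = self a
    X-close false true  = proj₁ (proj₂ (proj₂ x-inside))
    X-close true  false = proj₂ (proj₂ (proj₂ x-inside))
    X-close true  true  = self b

    Y-close : ∀ i j → ∣ Y i - Y j ∣ ≤ e
    Y-close false false = self c
    Y-close false true  = proj₁ (proj₂ (proj₂ y-inside))
    Y-close true  false = proj₂ (proj₂ (proj₂ y-inside))
    Y-close true  true  = self d

    0≤K : 0ℚ ≤ K
    0≤K = +-0≤ 0≤1 (+-0≤ (<⇒≤ 0<k) (<⇒≤ 0<k′))

    all-below : ∀ i j → ¬ (p < X i * Y j) → ∀ m n → X m * Y n < q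
    all-below i j p≮ m n = begin-strict
      X m * Y n                      ≤⟨ product-close 0≤K (<⇒≤ 0<e) (X-bound m) (Y-bound j) (X-close m i) (Y-close n j) ⟩
      X i * Y j + (K * e + K * e)    ≤⟨ +-monoˡ-≤ (K * e + K * e) (≮⇒≥ p≮) ⟩
      p + (K * e + K * e)            <⟨ +-monoʳ-< p Ke<w ⟩
      p + (q - p)                    ≡⟨ move p q ⟩
      q                              ∎
      where open ≤-Reasoning

    upper : ∀ i j → ¬ (p < X i * Y j) → Lower p ⊎ Upper q
    upper i j p≮ = let f = all-below i j p≮ in
      inj₂ (a , b , c , d , box , f false false , f false true , f true false , f true true)

    result : Lower p ⊎ Upper q
    result with p <? a * c | p <? a * d | p <? b * c | p <? b * d
    ... | yes ac | yes ad | yes bc | yes bd = inj₁ (a , b , c , d , box , ac , ad , bc , bd)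
    ... | no ¬ac | _      | _      | _      = upper false false ¬ac
    ... | yes _  | no ¬ad | _      | _      = upper false true ¬ad
    ... | yes _  | yes _  | no ¬bc | _      = upper true false ¬bc
    ... | yes _  | yes _  | yes _  | no ¬bd = upper true true ¬bd

  loc : p < q → Lower p ⊎ Upper q
  loc p<q =
    let (k  , 0<k  , L-k  , Uk)  = bound x
        (k′ , 0<k′ , L-k′ , Uk′) = bound y
        (e , 0<e , e<1 , Ke<w)   = small (+-0< 0<1 (+-0< 0<k 0<k′)) (0<-diff p<q)
        (a , b , La , Ub , b<)   = approx x 0<e
        (c , d , Lc , Ud , d<)   = approx y 0<e
    in Located.result p<q 0<k 0<k′ L-k Uk L-k′ Uk′ 0<e e<1 Ke<w La Ub Lc Ud b< d<

0<U : ∀ x → 0ᵣ <ᵣ x → U x q → 0ℚ < q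
0<U x (l , 0<l , Ll) Uq = <-trans 0<l (L<U x Ll Uq)

recipᵣ : (x : ℝ) → 0ᵣ <ᵣ x → ℝ
recipᵣ x 0<x@(l₀ , 0<l₀ , Ll₀) = record
  { L = Lower
  ; U = Upper
  ; L-inhab = let (u , Uu) = U-inhab x in
      0ℚ , u , Uu , subst (_< 1ℚ) (sym (*-zeroˡ u)) 0<1
  ; U-inhab = let (q , 1/l<q) = larger (1ℚ * recip 0<l₀) in
      q , l₀ , 0<l₀ , Ll₀ , subst (_< q * l₀) (recip-cancel 0<l₀ 1ℚ) (*-monoʳ-< 0<l₀ 1/l<q)
  ; L-down = λ p<q (u , Uu , qu<1) → u , Uu , <-trans (*-monoʳ-< (0<U x 0<x Uu) p<q) qu<1
  ; U-up = λ p<q (l , 0<l , Ll , 1<pl) → l , 0<l , Ll , <-trans 1<pl (*-monoʳ-< 0<l p<q)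
  ; L-round = λ (u , Uu , pu<1) →
      let 0<u = 0<U x 0<x Uu
          (q , p<q , q<1/u) = <-dense (<-recip 0<u pu<1)
      in q , p<q , u , Uu , subst (q * u <_) (recip-cancel 0<u 1ℚ) (*-monoʳ-< 0<u q<1/u)
  ; U-round = λ (l , 0<l , Ll , 1<ql) →
      let (p , 1/l<p , p<q) = <-dense (recip-< 0<l 1<ql)
      in p , p<q , l , 0<l , Ll , subst (_< p * l) (recip-cancel 0<l 1ℚ) (*-monoʳ-< 0<l 1/l<p)
  ; disjoint = λ {p} (u , Uu , pu<1) (l , 0<l , Ll , 1<pl) →
      <-asym pu<1 (<-trans 1<pl (*-monoˡ-< {c = p} (0<factor 0<l 1<pl) (L<U x Ll Uu)))
  ; located = loc
  }
  where
  Lower Upper : ℚ → Set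
  Lower q = ∃ λ u → U x u × q * u < 1ℚ
  Upper q = ∃ λ l → 0ℚ < l × L x l × 1ℚ < q * l

  0<factor : 0ℚ < q → 1ℚ < p * q → 0ℚ < p
  0<factor {q} {p} 0<q 1<pq =
    *-cancelʳ-< {c = q} (<⇒≤ 0<q) (subst (_< p * q) (sym (*-zeroˡ q)) (<-trans 0<1 1<pq))

  decide : ∀ {p q e l l′ u} → 0ℚ < q → q * e < (q - p) * l₀ → p < q →
           L x l → U x u → u < l + e → L x l′ → l₀ ≤ l′ → l ≤ l′ →
           Dec (p * u < 1ℚ) → Lower p ⊎ Upper q
  decide _ _ _ _ Uu _ _ _ _ (yes pu<1) = inj₁ (_ , Uu , pu<1)
  decide {p} {q} {e} {l} {l′} {u} 0<q qe< p<q Ll Uu u<l+e Ll′ l₀≤l′ l≤l′ (no pu≮1) =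
    inj₂ (l′ , <-≤-trans 0<l₀ l₀≤l′ , Ll′ , (begin-strict
      1ℚ                                 ≤⟨ ≮⇒≥ pu≮1 ⟩
      p * u                              ≡⟨ solve 3 (λ p q u → p :* u := q :* u :- (q :- p) :* u) refl p q u ⟩
      q * u - (q - p) * u                <⟨ +-mono-≤-< (*-monoˡ-≤ (<⇒≤ 0<q) (<⇒≤ u<l′+e)) (neg-swap-< step) ⟩
      q * (l′ + e) - q * e               ≡⟨ solve 3 (λ q l e → q :* (l :+ e) :- q :* e := q :* l) refl q l′ e ⟩
      q * l′                             ∎))
    where
    open ≤-Reasoning
    u<l′+e : u < l′ + e
    u<l′+e = <-≤-trans u<l+e (+-monoˡ-≤ e l≤l′)
    step : q * e < (q - p) * u
    step = <-trans qe< (*-monoˡ-< (0<-diff p<q) (L<U x Ll₀ Uu))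

  loc : p < q → Lower p ⊎ Upper q
  loc {p} {q} p<q with p <? 0ℚ
  ... | yes p<0 = let (u , Uu) = U-inhab x in
        inj₁ (u , Uu , <-trans (subst (p * u <_) (*-zeroˡ u) (*-monoʳ-< (0<U x 0<x Uu) p<0)) 0<1)
  ... | no  p≮0 =
        let 0<q = ≤-<-trans (≮⇒≥ p≮0) p<q
            (e , 0<e , e<) = <-dense {0ℚ} {(q - p) * l₀ * recip 0<q}
                               (*-0< (*-0< (0<-diff p<q) 0<l₀) (recip-0< 0<q))
            (l , u , Ll , Uu , u<) = approx x 0<e
            (l′ , Ll′ , l₀≤l′ , l≤l′) = L-max x Ll₀ Ll
        in decide 0<q (subst₂ _<_ (*-comm e q) (recip-cancel 0<q _) (*-monoʳ-< 0<q e<))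
             p<q Ll Uu u< Ll′ l₀≤l′ l≤l′ (p * u <? 1ℚ)

infixl 7 _÷ᵣ_⟨_⟩

_÷ᵣ_⟨_⟩ : (x y : ℝ) → 0ᵣ <ᵣ y → ℝ
x ÷ᵣ y ⟨ 0<y ⟩ = x *ᵣ recipᵣ y 0<y

*ᵣ-pos : ∀ {x y} → 0ᵣ <ᵣ x → 0ᵣ <ᵣ y → 0ᵣ <ᵣ x *ᵣ y
*ᵣ-pos {x} {y} 0<x@(a , 0<a , La) 0<y@(c , 0<c , Lc) =
  let (b , Ub) = U-inhab x
      (d , Ud) = U-inhab y
      0<b = 0<U x 0<x Ub
      0<d = 0<U y 0<y Ud
  in L-round (x *ᵣ y)
       (a , b , c , d , (La , Ub , Lc , Ud) , *-0< 0<a 0<c , *-0< 0<a 0<d , *-0< 0<b 0<c , *-0< 0<b 0<d)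

recipᵣ-pos : ∀ {x} (0<x : 0ᵣ <ᵣ x) → 0ᵣ <ᵣ recipᵣ x 0<x
recipᵣ-pos {x} 0<x =
  let (u , Uu) = U-inhab x in
  L-round (recipᵣ x 0<x) (u , Uu , subst (_< 1ℚ) (sym (*-zeroˡ u)) 0<1)

÷ᵣ-pos : ∀ {x y} → 0ᵣ <ᵣ x → (0<y : 0ᵣ <ᵣ y) → 0ᵣ <ᵣ x ÷ᵣ y ⟨ 0<y ⟩
÷ᵣ-pos {x} {y} 0<x 0<y = *ᵣ-pos {x} {recipᵣ y 0<y} 0<x (recipᵣ-pos {y} 0<y)

ℕ→ℝ-pos : ∀ {n} → 0 ℕ.< n → 0ᵣ <ᵣ ℕ→ℝ n
ℕ→ℝ-pos {suc n} _ = <-dense (ℕ→ℚ-0< n)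

unit : ℕ → ℚ
unit k = recip (ℕ→ℚ-0< k)

base : ℚ → ℕ → ℚ
base q k = 1ℚ + q * unit k

unit-inv : ∀ k → unit k * ℕ→ℚ (suc k) ≡ 1ℚ
unit-inv k = recip-inv (ℕ→ℚ-0< k)

0<unit : ∀ k → 0ℚ < unit k
0<unit k = recip-0< (ℕ→ℚ-0< k)

*-unit-cancel : ∀ k p → ℕ→ℚ (suc k) * (p * unit k) ≡ p
*-unit-cancel k p = trans
  (solve 3 (λ n p v → n :* (p :* v) := p :* (v :* n)) refl (ℕ→ℚ (suc k)) p (unit k))
  (trans (cong (p *_) (unit-inv k)) (*-identityʳ p))

base-mono-< : ∀ k → p < q → base p k < base q k
base-mono-< k p<q = +-monoʳ-< 1ℚ (*-monoʳ-< (0<unit k) p<q)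

base-cancel-< : ∀ k → base p k < base q k → p < q
base-cancel-< {p} {q} k lt = *-cancelʳ-< (<⇒≤ (0<unit k))
  (<-by (0<-diff lt) (solve 2 (λ a b → b :- a := (con 1ℚ :+ b) :- (con 1ℚ :+ a)) refl (p * unit k) (q * unit k)))

base-0< : ∀ k → - q < ℕ→ℚ (suc k) → 0ℚ < base q k
base-0< {q} k -q<n = subst (0ℚ <_) eq (*-0< (0<-diff -q<n) (0<unit k))
  where
  eq : (ℕ→ℚ (suc k) - - q) * unit k ≡ base q k
  eq = trans (solve 3 (λ n q v → (n :- :- q) :* v := v :* n :+ q :* v) refl (ℕ→ℚ (suc k)) q (unit k))
             (cong (_+ q * unit k) (unit-inv k))

unbase : ℚ → ℕ → ℚ
unbase b k = (b - 1ℚ) * ℕ→ℚ (suc k)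

base-unbase : ∀ b k → base (unbase b k) k ≡ b
base-unbase b k = trans
  (cong (1ℚ +_) (trans (*-assoc (b - 1ℚ) (ℕ→ℚ (suc k)) (unit k))
    (trans (*-comm (b - 1ℚ) _) (trans (cong (_* (b - 1ℚ)) (trans (*-comm _ (unit k)) (unit-inv k)))
      (*-identityˡ (b - 1ℚ))))))
  (move 1ℚ b)

1+-0≤ : ∀ j y → 0ℚ < 1ℚ + ℕ→ℚ (suc j) * y → 0ℚ ≤ 1ℚ + y
1+-0≤ j y 0<1+my = step (≤-total 0ℚ y)
  where
  eq : y - ℕ→ℚ (suc j) * y ≡ ℕ→ℚ j * (- y)
  eq = trans (cong (λ m → y - m * y) (ℕ→ℚ-suc j))
    (solve 2 (λ m y → y :- (con 1ℚ :+ m) :* y := m :* (:- y)) refl (ℕ→ℚ j) y)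

  step : 0ℚ ≤ y ⊎ y ≤ 0ℚ → 0ℚ ≤ 1ℚ + y
  step (inj₁ 0≤y) = +-0≤ 0≤1 0≤y
  step (inj₂ y≤0) = ≤-trans (<⇒≤ 0<1+my)
    (+-monoʳ-≤ 1ℚ {ℕ→ℚ (suc j) * y} {y} (≤-by {r = ℕ→ℚ j * (- y)} (*-0≤ (ℕ→ℚ-0≤ j) (neg-0≤ y≤0)) eq))

power-≤ : ∀ k j → 0ℚ < base q k → 0ℚ < base (- q) j →
          base q k ^ suc k * base (- q) j ^ suc j ≤ 1ℚ
power-≤ {q} k j 0<A 0<B = begin
  base q k ^ n * base (- q) j ^ m     ≤⟨ *-mono-≤-0≤ (^-0≤ n (<⇒≤ 0<A)) (^-0≤ m (^-0≤ n 0≤1-y)) (^-mono-≤ n (<⇒≤ 0<A) A≤) (^-mono-≤ m (<⇒≤ 0<B) B≤) ⟩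
  ((1ℚ + y) ^ m) ^ n * ((1ℚ + - y) ^ n) ^ m
    ≡⟨ cong₂ _*_ (Exp.^-assocʳ (1ℚ + y) m n) (trans (Exp.^-assocʳ (1ℚ + - y) n m) (cong ((1ℚ + - y) ^_) (ℕ.*-comm n m))) ⟩
  (1ℚ + y) ^ (m ℕ.* n) * (1ℚ + - y) ^ (m ℕ.* n)
    ≡⟨ sym (Exp.^-distrib-* (1ℚ + y) (1ℚ + - y) (m ℕ.* n)) ⟩
  ((1ℚ + y) * (1ℚ + - y)) ^ (m ℕ.* n) ≤⟨ ^-≤1 (m ℕ.* n) (*-0≤ 0≤1+y 0≤1-y) prod≤1 ⟩
  1ℚ                                  ∎
  where
  open ≤-Reasoning
  n = suc k
  m = suc j
  y = q * unit k * unit j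

  A≡ : base q k ≡ 1ℚ + ℕ→ℚ m * y
  A≡ = cong (1ℚ +_) (sym (*-unit-cancel j (q * unit k)))

  B≡ : base (- q) j ≡ 1ℚ + ℕ→ℚ n * (- y)
  B≡ = cong (1ℚ +_) (sym (trans
    (cong (ℕ→ℚ n *_) (solve 3 (λ q u v → :- (q :* u :* v) := (:- q :* v) :* u) refl q (unit k) (unit j)))
    (*-unit-cancel k (- q * unit j))))

  0≤1+y : 0ℚ ≤ 1ℚ + y
  0≤1+y = 1+-0≤ j y (subst (0ℚ <_) A≡ 0<A)

  0≤1-y : 0ℚ ≤ 1ℚ + - y
  0≤1-y = 1+-0≤ k (- y) (subst (0ℚ <_) B≡ 0<B)

  A≤ : base q k ≤ (1ℚ + y) ^ m
  A≤ = subst (_≤ (1ℚ + y) ^ m) (sym A≡) (bernoulli m 0≤1+y)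

  B≤ : base (- q) j ≤ (1ℚ + - y) ^ n
  B≤ = subst (_≤ (1ℚ + - y) ^ n) (sym B≡) (bernoulli n 0≤1-y)

  prod≤1 : (1ℚ + y) * (1ℚ + - y) ≤ 1ℚ
  prod≤1 = ≤-by (square-0≤ y) (solve 1 (λ y → con 1ℚ :- (con 1ℚ :+ y) :* (con 1ℚ :+ :- y) := y :* y) refl y)

power-≥ : ∀ k → 0ℚ < base p k → 0ℚ < base q k →
          1ℚ + (p + q + p * q * unit k) ≤ base p k ^ suc k * base q k ^ suc k
power-≥ {p} {q} k 0<A 0<B = begin
  1ℚ + (p + q + p * q * unit k)                    ≡⟨ cong (1ℚ +_) (sym (trans (cong (n *_) (solve 3 (λ p q v → (p :* v :+ q :* v) :+ (p :* v) :* (q :* v) := (p :+ q :+ p :* q :* v) :* v) refl p q (unit k))) (*-unit-cancel k (p + q + p * q * unit k)))) ⟩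
  1ℚ + n * z                                       ≤⟨ bernoulli (suc k) (subst (0ℚ ≤_) AB≡ (<⇒≤ (*-0< 0<A 0<B))) ⟩
  (1ℚ + z) ^ suc k                                 ≡⟨ cong (_^ suc k) (sym AB≡) ⟩
  (base p k * base q k) ^ suc k                    ≡⟨ Exp.^-distrib-* (base p k) (base q k) (suc k) ⟩
  base p k ^ suc k * base q k ^ suc k              ∎
  where
  open ≤-Reasoning
  n = ℕ→ℚ (suc k)
  z = (p * unit k + q * unit k) + (p * unit k) * (q * unit k)

  AB≡ : base p k * base q k ≡ 1ℚ + z
  AB≡ = solve 2 (λ a b → (con 1ℚ :+ a) :* (con 1ℚ :+ b) := con 1ℚ :+ ((a :+ b) :+ a :* b)) refl (p * unit k) (q * unit k)

1<-cancel : 0ℚ < p → p < p * q → 1ℚ < q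
1<-cancel {p} {q} 0<p p<pq = *-cancelˡ-< (<⇒≤ 0<p) (subst (_< p * q) (sym (*-identityʳ p)) p<pq)

1<⇒recip< : (0<b : 0ℚ < b) → 1ℚ < p * b → 1ℚ * recip 0<b < p
1<⇒recip< 0<b = recip-< 0<b

recip<⇒1< : (0<b : 0ℚ < b) → 1ℚ * recip 0<b < p → 1ℚ < p * b
recip<⇒1< {b} {p} 0<b lt = subst (_< p * b) (recip-cancel 0<b 1ℚ) (*-monoʳ-< 0<b lt)

step-size : ∀ {r w} q s → 0ℚ < r → 0ℚ < w →
            ∃ λ k → r * (s * unit k) < w × - q < ℕ→ℚ (suc k) × q < ℕ→ℚ (suc k)
step-size {r} {w} q s 0<r 0<w =
  let (k , q+t<n) = archimedean (∣ q ∣ + r * ∣ s ∣ * recip 0<w)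
      (q<n , t<n) = split (0≤∣p∣ q) (*-0≤ (*-0≤ (<⇒≤ 0<r) (0≤∣p∣ s)) (<⇒≤ (recip-0< 0<w))) q+t<n
  in k , small-step k t<n , ≤-<-trans (-p≤∣p∣ q) q<n , ≤-<-trans (p≤∣p∣ q) q<n
  where
  split : ∀ {a b n} → 0ℚ ≤ a → 0ℚ ≤ b → a + b < n → a < n × b < n
  split {a} {b} 0≤a 0≤b a+b<n =
      ≤-<-trans (≤-by 0≤b (solve 2 (λ a b → a :+ b :- a := b) refl a b)) a+b<n
    , ≤-<-trans (≤-by 0≤a (solve 2 (λ a b → a :+ b :- b := a) refl a b)) a+b<n

  small-step : ∀ k → r * ∣ s ∣ * recip 0<w < ℕ→ℚ (suc k) → r * (s * unit k) < w
  small-step k t<n = *-cancelʳ-< {c = ℕ→ℚ (suc k)} (ℕ→ℚ-0≤ (suc k))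
    (subst (_< w * ℕ→ℚ (suc k)) eq (≤-<-trans (*-monoˡ-≤ (<⇒≤ 0<r) (p≤∣p∣ s))
      (subst₂ _<_ (recip-cancel 0<w (r * ∣ s ∣)) (*-comm (ℕ→ℚ (suc k)) w) (*-monoʳ-< 0<w t<n))))
    where
    eq : r * s ≡ r * (s * unit k) * ℕ→ℚ (suc k)
    eq = trans (sym (*-unit-cancel k (r * s)))
      (solve 4 (λ n r s v → n :* (r :* s :* v) := r :* (s :* v) :* n) refl (ℕ→ℚ (suc k)) r s (unit k))

power-above : ∀ {p r} k → 0ℚ < p → p < r → r * (q * q * unit k) < r - p →
              0ℚ < base q k → 0ℚ < base (- q) k → base q k ^ suc k ≤ p →
              1ℚ < r * base (- q) k ^ suc k
power-above {q} {p} {r} k 0<p p<r small 0<A 0<B A≤p =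
  finish (base q k ^ suc k) (base (- q) k ^ suc k) A≤p (^-0< (suc k) 0<B) (power-≥ {q} {(- q)} k 0<A 0<B)
  where
  open ≤-Reasoning
  0<r = <-trans 0<p p<r
  finish : ∀ A B → A ≤ p → 0ℚ < B → 1ℚ + (q + - q + q * - q * unit k) ≤ A * B → 1ℚ < r * B
  finish A B A≤p 0<B AB≥ = 1<-cancel 0<p (begin-strict
    p                                             <⟨ <-by (0<-diff small) (solve 3 (λ p r s → r :- r :* s :- p := (r :- p) :- r :* s) refl p r (q * q * unit k)) ⟩
    r - r * (q * q * unit k)                      ≡⟨ solve 3 (λ r q v → r :- r :* (q :* q :* v) := r :* (con 1ℚ :+ (q :+ :- q :+ q :* :- q :* v))) refl r q (unit k) ⟩
    r * (1ℚ + (q + - q + q * - q * unit k))       ≤⟨ *-monoˡ-≤ (<⇒≤ 0<r) AB≥ ⟩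
    r * (A * B)                                   ≤⟨ *-monoˡ-≤ (<⇒≤ 0<r) (*-monoʳ-≤ (<⇒≤ 0<B) A≤p) ⟩
    r * (p * B)                                   ≡⟨ solve 3 (λ r p B → r :* (p :* B) := p :* (r :* B)) refl r p B ⟩
    p * (r * B)                                   ∎)

-- expℚ q is the common limit of the sequences (1 + q/n)^n, which increases
-- as long as 1 + q/n > 0, and 1 / (1 - q/n)^n, which decreases as long as
-- 1 - q/n > 0; here n = k + 1 and base q k = 1 + q/n.

expℚ : ℚ → ℝ
expℚ q = record
  { L = Lower
  ; U = Upper
  ; L-inhab = let (k , 0<A) = positive-base q in 0ℚ , k , 0<A , ^-0< (suc k) 0<A
  ; U-inhab =
      let (k , 0<B) = positive-base (- q)
          0<Bⁿ = ^-0< (suc k) 0<B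
          (p , 1/B<p) = larger (1ℚ * recip 0<Bⁿ)
      in p , k , 0<B , recip<⇒1< 0<Bⁿ 1/B<p
  ; L-down = λ p<r (k , 0<A , r<A) → k , 0<A , <-trans p<r r<A
  ; U-up = λ p<r (k , 0<B , 1<pB) → k , 0<B , <-trans 1<pB (*-monoʳ-< (^-0< (suc k) 0<B) p<r)
  ; L-round = λ (k , 0<A , p<A) → let (r , p<r , r<A) = <-dense p<A in r , p<r , k , 0<A , r<A
  ; U-round = λ (k , 0<B , 1<rB) →
      let 0<Bⁿ = ^-0< (suc k) 0<B
          (p , 1/B<p , p<r) = <-dense (1<⇒recip< 0<Bⁿ 1<rB)
      in p , p<r , k , 0<B , recip<⇒1< 0<Bⁿ 1/B<p
  ; disjoint = λ (k , 0<A , p<A) (j , 0<B , 1<pB) →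
      <-irrefl refl (<-≤-trans (<-trans 1<pB (*-monoʳ-< (^-0< (suc j) 0<B) p<A)) (power-≤ {q} k j 0<A 0<B))
  ; located = loc
  }
  where
  Lower Upper : ℚ → Set
  Lower p = ∃ λ k → 0ℚ < base q k × p < base q k ^ suc k
  Upper p = ∃ λ k → 0ℚ < base (- q) k × 1ℚ < p * base (- q) k ^ suc k

  positive-base : ∀ q → ∃ λ k → 0ℚ < base q k
  positive-base q = let (k , -q<n) = archimedean (- q) in k , base-0< k -q<n

  decide : ∀ {p r} k → 0ℚ < p → p < r → r * (q * q * unit k) < r - p →
           0ℚ < base q k → 0ℚ < base (- q) k → Dec (p < base q k ^ suc k) → Lower p ⊎ Upper r
  decide k _ _ _ 0<A _ (yes p<A) = inj₁ (k , 0<A , p<A)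
  decide k 0<p p<r small 0<A 0<B (no p≮A) =
    inj₂ (k , 0<B , power-above {q} k 0<p p<r small 0<A 0<B (≮⇒≥ p≮A))

  loc : ∀ {p r} → p < r → Lower p ⊎ Upper r
  loc {p} {r} p<r = cases (0ℚ <? p)
    where
    cases : Dec (0ℚ < p) → Lower p ⊎ Upper r
    cases (no 0≮p) = let (k , 0<A) = positive-base q in
      inj₁ (k , 0<A , ≤-<-trans (≮⇒≥ 0≮p) (^-0< (suc k) 0<A))
    cases (yes 0<p) =
      let (k , small , -q<n , q<n) = step-size q (q * q) (<-trans 0<p p<r) (0<-diff p<r) in
      decide k 0<p p<r small (base-0< k -q<n)
        (base-0< k (subst (_< ℕ→ℚ (suc k)) (sym (-‿inv q)) q<n)) (p <? base q k ^ suc k)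

exp-L-shrink : ∀ q → L (expℚ q) p → ∃ λ r → r < q × L (expℚ r) p
exp-L-shrink {p} q (k , 0<A , p<A) =
  let (b , 0<b , b<A , p<b) = ^-shrink (suc k) 0<A p<A
      eq = base-unbase b k
  in unbase b k , base-cancel-< k (subst (_< base q k) (sym eq) b<A)
   , k , subst (0ℚ <_) (sym eq) 0<b , subst (λ b → p < b ^ suc k) (sym eq) p<b

exp-U-grow : ∀ q → U (expℚ q) p → ∃ λ r → q < r × U (expℚ r) p
exp-U-grow {p} q (k , 0<B , 1<pB) =
  let 0<p = 0<first (^-0< (suc k) 0<B) 1<pB
      (b , 0<b , b<B , 1/p<b) = ^-shrink (suc k) 0<B
         (1<⇒recip< 0<p (subst (1ℚ <_) (*-comm p (base (- q) k ^ suc k)) 1<pB))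
      r = unbase b k
      eq : base (- (- r)) k ≡ b
      eq = trans (cong (λ q → base q k) (-‿inv r)) (base-unbase b k)
      r<-q = base-cancel-< k (subst (_< base (- q) k) (sym (base-unbase b k)) b<B)
  in - r , subst (_< - r) (-‿inv q) (neg-swap-< r<-q)
   , k , subst (0ℚ <_) (sym eq) 0<b
   , subst (λ b → 1ℚ < p * b ^ suc k) (sym eq)
       (subst (1ℚ <_) (*-comm (b ^ suc k) p) (recip<⇒1< 0<p 1/p<b))
  where
  0<first : ∀ {b} → 0ℚ < b → 1ℚ < p * b → 0ℚ < p
  0<first {b} 0<b 1<pb =
    *-cancelʳ-< {c = b} (<⇒≤ 0<b) (subst (_< p * b) (sym (*-zeroˡ b)) (<-trans 0<1 1<pb))

exp-L-mono : q < r → L (expℚ q) p → L (expℚ r) p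
exp-L-mono q<r (k , 0<A , p<A) =
  let A<A′ = base-mono-< k q<r in
  k , <-trans 0<A A<A′ , <-≤-trans p<A (^-mono-≤ (suc k) (<⇒≤ 0<A) (<⇒≤ A<A′))

exp-U-mono : 0ℚ < p → q < r → U (expℚ r) p → U (expℚ q) p
exp-U-mono 0<p q<r (k , 0<B , 1<pB) =
  let B<B′ = base-mono-< k (neg-swap-< q<r) in
  k , <-trans 0<B B<B′ , <-≤-trans 1<pB (*-monoˡ-≤ (<⇒≤ 0<p) (^-mono-≤ (suc k) (<⇒≤ 0<B) (<⇒≤ B<B′)))

0<expℚ : ∀ q → 0ᵣ <ᵣ expℚ q
0<expℚ q = L-round (expℚ q) (proj₂ (L-inhab (expℚ q)))

exp-unbounded : ∀ p → ∃ λ q → L (expℚ q) p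
exp-unbounded p =
  let (b , p<b , 0<b) = above p 0ℚ
      eq = base-unbase b 0
  in unbase b 0 , 0 , subst (0ℚ <_) (sym eq) 0<b
   , subst (λ b → p < b ^ 1) (sym eq) (subst (p <_) (sym (*-identityʳ b)) p<b)

exp-small : 0ℚ < p → ∃ λ q → U (expℚ q) p
exp-small {p} 0<p =
  let (b , 1/p<b , 0<b) = above (1ℚ * recip 0<p) 0ℚ
      r = unbase b 0
      eq : base (- (- r)) 0 ≡ b
      eq = trans (cong (λ q → base q 0) (-‿inv r)) (base-unbase b 0)
  in - r , 0 , subst (0ℚ <_) (sym eq) 0<b
   , subst (λ b → 1ℚ < p * b ^ 1) (sym eq)
       (subst (λ b → 1ℚ < p * b) (sym (*-identityʳ b))
         (subst (1ℚ <_) (*-comm b p) (recip<⇒1< 0<p 1/p<b)))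

exp-gap : q < r → ∃₂ λ a b → U (expℚ q) a × a < b × L (expℚ r) b
exp-gap {q} {r} q<r =
  let (k , -m<n , m<n , z) = steps
      0<A = base-0< {r} k -m<n
      0<B = base-0< { - q} k m<n
      0<Bⁿ = ^-0< (suc k) 0<B
      1<AB = <-≤-trans z (power-≥ {r} { - q} k 0<A 0<B)
      (a , 1/B<a , a<A) = <-dense (1<⇒recip< 0<Bⁿ 1<AB)
      (b , a<b , b<A) = <-dense a<A
  in a , b , (k , 0<B , recip<⇒1< 0<Bⁿ 1/B<a) , a<b , (k , 0<A , b<A)
  where
  m = ∣ q ∣ + ∣ r ∣

  -r≤m : - r ≤ m
  -r≤m = ≤-trans (-p≤∣p∣ r) (≤-by (0≤∣p∣ q) (solve 2 (λ q r → q :+ r :- r := q) refl ∣ q ∣ ∣ r ∣))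

  q≤m : - - q ≤ m
  q≤m = subst (_≤ m) (sym (-‿inv q))
    (≤-trans (p≤∣p∣ q) (≤-by (0≤∣p∣ r) (solve 2 (λ q r → q :+ r :- q := r) refl ∣ q ∣ ∣ r ∣)))

  steps : ∃ λ k → - r < ℕ→ℚ (suc k) × - - q < ℕ→ℚ (suc k) × 1ℚ < 1ℚ + (r + - q + r * - q * unit k)
  steps = 
    let (k , small , _ , m<n) = step-size {1ℚ} m (r * q) 0<1 (0<-diff q<r) in
    k , ≤-<-trans -r≤m m<n , ≤-<-trans q≤m m<n
      , <-by (0<-diff small) (solve 3 (λ q r v →
          con 1ℚ :+ (r :+ :- q :+ r :* :- q :* v) :- con 1ℚ := r :- q :- con 1ℚ :* (r :* q :* v)) refl q r (unit k))

-- For positive x, the cut of ln x is { q | exp q < x } , { r | x < exp r }.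

ln : (x : ℝ) → 0ᵣ <ᵣ x → ℝ
ln x 0<x@(l₀ , 0<l₀ , Ll₀) = record
  { L = λ q → expℚ q <ᵣ x
  ; U = λ r → x <ᵣ expℚ r
  ; L-inhab = let (q , Uq) = exp-small 0<l₀ in q , l₀ , Uq , Ll₀
  ; U-inhab = let (u , Uu) = U-inhab x ; (r , Lr) = exp-unbounded u in r , u , Uu , Lr
  ; L-down = λ {p} {q} p<q (a , Ua , La) → a , exp-U-mono {a} {p} {q} (0<U (expℚ q) (0<expℚ q) Ua) p<q Ua , La
  ; U-up = λ {p} {q} p<q (b , Ub , Lb) → b , Ub , exp-L-mono {p} {q} {b} p<q Lb
  ; L-round = λ {p} (a , Ua , La) → let (q , p<q , Ua′) = exp-U-grow {a} p Ua in q , p<q , a , Ua′ , La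
  ; U-round = λ {q} (b , Ub , Lb) → let (p , p<q , Lb′) = exp-L-shrink {b} q Lb in p , p<q , b , Ub , Lb′
  ; disjoint = λ {p} (a , Ua , La) (b , Ub , Lb) → <-asym {a} {b} (L<U x La Ub) (L<U (expℚ p) Lb Ua)
  ; located = loc
  }
  where
  loc : p < q → expℚ p <ᵣ x ⊎ x <ᵣ expℚ q
  loc p<q =
    let (a , b , Ua , a<b , Lb) = exp-gap p<q in
    Sum.map (λ La → a , Ua , La) (λ Ub → b , Ub , Lb) (located x a<b)

private
  variable
    ℓ : Level
    A : Set
    n : ℕ

-- Entries are counted with multiplicity; the empty list has proportion 0.

proportion : {P : Pred A ℓ} → Decidable P → List A → ℚ
proportion P? []            = 0ℚ
proportion P? xs@(_ ∷ tail) = ℤ.+ length (List.filter P? xs) / suc (length tail)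

-- A random element of a list Ω is uniform on its positions. An event E lies
-- in Ω with probability at least p if every decidable event containing E
-- has proportion at least p. For decidable E this is the same as E itself
-- having proportion at least p; events that compare with real thresholds
-- cannot in general be decided, so that counting them directly would
-- require excluded middle.

Probability≥ : List A → ℝ → Pred A ℓ → Set (lsuc ℓ)
Probability≥ {A = A} {ℓ = ℓ} Ω p E =
  ∀ {B : Pred A ℓ} (B? : Decidable B) → E ⊆ B → p ≤ᵣ ℚ→ℝ (proportion B? Ω)

length-filter-mono : {P Q : Pred A ℓ} (P? : Decidable P) (Q? : Decidable Q) → P ⊆ Q →
                     ∀ xs → length (List.filter P? xs) ℕ.≤ length (List.filter Q? xs)
length-filter-mono P? Q? P⊆Q [] = ℕ.z≤n
length-filter-mono P? Q? P⊆Q (x ∷ xs) with P? x | Q? x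
... | yes _ | yes _ = ℕ.s≤s (length-filter-mono P? Q? P⊆Q xs)
... | yes p | no ¬q = contradiction (P⊆Q p) ¬q
... | no _  | yes _ = ℕ.m≤n⇒m≤1+n (length-filter-mono P? Q? P⊆Q xs)
... | no _  | no _  = length-filter-mono P? Q? P⊆Q xs

/-mono-≤ : ∀ {a b} d → a ℕ.≤ b → ℤ.+ a / suc d ≤ ℤ.+ b / suc d
/-mono-≤ {a} {b} d a≤b = toℚᵘ-cancel-≤
  (ℚᵘ.≤-respˡ-≃ (ℚᵘ.≃-sym (toℚᵘ-fromℚᵘ (ℚᵘ.mkℚᵘ (ℤ.+ a) d)))
    (ℚᵘ.≤-respʳ-≃ (ℚᵘ.≃-sym (toℚᵘ-fromℚᵘ (ℚᵘ.mkℚᵘ (ℤ.+ b) d)))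
      (ℚᵘ.*≤* (ℤ.*-monoʳ-≤-nonNeg (ℤ.+ suc d) (ℤ.+≤+ a≤b)))))

proportion-mono : {P Q : Pred A ℓ} (P? : Decidable P) (Q? : Decidable Q) → P ⊆ Q →
                  ∀ xs → proportion P? xs ≤ proportion Q? xs
proportion-mono P? Q? P⊆Q []          = ≤-refl
proportion-mono P? Q? P⊆Q xs@(_ ∷ tail) = /-mono-≤ (length tail) (length-filter-mono P? Q? P⊆Q xs)

Probability≥-decidable : ∀ (Ω : List A) p {E : Pred A ℓ} (E? : Decidable E) →
                         Probability≥ Ω p E ⇔ p ≤ᵣ ℚ→ℝ (proportion E? Ω)
Probability≥-decidable Ω p E? = mk⇔
  (λ pr → pr E? (λ e → e))
  (λ p≤ {B} B? E⊆B (q , B<q , q<p) → p≤ (q , ≤-<-trans (proportion-mono E? B? E⊆B Ω) B<q , q<p))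

-- The sequences of t independent draws with replacement from xs, listed
-- with multiplicity.

draws : ℕ → List A → List (List A)
draws zero    xs = [] ∷ []
draws (suc t) xs = List.cartesianProductWith _∷_ xs (draws t xs)

Itemset : ℕ → Set
Itemset = Subset

Dataset : ℕ → Set
Dataset n = List (Subset n)

_∈U_ : Itemset n → ℕ → Set
x ∈U w = 1 ℕ.≤ Subset.∣ x ∣ × Subset.∣ x ∣ ℕ.≤ w

_∈U?_ : ∀ (x : Itemset n) w → Dec (x ∈U w)
x ∈U? w = 1 ℕ.≤? Subset.∣ x ∣ ×-dec Subset.∣ x ∣ ℕ.≤? w

subsets : ∀ n → List (Subset n)
subsets zero    = Vec.[] ∷ []
subsets (suc n) = List.map (outside Vec.∷_) (subsets n) ++ List.map (inside Vec.∷_) (subsets n)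

U-list : ∀ n → ℕ → List (Itemset n)
U-list n w = List.filter (_∈U? w) (subsets n)

∣U∣ : ℕ → ℕ → ℕ
∣U∣ n w = length (U-list n w)

frequency : Dataset n → Itemset n → ℚ
frequency T x = proportion (x Subset.⊆?_) T

module _ (T : Dataset n) where

  decreasingFrequency : DecTotalOrder 0ℓ 0ℓ 0ℓ
  decreasingFrequency = On.decTotalOrder (Flip.decTotalOrder ≤-decTotalOrder) (frequency T)

  ranking : ℕ → List (Itemset n)
  ranking w = Sort.sort decreasingFrequency (U-list n w)

  -- K counts from 1; the default value is irrelevant for 1 ≤ K ≤ ∣U∣ n w.

  kthFrequency : ℕ → ℕ → ℚ
  kthFrequency K w =
    fromMaybe 0ℚ (List.head (List.drop (K ℕ.∸ 1) (List.map (frequency T) (ranking w))))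

-- Sets of pairs (x , f), where pairs are compared up to equality of reals.

PairSet : ℕ → Set₁
PairSet n = Itemset n × ℝ → Set

TOPK : Dataset n → ℕ → ℕ → PairSet n
TOPK T K w (x , f) = x ∈U w × f ≃ᵣ ℚ→ℝ (frequency T x) × kthFrequency T K w ≤ frequency T x

HasAtLeast : ℕ → PairSet n → Set₁
HasAtLeast {n} K W = Σ (Fin K → Itemset n × ℝ) λ v →
  (∀ i → W (v i)) ×
  (∀ i j → proj₁ (v i) ≡ proj₁ (v j) → proj₂ (v i) ≃ᵣ proj₂ (v j) → i ≡ j)

record IsApproximation (ε : ℝ) (D : Dataset n) (K w : ℕ) (W : PairSet n) : Set₁ where
  fᴷ : ℝ
  fᴷ = ℚ→ℝ (kthFrequency D K w)

  f : Itemset n → ℝ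
  f x = ℚ→ℝ (frequency D x)

  field
    enough   : HasAtLeast K W
    itemsets : ∀ x g → W (x , g) → x ∈U w
    unitary  : ∀ x g → W (x , g) → 0ᵣ ≤ᵣ g × g ≤ᵣ 1ᵣ
    P1       : ∀ x g → W (x , g) → fᴷ -ᵣ ε ≤ᵣ f x
    P2       : ∀ x → x ∈U w → ¬ (∃ λ g → W (x , g)) → f x <ᵣ fᴷ +ᵣ ε
    P3       : ∀ x g → W (x , g) → ∣ g -ᵣ f x ∣ᵣ ≤ᵣ ε

subsets-complete : ∀ (x : Subset n) → x ∈ subsets n
subsets-complete Vec.[]             = here refl
subsets-complete (outside Vec.∷ x)  = ∈.∈-++⁺ˡ (∈.∈-map⁺ (outside Vec.∷_) (subsets-complete x))
subsets-complete {suc n} (inside Vec.∷ x) =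
  ∈.∈-++⁺ʳ (List.map (outside Vec.∷_) (subsets n)) (∈.∈-map⁺ (inside Vec.∷_) (subsets-complete x))

U-list-complete : ∀ {w} (x : Itemset n) → x ∈U w → x ∈ U-list n w
U-list-complete {w = w} x x∈U = ∈.∈-filter⁺ (_∈U? w) (subsets-complete x) x∈U

ofSize : ℕ → List (Subset n) → ℕ
ofSize k xs = length (List.filter (λ x → Subset.∣ x ∣ ℕ.≟ k) xs)

ofSize-++ : ∀ k (xs ys : List (Subset n)) → ofSize k (xs ++ ys) ≡ ofSize k xs ℕ.+ ofSize k ys
ofSize-++ k xs ys = trans
  (cong length (List.filter-++ (λ x → Subset.∣ x ∣ ℕ.≟ k) xs ys))
  (List.length-++ (List.filter (λ x → Subset.∣ x ∣ ℕ.≟ k) xs))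

ofSize-outside : ∀ k (xs : List (Subset n)) → ofSize k (List.map (outside Vec.∷_) xs) ≡ ofSize k xs
ofSize-outside k [] = refl
ofSize-outside k (x ∷ xs) with Subset.∣ x ∣ ℕ.≡ᵇ k
... | true  = cong suc (ofSize-outside k xs)
... | false = ofSize-outside k xs

ofSize-inside : ∀ k (xs : List (Subset n)) → ofSize (suc k) (List.map (inside Vec.∷_) xs) ≡ ofSize k xs
ofSize-inside k [] = refl
ofSize-inside k (x ∷ xs) with Subset.∣ x ∣ ℕ.≡ᵇ k
... | true  = cong suc (ofSize-inside k xs)
... | false = ofSize-inside k xs

ofSize-inside-zero : ∀ (xs : List (Subset n)) → ofSize 0 (List.map (inside Vec.∷_) xs) ≡ 0
ofSize-inside-zero []       = refl
ofSize-inside-zero (x ∷ xs) = ofSize-inside-zero xs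

ofSize-subsets : ∀ n k → ofSize k (subsets n) ≡ n C k
ofSize-subsets zero    zero    = refl
ofSize-subsets zero    (suc k) = refl
ofSize-subsets (suc n) zero    = trans
  (ofSize-++ 0 (List.map (outside Vec.∷_) (subsets n)) _)
  (trans (cong₂ ℕ._+_ (ofSize-outside 0 (subsets n)) (ofSize-inside-zero (subsets n)))
    (trans (ℕ.+-identityʳ _) (ofSize-subsets n 0)))
ofSize-subsets (suc n) (suc k) = trans
  (ofSize-++ (suc k) (List.map (outside Vec.∷_) (subsets n)) _)
  (trans (cong₂ ℕ._+_ (trans (ofSize-outside (suc k) (subsets n)) (ofSize-subsets n (suc k)))
                      (trans (ofSize-inside k (subsets n)) (ofSize-subsets n k)))
    (trans (ℕ.+-comm (n C suc k) (n C k)) (nCk+nC[k+1]≡[n+1]C[k+1] n k)))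

length-filter-⊎ : {P Q R : Pred A 0ℓ} (P? : Decidable P) (Q? : Decidable Q) (R? : Decidable R) →
  (∀ {x} → R x → P x ⊎ Q x) → P ⊆ R → Q ⊆ R → (∀ {x} → P x → ¬ Q x) → ∀ xs →
  length (List.filter R? xs) ≡ length (List.filter P? xs) ℕ.+ length (List.filter Q? xs)
length-filter-⊎ P? Q? R? R⇒ P⊆R Q⊆R P⇒¬Q [] = refl
length-filter-⊎ P? Q? R? R⇒ P⊆R Q⊆R P⇒¬Q (x ∷ xs)
  with ih ← length-filter-⊎ P? Q? R? R⇒ P⊆R Q⊆R P⇒¬Q xs | P? x | Q? x | R? x
... | yes p | yes q | _     = contradiction q (P⇒¬Q p)
... | yes p | no _  | yes _ = cong suc ih
... | yes p | no _  | no ¬r = contradiction (P⊆R p) ¬r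
... | no _  | yes q | yes _ = trans (cong suc ih) (sym (ℕ.+-suc _ _))
... | no _  | yes q | no ¬r = contradiction (Q⊆R q) ¬r
... | no _  | no _  | no _  = ih
... | no ¬p | no ¬q | yes r with R⇒ r
...   | inj₁ p = contradiction p ¬p
...   | inj₂ q = contradiction q ¬q

∈U-suc : ∀ w (xs : List (Subset n)) →
         length (List.filter (_∈U? suc w) xs) ≡ length (List.filter (_∈U? w) xs) ℕ.+ ofSize (suc w) xs
∈U-suc w = length-filter-⊎ (_∈U? w) (λ x → Subset.∣ x ∣ ℕ.≟ suc w) (_∈U? suc w)
  (λ {x} → split x)
  (λ (1≤ , ≤w) → 1≤ , ℕ.m≤n⇒m≤1+n ≤w)
  (λ eq → subst (1 ℕ.≤_) (sym eq) (ℕ.s≤s ℕ.z≤n) , ℕ.≤-reflexive eq)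
  (λ (_ , ≤w) eq → contradiction (subst (ℕ._≤ w) eq ≤w) ℕ.1+n≰n)
  where
  split : ∀ x → x ∈U suc w → x ∈U w ⊎ Subset.∣ x ∣ ≡ suc w
  split x (1≤ , ≤1+w) with Subset.∣ x ∣ ℕ.≟ suc w
  ... | yes eq = inj₂ eq
  ... | no ≢   = inj₁ (1≤ , ℕ.≤-pred (ℕ.≤∧≢⇒< ≤1+w ≢))

∣U∣-zero : ∀ (xs : List (Subset n)) → length (List.filter (_∈U? 0) xs) ≡ 0
∣U∣-zero xs = cong length (List.filter-none (_∈U? 0) (All.universal (λ _ (1≤ , ≤0) → ℕ.1+n≰n (ℕ.≤-trans 1≤ ≤0)) xs))

∣U∣≡ΣC : ∀ n w → ∣U∣ n w ≡ sum (List.applyUpTo (λ i → n C suc i) w)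
∣U∣≡ΣC n zero    = ∣U∣-zero (subsets n)
∣U∣≡ΣC n (suc w) = begin
  ∣U∣ n (suc w)                                                      ≡⟨ ∈U-suc w (subsets n) ⟩
  ∣U∣ n w ℕ.+ ofSize (suc w) (subsets n)                             ≡⟨ cong₂ ℕ._+_ (∣U∣≡ΣC n w) (ofSize-subsets n (suc w)) ⟩
  sum (List.applyUpTo binom w) ℕ.+ binom w                              ≡⟨ cong (sum (List.applyUpTo binom w) ℕ.+_) (sym (ℕ.+-identityʳ (binom w))) ⟩
  sum (List.applyUpTo binom w) ℕ.+ sum (binom w ∷ [])              ≡⟨ sym (sum-++ (List.applyUpTo binom w) (binom w ∷ [])) ⟩
  sum (List.applyUpTo binom w ++ binom w ∷ [])                          ≡⟨ cong sum (List.applyUpTo-∷ʳ binom w) ⟩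
  sum (List.applyUpTo binom (suc w))                                ∎
  where
  open ≡-Reasoning
  binom : ℕ → ℕ
  binom i = n C suc i

IsCeiling : ℝ → ℕ → Set
IsCeiling x t = x ≤ᵣ ℕ→ℝ t × ℕ→ℝ t <ᵣ x +ᵣ 1ᵣ

2m+K[m-K]-pos : ∀ {m K} → 1 ℕ.≤ K → K ℕ.≤ m → 0 ℕ.< 2 ℕ.* m ℕ.+ K ℕ.* (m ℕ.∸ K)
2m+K[m-K]-pos {m} {K} 1≤K K≤m =
  ℕ.≤-trans (ℕ.≤-trans 1≤K K≤m) (ℕ.≤-trans (ℕ.m≤m+n m (m ℕ.+ 0)) (ℕ.m≤m+n (2 ℕ.* m) (K ℕ.* (m ℕ.∸ K))))

module Submission where

-- To each of 2m + K(m - K) bad events one attaches a nonnegative rational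
-- weight g on transactions whose mean over D is at most β = 1 - e²/2 and whose product
-- over a sample is at least 1 whenever the bad event occurs. Products of
-- weights have mean at most βᵗ over all samples, so by Markov's inequality
-- and the union bound some bad event occurs with probability at most
-- (2m + K(m - K)) βᵗ. The bad events are: an itemset frequency is off by more
-- than e, upwards or downwards, and an itemset x among the first K of D does
-- not beat in the sample an itemset y outside them although
-- f_D(x) ≥ f_D(y) + e. The latter event concerns the sum of 1[x ⊆ T] - 1[y ⊆ T],
-- of mean at least e, being nonpositive; there the tilt
-- (1 + e)^(1[y ⊆ T] - 1[x ⊆ T]) has mean at most 1 - e²/2.
-- If no bad event occurs, P1 and P2 follow by counting the itemsets above the
-- K-th sample frequency. Finally β ≤ exp (-e²/2), and since the probability
-- bound is only compared with rationals above δ, e may be taken rational and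
-- slightly below ε.

open import Defs

module Sampling where

  open import Algebra.Bundles using (CommutativeRing)
  open import Data.Fin.Base using (Fin; zero; suc)
  open import Data.Fin.Subset as Subset using (Subset; inside; outside)
  import Data.Fin.Subset.Properties as Subset
  import Data.Integer.Base as ℤ
  import Data.Integer.Properties as ℤ
  open import Data.List.Base as List using (List; []; _∷_; _++_; length; take; drop)
  import Data.List.Properties as List
  import Data.List.Sort as Sort
  open import Data.List.Membership.Propositional using (_∈_; find; lose)
  import Data.List.Membership.Propositional.Properties as ∈
  open import Data.List.Relation.Binary.Permutation.Propositional using (_↭_; ↭-sym; ↭-trans; ↭⇒↭ₛ)
  import Data.List.Relation.Binary.Permutation.Propositional.Properties as ↭
  import Data.List.Relation.Binary.Permutation.Setoid.Properties as ↭ₛ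
  open import Data.List.Relation.Unary.All as All using (All; []; _∷_)
  import Data.List.Relation.Unary.All.Properties as All
  open import Data.List.Relation.Unary.AllPairs using (AllPairs; []; _∷_)
  open import Data.List.Relation.Unary.Any as Any using (Any; here; there)
  open import Data.List.Relation.Unary.Sorted.TotalOrder.Properties using (Sorted⇒AllPairs)
  open import Data.List.Relation.Unary.Unique.Propositional using (Unique)
  import Data.List.Relation.Unary.Unique.Propositional.Properties as Unique
  open import Data.Maybe.Base using (fromMaybe)
  open import Data.Nat.Base as ℕ using (ℕ; zero; suc)
  import Data.Nat.Properties as ℕ
  open import Data.Product using (∃; ∃₂; _×_; _,_; proj₁; proj₂)
  open import Data.Rational
  open import Data.Rational.Properties
  open import Data.Rational.Solver using (module +-*-Solver)
  import Data.Rational.Unnormalised as ℚᵘ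
  import Data.Rational.Unnormalised.Properties as ℚᵘ
  open import Data.Sum using (_⊎_; inj₁; inj₂)
  import Data.Vec.Base as Vec
  import Data.Vec.Properties as Vec
  open import Function.Base using (_∘_)
  open import Level using (Level)
  open import Relation.Binary.Bundles using (DecTotalOrder)
  open import Relation.Binary.PropositionalEquality hiding (J)
  open import Relation.Nullary using (¬_; yes; no; contradiction)
  open import Relation.Unary using (Pred; Decidable)
  open import Relation.Unary.Properties using (∁?)

  open import Algebra.Definitions.RawSemiring +-*-rawSemiring using (_^_)
  import Algebra.Properties.CommutativeSemiring.Exp
    (CommutativeRing.commutativeSemiring +-*-commutativeRing) as Exp

  open +-*-Solver
  open ℝ

  private
    variable
      ℓ : Level
      A : Set

  -- Potentials on samples

  sumOf : (A → ℚ) → List A → ℚ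
  sumOf f []       = 0ℚ
  sumOf f (x ∷ xs) = f x + sumOf f xs

  prodOf : (A → ℚ) → List A → ℚ
  prodOf f []       = 1ℚ
  prodOf f (x ∷ xs) = f x * prodOf f xs

  sumOf-mono : ∀ {f g : A → ℚ} → (∀ x → f x ≤ g x) → ∀ xs → sumOf f xs ≤ sumOf g xs
  sumOf-mono f≤g []       = ≤-refl
  sumOf-mono f≤g (x ∷ xs) = +-mono-≤ (f≤g x) (sumOf-mono f≤g xs)

  sumOf-cong : ∀ {f g : A → ℚ} → (∀ x → f x ≡ g x) → ∀ xs → sumOf f xs ≡ sumOf g xs
  sumOf-cong f≡g []       = refl
  sumOf-cong f≡g (x ∷ xs) = cong₂ _+_ (f≡g x) (sumOf-cong f≡g xs)

  sumOf-+ : ∀ (f g : A → ℚ) xs → sumOf (λ x → f x + g x) xs ≡ sumOf f xs + sumOf g xs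
  sumOf-+ f g []       = refl
  sumOf-+ f g (x ∷ xs) = trans (cong (f x + g x +_) (sumOf-+ f g xs))
    (solve 4 (λ a b c d → (a :+ b) :+ (c :+ d) := (a :+ c) :+ (b :+ d)) refl (f x) (g x) (sumOf f xs) (sumOf g xs))

  sumOf-* : ∀ c (f : A → ℚ) xs → sumOf (λ x → c * f x) xs ≡ c * sumOf f xs
  sumOf-* c f []       = sym (*-zeroʳ c)
  sumOf-* c f (x ∷ xs) = trans (cong (c * f x +_) (sumOf-* c f xs)) (sym (*-distribˡ-+ c (f x) (sumOf f xs)))

  sumOf-const : ∀ c (xs : List A) → sumOf (λ _ → c) xs ≡ ℕ→ℚ (length xs) * c
  sumOf-const c []       = sym (*-zeroˡ c)
  sumOf-const c (x ∷ xs) = trans (cong (c +_) (sumOf-const c xs))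
    (trans (solve 2 (λ c n → c :+ n :* c := (con 1ℚ :+ n) :* c) refl c (ℕ→ℚ (length xs)))
      (cong (_* c) (sym (ℕ→ℚ-suc (length xs)))))

  sumOf-++ : ∀ (f : A → ℚ) xs ys → sumOf f (xs ++ ys) ≡ sumOf f xs + sumOf f ys
  sumOf-++ f []       ys = sym (+-identityˡ (sumOf f ys))
  sumOf-++ f (x ∷ xs) ys = trans (cong (f x +_) (sumOf-++ f xs ys)) (sym (+-assoc (f x) (sumOf f xs) (sumOf f ys)))

  sumOf-map : ∀ {B : Set} (f : B → ℚ) (h : A → B) xs → sumOf f (List.map h xs) ≡ sumOf (f ∘ h) xs
  sumOf-map f h []       = refl
  sumOf-map f h (x ∷ xs) = cong (f (h x) +_) (sumOf-map f h xs)

  sumOf-0≤ : ∀ {f : A → ℚ} → (∀ x → 0ℚ ≤ f x) → ∀ xs → 0ℚ ≤ sumOf f xs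
  sumOf-0≤ 0≤f []       = ≤-refl
  sumOf-0≤ 0≤f (x ∷ xs) = +-0≤ (0≤f x) (sumOf-0≤ 0≤f xs)

  prodOf-0≤ : ∀ {f : A → ℚ} → (∀ x → 0ℚ ≤ f x) → ∀ xs → 0ℚ ≤ prodOf f xs
  prodOf-0≤ 0≤f []       = 0≤1
  prodOf-0≤ 0≤f (x ∷ xs) = *-0≤ (0≤f x) (prodOf-0≤ 0≤f xs)

  prodOf-* : ∀ (f g : A → ℚ) xs → prodOf (λ x → f x * g x) xs ≡ prodOf f xs * prodOf g xs
  prodOf-* f g []       = refl
  prodOf-* f g (x ∷ xs) = trans (cong (f x * g x *_) (prodOf-* f g xs))
    (solve 4 (λ a b c d → (a :* b) :* (c :* d) := (a :* c) :* (b :* d)) refl (f x) (g x) (prodOf f xs) (prodOf g xs))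

  -- Independence of the draws: expanding the t-th power of the sum yields one product for each
  -- sequence of t draws.
  sumOf-prodOf-draws : ∀ (f : A → ℚ) t xs → sumOf (prodOf f) (draws t xs) ≡ sumOf f xs ^ t
  sumOf-prodOf-draws f zero    xs = refl
  sumOf-prodOf-draws f (suc t) xs = trans (go xs) (cong (sumOf f xs *_) (sumOf-prodOf-draws f t xs))
    where
    S = draws t xs

    go : ∀ ys → sumOf (prodOf f) (List.cartesianProductWith _∷_ ys S) ≡ sumOf f ys * sumOf (prodOf f) S
    go []       = sym (*-zeroˡ (sumOf (prodOf f) S))
    go (y ∷ ys) = begin
      sumOf (prodOf f) (List.map (y ∷_) S ++ List.cartesianProductWith _∷_ ys S)
        ≡⟨ sumOf-++ (prodOf f) (List.map (y ∷_) S) _ ⟩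
      sumOf (prodOf f) (List.map (y ∷_) S) + sumOf (prodOf f) (List.cartesianProductWith _∷_ ys S)
        ≡⟨ cong₂ _+_ (trans (sumOf-map (prodOf f) (y ∷_) S) (sumOf-* (f y) (prodOf f) S)) (go ys) ⟩
      f y * sumOf (prodOf f) S + sumOf f ys * sumOf (prodOf f) S
        ≡⟨ sym (*-distribʳ-+ (sumOf (prodOf f) S) (f y) (sumOf f ys)) ⟩
      (f y + sumOf f ys) * sumOf (prodOf f) S ∎
      where open ≡-Reasoning

  count : {P : Pred A ℓ} → Decidable P → List A → ℕ
  count P? xs = length (List.filter P? xs)

  indicator : {P : Pred A ℓ} → Decidable P → A → ℚ
  indicator P? x with P? x
  ... | yes _ = 1ℚ
  ... | no  _ = 0ℚ

  sumOf-indicator : {P : Pred A ℓ} (P? : Decidable P) → ∀ xs → sumOf (indicator P?) xs ≡ ℕ→ℚ (count P? xs)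
  sumOf-indicator P? []       = refl
  sumOf-indicator P? (x ∷ xs) with P? x
  ... | yes _ = trans (cong (1ℚ +_) (sumOf-indicator P? xs)) (sym (ℕ→ℚ-suc (count P? xs)))
  ... | no  _ = trans (+-identityˡ (sumOf (indicator P?) xs)) (sumOf-indicator P? xs)

  /1+-cancel : ∀ k n → ℕ→ℚ (suc n) * (ℤ.+ k / suc n) ≡ ℕ→ℚ k
  /1+-cancel k n = toℚᵘ-injective (begin-equality
    toℚᵘ (ℕ→ℚ (suc n) * (ℤ.+ k / suc n))           ≃⟨ toℚᵘ-homo-* (ℕ→ℚ (suc n)) (ℤ.+ k / suc n) ⟩
    toℚᵘ (ℕ→ℚ (suc n)) ℚᵘ.* toℚᵘ (ℤ.+ k / suc n)   ≃⟨ ℚᵘ.*-cong (toℚᵘ-fromℚᵘ (ℚᵘ.mkℚᵘ (ℤ.+ suc n) 0)) (toℚᵘ-fromℚᵘ (ℚᵘ.mkℚᵘ (ℤ.+ k) n)) ⟩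
    ℚᵘ.mkℚᵘ (ℤ.+ suc n) 0 ℚᵘ.* ℚᵘ.mkℚᵘ (ℤ.+ k) n   ≃⟨ ℚᵘ.*≡* (trans (ℤ.*-identityʳ _) (trans (ℤ.*-comm (ℤ.+ suc n) (ℤ.+ k)) (cong (λ m → ℤ.+ k ℤ.* (ℤ.+ suc m)) (sym (ℕ.+-identityʳ n))))) ⟩
    ℚᵘ.mkℚᵘ (ℤ.+ k) 0                              ≃⟨ toℚᵘ-fromℚᵘ (ℚᵘ.mkℚᵘ (ℤ.+ k) 0) ⟨
    toℚᵘ (ℕ→ℚ k)                                   ∎)
    where open ℚᵘ.≤-Reasoning

  length*proportion : {P : Pred A ℓ} (P? : Decidable P) → ∀ xs →
                      ℕ→ℚ (length xs) * proportion P? xs ≡ ℕ→ℚ (count P? xs)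
  length*proportion P? []            = refl
  length*proportion P? xs@(_ ∷ tail) = /1+-cancel (count P? xs) (length tail)

  -- The bound is on the mean of `g` over `D`, multiplied out to avoid division by the length.
  IsPotential : ℚ → List A → (A → ℚ) → Set
  IsPotential β D g = (∀ x → 0ℚ ≤ g x) × sumOf g D ≤ ℕ→ℚ (length D) * β

  -- A bad event lifts at least one summand to 1, so this single sum serves for Markov's inequality
  -- and the union bound at once.
  total : List (A → ℚ) → List A → ℚ
  total gs S = sumOf (λ g → prodOf g S) gs

  total-draws : ∀ {β} {D : List A} {gs} t → All (IsPotential β D) gs →
                sumOf (total gs) (draws t D) ≤ ℕ→ℚ (length gs) * (ℕ→ℚ (length D) * β) ^ t
  total-draws {β = β} {D} t [] = ≤-reflexive
    (trans (sumOf-const 0ℚ (draws t D)) (trans (*-zeroʳ (ℕ→ℚ (length (draws t D)))) (sym (*-zeroˡ ((ℕ→ℚ (length D) * β) ^ t)))))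
  total-draws {β = β} {D} {g ∷ gs} t ((0≤g , g≤) ∷ pots) = begin
    sumOf (λ S → prodOf g S + total gs S) (draws t D)
      ≡⟨ sumOf-+ (prodOf g) (total gs) (draws t D) ⟩
    sumOf (prodOf g) (draws t D) + sumOf (total gs) (draws t D)
      ≤⟨ +-mono-≤ (≤-trans (≤-reflexive (sumOf-prodOf-draws g t D)) (^-mono-≤ t (sumOf-0≤ 0≤g D) g≤)) (total-draws t pots) ⟩
    c + ℕ→ℚ (length gs) * c
      ≡⟨ solve 2 (λ c n → c :+ n :* c := (con 1ℚ :+ n) :* c) refl c (ℕ→ℚ (length gs)) ⟩
    (1ℚ + ℕ→ℚ (length gs)) * c
      ≡⟨ cong (_* c) (sym (ℕ→ℚ-suc (length gs))) ⟩
    ℕ→ℚ (suc (length gs)) * c ∎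
    where
    open ≤-Reasoning
    c = (ℕ→ℚ (length D) * β) ^ t

  total-0≤ : ∀ {gs : List (A → ℚ)} → All (λ g → ∀ x → 0ℚ ≤ g x) gs → ∀ S → 0ℚ ≤ total gs S
  total-0≤ []          S = ≤-refl
  total-0≤ (0≤g ∷ 0≤gs) S = +-0≤ (prodOf-0≤ 0≤g S) (total-0≤ 0≤gs S)

  1≤total : ∀ {gs : List (A → ℚ)} {S} → All (λ g → ∀ x → 0ℚ ≤ g x) gs →
            Any (λ g → ¬ prodOf g S < 1ℚ) gs → 1ℚ ≤ total gs S
  1≤total {S = S} (0≤g ∷ 0≤gs) (here g≮1) = +-mono-≤ {1ℚ} {_} {0ℚ} (≮⇒≥ g≮1) (total-0≤ 0≤gs S)
  1≤total {S = S} (0≤g ∷ 0≤gs) (there any) = +-mono-≤ {0ℚ} {_} {1ℚ} (prodOf-0≤ 0≤g S) (1≤total {S = S} 0≤gs any)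

  -- Counting samples amounts to summing the product of the constant weight 1, an instance of
  -- `sumOf-prodOf-draws`.
  length-draws : ∀ t (xs : List A) → ℕ→ℚ (length (draws t xs)) ≡ ℕ→ℚ (length xs) ^ t
  length-draws t xs = begin
    ℕ→ℚ (length (draws t xs))             ≡⟨ sym (*-identityʳ (ℕ→ℚ (length (draws t xs)))) ⟩
    ℕ→ℚ (length (draws t xs)) * 1ℚ        ≡⟨ sym (sumOf-const 1ℚ (draws t xs)) ⟩
    sumOf (λ _ → 1ℚ) (draws t xs)         ≡⟨ sumOf-cong (λ S → sym (prodOf-1 S)) (draws t xs) ⟩
    sumOf (prodOf (λ _ → 1ℚ)) (draws t xs) ≡⟨ sumOf-prodOf-draws (λ _ → 1ℚ) t xs ⟩
    sumOf (λ _ → 1ℚ) xs ^ t               ≡⟨ cong (_^ t) (trans (sumOf-const 1ℚ xs) (*-identityʳ (ℕ→ℚ (length xs)))) ⟩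
    ℕ→ℚ (length xs) ^ t                   ∎
    where
    open ≡-Reasoning
    prodOf-1 : ∀ S → prodOf (λ _ → 1ℚ) S ≡ 1ℚ
    prodOf-1 []      = refl
    prodOf-1 (x ∷ S) = trans (*-identityˡ (prodOf (λ _ → 1ℚ) S)) (prodOf-1 S)

  0<length : ∀ {xs : List A} → xs ≢ [] → 0ℚ < ℕ→ℚ (length xs)
  0<length {xs = []}     xs≢[] = contradiction refl xs≢[]
  0<length {xs = x ∷ xs} _     = ℕ→ℚ-0< (length xs)

  -- Every sample lies in `B` or gives some weight a product of at least 1, so 1 is at most the
  -- indicator of `B` plus `total gs`. Summing over all samples and dividing by `Nᵗ` gives the
  -- bound.
  proportion-draws-≥ : ∀ {β} {D : List A} {gs} t → D ≢ [] → All (IsPotential β D) gs →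
    {B : Pred (List A) ℓ} (B? : Decidable B) → (∀ S → All (λ g → prodOf g S < 1ℚ) gs → B S) →
    1ℚ - ℕ→ℚ (length gs) * β ^ t ≤ proportion B? (draws t D)
  proportion-draws-≥ {β = β} {D} {gs} t D≢[] pots {B} B? good =
    *-cancelˡ-≤-pos Nᵗ {{positive (^-0< t (0<length D≢[]))}} (begin
      Nᵗ * (1ℚ - G * β ^ t)
        ≡⟨ solve 3 (λ n g b → n :* (con 1ℚ :- g :* b) := n :- g :* (n :* b)) refl Nᵗ G (β ^ t) ⟩
      Nᵗ - G * (Nᵗ * β ^ t)
        ≡⟨ cong (λ c → Nᵗ - G * c) (sym (Exp.^-distrib-* N β t)) ⟩
      Nᵗ - G * (N * β) ^ t
        ≤⟨ ≤-by (0≤-diff sums) (solve 3 (λ a b c → a :- (c :- b) := (a :+ b) :- c) refl (Nᵗ * proportion B? Ω) (G * (N * β) ^ t) Nᵗ) ⟩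
      Nᵗ * proportion B? Ω ∎)
    where
    open ≤-Reasoning
    N = ℕ→ℚ (length D)
    Nᵗ = N ^ t
    G = ℕ→ℚ (length gs)
    Ω = draws t D
    0≤gs = All.map proj₁ pots

    pointwise : ∀ S → 1ℚ ≤ indicator B? S + total gs S
    pointwise S with B? S
    ... | yes _ = ≤-trans (≤-reflexive (sym (+-identityʳ 1ℚ))) (+-monoʳ-≤ 1ℚ (total-0≤ 0≤gs S))
    -- Comparison of rationals is decidable, so a sample outside `B` yields a definite weight whose
    -- product is not below 1.
    ... | no ¬b with All.all? (λ g → prodOf g S <? 1ℚ) gs
    ...   | yes all = contradiction (good S all) ¬b
    ...   | no ¬all = ≤-trans (1≤total {S = S} 0≤gs (All.¬All⇒Any¬ (λ g → prodOf g S <? 1ℚ) gs ¬all))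
                        (≤-reflexive (sym (+-identityˡ (total gs S))))

    sums : Nᵗ ≤ Nᵗ * proportion B? Ω + G * (N * β) ^ t
    sums = begin
      Nᵗ                                               ≡⟨ sym (trans (sumOf-const 1ℚ Ω) (trans (*-identityʳ (ℕ→ℚ (length Ω))) (length-draws t D))) ⟩
      sumOf (λ _ → 1ℚ) Ω                               ≤⟨ sumOf-mono pointwise Ω ⟩
      sumOf (λ S → indicator B? S + total gs S) Ω      ≡⟨ sumOf-+ (indicator B?) (total gs) Ω ⟩
      sumOf (indicator B?) Ω + sumOf (total gs) Ω      ≤⟨ +-mono-≤ (≤-reflexive counts) (total-draws t pots) ⟩
      Nᵗ * proportion B? Ω + G * (N * β) ^ t ∎
      where
      counts : sumOf (indicator B?) Ω ≡ Nᵗ * proportion B? Ω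
      counts = trans (sumOf-indicator B? Ω) (trans (sym (length*proportion B? Ω)) (cong (_* proportion B? Ω) (length-draws t D)))

  -- Tail bounds

  ℕ→ℚ-mono-< : ∀ {m n} → m ℕ.< n → ℕ→ℚ m < ℕ→ℚ n
  ℕ→ℚ-mono-< {zero}  {suc n} _ = ℕ→ℚ-0< n
  ℕ→ℚ-mono-< {suc m} {suc n} (ℕ.s≤s m<n) =
    subst₂ _<_ (sym (ℕ→ℚ-suc m)) (sym (ℕ→ℚ-suc n)) (+-monoʳ-< 1ℚ (ℕ→ℚ-mono-< m<n))

  ℕ→ℚ-cancel-≤ : ∀ {m n} → ℕ→ℚ m ≤ ℕ→ℚ n → m ℕ.≤ n
  ℕ→ℚ-cancel-≤ {m} {n} m≤n with m ℕ.≤? n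
  ... | yes le = le
  ... | no ≰  = contradiction (<-≤-trans (ℕ→ℚ-mono-< (ℕ.≰⇒> ≰)) m≤n) (<-irrefl refl)

  weight : {P : Pred A ℓ} → Decidable P → ℚ → ℚ → A → ℚ
  weight P? a b x with P? x
  ... | yes _ = a
  ... | no  _ = b

  weight-0≤ : {P : Pred A ℓ} (P? : Decidable P) → ∀ {a b} → 0ℚ ≤ a → 0ℚ ≤ b → ∀ x → 0ℚ ≤ weight P? a b x
  weight-0≤ P? 0≤a 0≤b x with P? x
  ... | yes _ = 0≤a
  ... | no  _ = 0≤b

  count+count∁ : {P : Pred A ℓ} (P? : Decidable P) → ∀ xs →
                 ℕ→ℚ (count P? xs) + ℕ→ℚ (count (∁? P?) xs) ≡ ℕ→ℚ (length xs)
  count+count∁ P? []       = refl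
  count+count∁ P? (x ∷ xs) with P? x
  ... | yes _ = begin
    ℕ→ℚ (suc (count P? xs)) + ℕ→ℚ (count (∁? P?) xs)   ≡⟨ cong (_+ ℕ→ℚ (count (∁? P?) xs)) (ℕ→ℚ-suc (count P? xs)) ⟩
    (1ℚ + ℕ→ℚ (count P? xs)) + ℕ→ℚ (count (∁? P?) xs)  ≡⟨ +-assoc 1ℚ (ℕ→ℚ (count P? xs)) (ℕ→ℚ (count (∁? P?) xs)) ⟩
    1ℚ + (ℕ→ℚ (count P? xs) + ℕ→ℚ (count (∁? P?) xs))  ≡⟨ cong (1ℚ +_) (count+count∁ P? xs) ⟩
    1ℚ + ℕ→ℚ (length xs)                               ≡⟨ sym (ℕ→ℚ-suc (length xs)) ⟩
    ℕ→ℚ (suc (length xs))                              ∎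
    where open ≡-Reasoning
  ... | no _ = begin
    ℕ→ℚ (count P? xs) + ℕ→ℚ (suc (count (∁? P?) xs))   ≡⟨ cong (ℕ→ℚ (count P? xs) +_) (ℕ→ℚ-suc (count (∁? P?) xs)) ⟩
    ℕ→ℚ (count P? xs) + (1ℚ + ℕ→ℚ (count (∁? P?) xs))  ≡⟨ solve 2 (λ a b → a :+ (con 1ℚ :+ b) := con 1ℚ :+ (a :+ b)) refl (ℕ→ℚ (count P? xs)) (ℕ→ℚ (count (∁? P?) xs)) ⟩
    1ℚ + (ℕ→ℚ (count P? xs) + ℕ→ℚ (count (∁? P?) xs))  ≡⟨ cong (1ℚ +_) (count+count∁ P? xs) ⟩
    1ℚ + ℕ→ℚ (length xs)                               ≡⟨ sym (ℕ→ℚ-suc (length xs)) ⟩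
    ℕ→ℚ (suc (length xs))                              ∎
    where open ≡-Reasoning

  sumOf-weight : {P : Pred A ℓ} (P? : Decidable P) → ∀ a b xs →
                 sumOf (weight P? a b) xs ≡ ℕ→ℚ (length xs) * (b + (a - b) * proportion P? xs)
  sumOf-weight P? a b xs = begin
    sumOf (weight P? a b) xs
      ≡⟨ sumOf-cong linear xs ⟩
    sumOf (λ x → b + (a - b) * indicator P? x) xs
      ≡⟨ sumOf-+ (λ _ → b) (λ x → (a - b) * indicator P? x) xs ⟩
    sumOf (λ _ → b) xs + sumOf (λ x → (a - b) * indicator P? x) xs
      ≡⟨ cong₂ _+_ (sumOf-const b xs) (sumOf-* (a - b) (indicator P?) xs) ⟩
    N * b + (a - b) * sumOf (indicator P?) xs
      ≡⟨ cong (λ c → N * b + (a - b) * c) (trans (sumOf-indicator P? xs) (sym (length*proportion P? xs))) ⟩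
    N * b + (a - b) * (N * p)
      ≡⟨ solve 4 (λ n p a b → n :* b :+ (a :- b) :* (n :* p) := n :* (b :+ (a :- b) :* p)) refl N p a b ⟩
    N * (b + (a - b) * p) ∎
    where
    open ≡-Reasoning
    N = ℕ→ℚ (length xs)
    p = proportion P? xs

    linear : ∀ x → weight P? a b x ≡ b + (a - b) * indicator P? x
    linear x with P? x
    ... | yes _ = solve 2 (λ a b → a := b :+ (a :- b) :* con 1ℚ) refl a b
    ... | no  _ = solve 2 (λ a b → b := b :+ (a :- b) :* con 0ℚ) refl a b

  prodOf-weight : {P : Pred A ℓ} (P? : Decidable P) → ∀ a b xs →
                  prodOf (weight P? a b) xs ≡ a ^ count P? xs * b ^ count (∁? P?) xs
  prodOf-weight P? a b []       = refl
  prodOf-weight P? a b (x ∷ xs) with P? x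
  ... | yes _ = trans (cong (a *_) (prodOf-weight P? a b xs)) (sym (*-assoc a (a ^ count P? xs) (b ^ count (∁? P?) xs)))
  ... | no  _ = trans (cong (b *_) (prodOf-weight P? a b xs))
    (solve 3 (λ a b c → b :* (a :* c) := a :* (b :* c)) refl (a ^ count P? xs) b (b ^ count (∁? P?) xs))

  -- The inequality of arithmetic and geometric means with multiplicities k and j. For positive
  -- multiplicities, writing b = 1 + q/j turns the hypothesis into a ≤ 1 - q/k, and `power-≤` bounds
  -- (1 + q/j)^j (1 - q/k)^k by 1.
  power-product-≤1 : ∀ {a b} k j → 0ℚ < a → 0ℚ < b →
                     ℕ→ℚ k * a + ℕ→ℚ j * b ≤ ℕ→ℚ k + ℕ→ℚ j → a ^ k * b ^ j ≤ 1ℚ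
  power-product-≤1 {a} {b} zero zero 0<a 0<b le = ≤-refl
  -- With one exponent 0 the hypothesis bounds the other number by 1; `base` only covers exponents
  -- that are successors.
  power-product-≤1 {a} {b} zero (suc j) 0<a 0<b le =
    ≤-trans (≤-reflexive (*-identityˡ (b ^ suc j))) (^-≤1 (suc j) (<⇒≤ 0<b)
      (*-cancelˡ-≤-pos (ℕ→ℚ (suc j)) {{positive (ℕ→ℚ-0< j)}}
        (≤-trans (≤-reflexive (solve 3 (λ a b j → j :* b := con 0ℚ :* a :+ j :* b) refl a b (ℕ→ℚ (suc j))))
          (≤-trans le (≤-reflexive (solve 1 (λ j → con 0ℚ :+ j := j :* con 1ℚ) refl (ℕ→ℚ (suc j))))))))
  power-product-≤1 {a} {b} (suc k) zero 0<a 0<b le =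
    ≤-trans (≤-reflexive (*-identityʳ (a ^ suc k))) (^-≤1 (suc k) (<⇒≤ 0<a)
      (*-cancelˡ-≤-pos (ℕ→ℚ (suc k)) {{positive (ℕ→ℚ-0< k)}}
        (≤-trans (≤-reflexive (solve 3 (λ a b k → k :* a := k :* a :+ con 0ℚ :* b) refl a b (ℕ→ℚ (suc k))))
          (≤-trans le (≤-reflexive (solve 1 (λ k → k :+ con 0ℚ := k :* con 1ℚ) refl (ℕ→ℚ (suc k))))))))
  power-product-≤1 {a} {b} (suc k) (suc j) 0<a 0<b le = begin
    a ^ suc k * b ^ suc j
      ≤⟨ *-monoʳ-≤ (^-0≤ (suc j) (<⇒≤ 0<b)) (^-mono-≤ (suc k) (<⇒≤ 0<a) a≤) ⟩
    base (- q) k ^ suc k * b ^ suc j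
      ≡⟨ *-comm (base (- q) k ^ suc k) (b ^ suc j) ⟩
    b ^ suc j * base (- q) k ^ suc k
      ≡⟨ cong (λ c → c ^ suc j * base (- q) k ^ suc k) (sym (base-unbase b j)) ⟩
    base q j ^ suc j * base (- q) k ^ suc k
      ≤⟨ power-≤ {q} j k (subst (0ℚ <_) (sym (base-unbase b j)) 0<b) (<-≤-trans 0<a a≤) ⟩
    1ℚ ∎
    where
    open ≤-Reasoning
    q = unbase b j
    K₀ = ℕ→ℚ (suc k)
    J₀ = ℕ→ℚ (suc j)

    a≤ : a ≤ base (- q) k
    a≤ = *-cancelˡ-≤-pos K₀ {{positive (ℕ→ℚ-0< k)}} (begin
      K₀ * a                       ≤⟨ ≤-by (0≤-diff le) (solve 4 (λ a b k j → (k :+ :- ((b :- con 1ℚ) :* j)) :- k :* a := (k :+ j) :- (k :* a :+ j :* b)) refl a b K₀ J₀) ⟩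
      K₀ + - q                     ≡⟨ cong (K₀ +_) (sym (*-unit-cancel k (- q))) ⟩
      K₀ + K₀ * (- q * unit k)      ≡⟨ solve 2 (λ k v → k :+ k :* v := k :* (con 1ℚ :+ v)) refl K₀ (- q * unit k) ⟩
      K₀ * base (- q) k            ∎)

  proportion-0≤ : {P : Pred A ℓ} (P? : Decidable P) → ∀ xs → 0ℚ ≤ proportion P? xs
  proportion-0≤ P? []            = ≤-refl
  proportion-0≤ P? xs@(_ ∷ tail) = *-cancelˡ-≤-pos (ℕ→ℚ (length xs)) {{positive (ℕ→ℚ-0< (length tail))}}
    (subst₂ _≤_ (sym (*-zeroʳ (ℕ→ℚ (length xs)))) (sym (length*proportion P? xs)) (ℕ→ℚ-0≤ (count P? xs)))

  proportion-∁ : {P : Pred A ℓ} (P? : Decidable P) → ∀ {xs} → xs ≢ [] →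
                 proportion (∁? P?) xs ≡ 1ℚ - proportion P? xs
  proportion-∁ P? {xs} xs≢[] = ≤-antisym (cancel (≤-reflexive eq)) (cancel (≤-reflexive (sym eq)))
    where
    N = ℕ→ℚ (length xs)
    cancel : ∀ {p q} → N * p ≤ N * q → p ≤ q
    cancel = *-cancelˡ-≤-pos N {{positive (0<length xs≢[])}}
    eq : N * proportion (∁? P?) xs ≡ N * (1ℚ - proportion P? xs)
    eq = begin
      N * proportion (∁? P?) xs                        ≡⟨ length*proportion (∁? P?) xs ⟩
      k′                                               ≡⟨ solve 2 (λ k k′ → k′ := (k :+ k′) :- k) refl k k′ ⟩
      (k + k′) - k                                     ≡⟨ cong₂ _-_ (count+count∁ P? xs) (sym (length*proportion P? xs)) ⟩
      N - N * proportion P? xs                         ≡⟨ solve 2 (λ n p → n :- n :* p := n :* (con 1ℚ :- p)) refl N (proportion P? xs) ⟩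
      N * (1ℚ - proportion P? xs) ∎
      where
      open ≡-Reasoning
      k = ℕ→ℚ (count P? xs)
      k′ = ℕ→ℚ (count (∁? P?) xs)

  proportion-≤1 : {P : Pred A ℓ} (P? : Decidable P) → ∀ xs → proportion P? xs ≤ 1ℚ
  proportion-≤1 P? []         = 0≤1
  proportion-≤1 P? xs@(_ ∷ _) = ≤-by (proportion-0≤ (∁? P?) xs) (sym (proportion-∁ P? {xs} (λ ())))

  rate : ℚ → ℚ
  rate e = 1ℚ - ½ * (e * e)

  -- Stands in where the bad event to be covered is impossible, so that each event still receives
  -- exactly one weight.
  zero-potential : ∀ {β} → 0ℚ ≤ β → (D : List A) → IsPotential β D (λ _ → 0ℚ)
  zero-potential 0≤β D = (λ _ → ≤-refl) ,
    ≤-trans (≤-reflexive (trans (sumOf-const 0ℚ D) (*-zeroʳ (ℕ→ℚ (length D))))) (*-0≤ (ℕ→ℚ-0≤ (length D)) 0≤β)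

  -- Weights for the three kinds of bad events

  module _ {e : ℚ} (0<e : 0ℚ < e) (e<1 : e < 1ℚ) where

    0<rate : 0ℚ < rate e
    0<rate = <-≤-trans (*-0< 0<½ 0<½) (≤-by (+-0≤ (*-0≤ (<⇒≤ 0<½) (*-0≤ (<⇒≤ (0<-diff e<1)) (+-0≤ 0≤1 (<⇒≤ 0<e)))) (<⇒≤ (*-0< 0<½ 0<½)))
      (solve 1 (λ e → con 1ℚ :- con ½ :* (e :* e) :- con ½ :* con ½
                      := con ½ :* ((con 1ℚ :- e) :* (con 1ℚ :+ e)) :+ con ½ :* con ½) refl e))

    module _ {P : Pred A ℓ} (P? : Decidable P) (D : List A) where

      -- With weights 1/Â on P and 1/B off P, where qÂ + (1 - q)B = 1, the product
      -- is at least 1 by the inequality of arithmetic and geometric means.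

      tail-potential : let q = proportion P? D + e in q ≤ 1ℚ →
        ∃ λ g → IsPotential (rate e) D g ×
          (∀ S → ℕ→ℚ (length S) * q ≤ ℕ→ℚ (count P? S) → 1ℚ ≤ prodOf g S)
      tail-potential q≤1 = g , (weight-0≤ P? (<⇒≤ 0<a) (<⇒≤ 0<b) , sum≤) , prod≥
        where
        p = proportion P? D
        q = p + e
        Â = 1ℚ - e * (1ℚ - q)
        B = 1ℚ + e * q

        0≤q : 0ℚ ≤ q
        0≤q = +-0≤ (proportion-0≤ P? D) (<⇒≤ 0<e)

        0<Â : 0ℚ < Â
        0<Â = <-≤-trans (0<-diff e<1) (≤-by (*-0≤ (<⇒≤ 0<e) 0≤q)
          (solve 2 (λ e q → con 1ℚ :- e :* (con 1ℚ :- q) :- (con 1ℚ :- e) := e :* q) refl e q))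

        0<B : 0ℚ < B
        0<B = +-mono-<-≤ 0<1 (*-0≤ (<⇒≤ 0<e) 0≤q)

        a = recip 0<Â
        b = recip 0<B
        0<a = recip-0< 0<Â
        0<b = recip-0< 0<B
        g = weight P? a b

        mean≤ : b + (a - b) * p ≤ rate e
        mean≤ = *-cancelˡ-≤-pos (Â * B) {{positive (*-0< 0<Â 0<B)}} (begin
          Â * B * (b + (a - b) * p)
            ≡⟨ solve 5 (λ A B a b p → A :* B :* (b :+ (a :- b) :* p) := (b :* B) :* (A :* (con 1ℚ :- p)) :+ (a :* A) :* (B :* p)) refl Â B a b p ⟩
          (b * B) * (Â * (1ℚ - p)) + (a * Â) * (B * p)
            ≡⟨ cong₂ (λ u v → u * (Â * (1ℚ - p)) + v * (B * p)) (recip-inv 0<B) (recip-inv 0<Â) ⟩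
          1ℚ * (Â * (1ℚ - p)) + 1ℚ * (B * p)
            -- As p = q - e, the right side exceeds the left by e² (s² + (1 - e²)/4 + e² q (1 -
            -- q)/2), where `s` comes from completing the square in q.
            ≤⟨ ≤-by 0≤gap (solve 2 (λ p e →
                 let q = p :+ e ; A = con 1ℚ :- e :* (con 1ℚ :- q) ; B = con 1ℚ :+ e :* q
                     s = q :- con ½ :* (con 1ℚ :+ e) in
                 A :* B :* (con 1ℚ :- con ½ :* (e :* e)) :- (con 1ℚ :* (A :* (con 1ℚ :- p)) :+ con 1ℚ :* (B :* p))
                 := e :* e :* (s :* s :+ con ½ :* con ½ :* ((con 1ℚ :- e) :* (con 1ℚ :+ e)) :+ con ½ :* (e :* e :* (q :* (con 1ℚ :- q)))))
                 refl p e) ⟩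
          Â * B * rate e ∎)
          where
          open ≤-Reasoning
          s = q - ½ * (1ℚ + e)
          0≤gap : 0ℚ ≤ e * e * (s * s + ½ * ½ * ((1ℚ - e) * (1ℚ + e)) + ½ * (e * e * (q * (1ℚ - q))))
          0≤gap = *-0≤ (square-0≤ e) (+-0≤ (+-0≤ (square-0≤ s)
            (*-0≤ (<⇒≤ (*-0< 0<½ 0<½)) (*-0≤ (<⇒≤ (0<-diff e<1)) (+-0≤ 0≤1 (<⇒≤ 0<e)))))
            (*-0≤ (<⇒≤ 0<½) (*-0≤ (square-0≤ e) (*-0≤ 0≤q (0≤-diff q≤1)))))

        sum≤ : sumOf g D ≤ ℕ→ℚ (length D) * rate e
        sum≤ = ≤-trans (≤-reflexive (sumOf-weight P? a b D)) (*-monoˡ-≤ (ℕ→ℚ-0≤ (length D)) mean≤)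

        prod≥ : ∀ S → ℕ→ℚ (length S) * q ≤ ℕ→ℚ (count P? S) → 1ℚ ≤ prodOf g S
        -- Since `a` and `b` invert `Â` and `B`, the product of the weights is the inverse of `Π`,
        -- and it suffices that `Π` is at most 1.
        prod≥ S Mq≤k = *-cancelˡ-≤-pos Π {{positive 0<Π}} (begin
          Π * 1ℚ                              ≡⟨ *-identityʳ Π ⟩
          Π                                   ≤⟨ power-product-≤1 k j 0<Â 0<B balance ⟩
          1ℚ                                  ≡⟨ sym (trans (cong₂ _*_ (1^ k) (1^ j)) (*-identityʳ 1ℚ)) ⟩
          1ℚ ^ k * 1ℚ ^ j                     ≡⟨ cong₂ (λ u v → u ^ k * v ^ j) (sym (recip-inv 0<Â)) (sym (recip-inv 0<B)) ⟩
          (a * Â) ^ k * (b * B) ^ j           ≡⟨ cong₂ _*_ (Exp.^-distrib-* a Â k) (Exp.^-distrib-* b B j) ⟩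
          (a ^ k * Â ^ k) * (b ^ j * B ^ j)   ≡⟨ solve 4 (λ a A b B → (a :* A) :* (b :* B) := (A :* B) :* (a :* b)) refl (a ^ k) (Â ^ k) (b ^ j) (B ^ j) ⟩
          Π * (a ^ k * b ^ j)                 ≡⟨ cong (Π *_) (sym (prodOf-weight P? a b S)) ⟩
          Π * prodOf g S                      ∎)
          where
          open ≤-Reasoning
          k = count P? S
          j = count (∁? P?) S
          Π = Â ^ k * B ^ j
          0<Π = *-0< (^-0< k 0<Â) (^-0< j 0<B)
          -- The left side exceeds the right by e ((k + j) q - k), which is nonpositive because P
          -- holds for at least the fraction q of the sample.
          balance : ℕ→ℚ k * Â + ℕ→ℚ j * B ≤ ℕ→ℚ k + ℕ→ℚ j
          balance = ≤-by (*-0≤ (<⇒≤ 0<e) (0≤-diff (subst (λ M → M * q ≤ ℕ→ℚ k) (sym (count+count∁ P? S)) Mq≤k)))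
            (solve 4 (λ k j e q → (k :+ j) :- (k :* (con 1ℚ :- e :* (con 1ℚ :- q)) :+ j :* (con 1ℚ :+ e :* q))
                                  := e :* (k :- (k :+ j) :* q)) refl (ℕ→ℚ k) (ℕ→ℚ j) e q)

      -- If p + e > 1 then the tail event is empty and the weight 0 will do.

      upper-tail : ∃ λ g → IsPotential (rate e) D g ×
        (∀ S → prodOf g S < 1ℚ → proportion P? S ≤ proportion P? D + e)
      upper-tail with proportion P? D + e ≤? 1ℚ
      ... | no q≰1 = (λ _ → 0ℚ) , zero-potential (<⇒≤ 0<rate) D ,
        λ S _ → ≤-trans (proportion-≤1 P? S) (<⇒≤ (≰⇒> q≰1))
      ... | yes q≤1 = let (g , pot , prod≥) = tail-potential q≤1 in g , pot , λ S <1 →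
        ≮⇒≥ λ q<f → <-irrefl refl (<-≤-trans <1 (prod≥ S
          (≤-trans (*-monoˡ-≤ (ℕ→ℚ-0≤ (length S)) (<⇒≤ q<f)) (≤-reflexive (length*proportion P? S)))))

    -- The upper tail of the complement: P falls below p - e when its complement exceeds 1 - p + e.
    -- The complement has proportion 1 - p only in a nonempty list, whence `D ≢ []`; for the sample
    -- the argument runs on counts.
    lower-tail : {P : Pred A ℓ} (P? : Decidable P) (D : List A) → D ≢ [] → ∃ λ g → IsPotential (rate e) D g ×
      (∀ S → prodOf g S < 1ℚ → proportion P? D - e ≤ proportion P? S)
    lower-tail P? D D≢[] with proportion (∁? P?) D + e ≤? 1ℚ
    ... | no q≰1 = (λ _ → 0ℚ) , zero-potential (<⇒≤ 0<rate) D ,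
        λ S _ → ≤-trans (<⇒≤ (subst (_< 0ℚ) eq (p<0 (≰⇒> q≰1)))) (proportion-0≤ P? S)
      where
      q = proportion (∁? P?) D + e
      p<0 : 1ℚ < q → 1ℚ - q < 0ℚ
      p<0 1<q = <-by (0<-diff 1<q) (solve 1 (λ q → con 0ℚ :- (con 1ℚ :- q) := q :- con 1ℚ) refl q)
      eq : 1ℚ - q ≡ proportion P? D - e
      eq = trans (cong (λ p → 1ℚ - (p + e)) (proportion-∁ P? D≢[]))
        (solve 2 (λ p e → con 1ℚ :- (con 1ℚ :- p :+ e) := p :- e) refl (proportion P? D) e)
    ... | yes q≤1 = let (g , pot , prod≥) = tail-potential (∁? P?) D q≤1 in g , pot , λ S <1 →
        ≮⇒≥ λ f<p-e → <-irrefl refl (<-≤-trans <1 (prod≥ S (Mq≤k S (<⇒≤ f<p-e))))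
      where
      p = proportion P? D
      Mq≤k : ∀ S → proportion P? S ≤ p - e → ℕ→ℚ (length S) * (proportion (∁? P?) D + e) ≤ ℕ→ℚ (count (∁? P?) S)
      Mq≤k S f≤p-e = begin
        M * (proportion (∁? P?) D + e)   ≡⟨ cong (λ p → M * (p + e)) (proportion-∁ P? D≢[]) ⟩
        M * (1ℚ - p + e)                 ≤⟨ *-monoˡ-≤ (ℕ→ℚ-0≤ (length S)) (≤-by (0≤-diff f≤p-e) (solve 3 (λ p e f → (con 1ℚ :- f) :- (con 1ℚ :- p :+ e) := (p :- e) :- f) refl p e f)) ⟩
        M * (1ℚ - f)                     ≡⟨ solve 2 (λ m f → m :* (con 1ℚ :- f) := m :- m :* f) refl M f ⟩
        M - M * f                        ≡⟨ cong₂ _-_ (sym (count+count∁ P? S)) (length*proportion P? S) ⟩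
        (k + k′) - k                     ≡⟨ solve 2 (λ k k′ → (k :+ k′) :- k := k′) refl k k′ ⟩
        k′                               ∎
        where
        open ≤-Reasoning
        M = ℕ→ℚ (length S)
        f = proportion P? S
        k = ℕ→ℚ (count P? S)
        k′ = ℕ→ℚ (count (∁? P?) S)

    -- If P does not lead Q by e in `D`, the conclusion holds outright. Otherwise the weight is (1 +
    -- e)^([Q] - [P]), and its product reaches 1 as soon as Q occurs in the sample at least as often
    -- as P. Deciding between the two cases here provides one weight for every pair.
    inversion-tail : {P Q : Pred A ℓ} (P? : Decidable P) (Q? : Decidable Q) (D : List A) →
      ∃ λ g → IsPotential (rate e) D g ×
      (∀ S → prodOf g S < 1ℚ → proportion P? S ≤ proportion Q? S → proportion P? D < proportion Q? D + e)
    inversion-tail P? Q? D with proportion P? D <? proportion Q? D + e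
    ... | yes lt = (λ _ → 0ℚ) , zero-potential (<⇒≤ 0<rate) D , λ _ _ _ → lt
    ... | no ≮ = g , ((λ x → *-0≤ (weight-0≤ P? (<⇒≤ 0<u) 0≤1 x) (weight-0≤ Q? (<⇒≤ 0<ρ) 0≤1 x)) , sum≤) ,
        λ S <1 fP≤fQ → contradiction (<-≤-trans <1 (prod≥ S fP≤fQ)) (<-irrefl refl)
      where
      ρ = 1ℚ + e
      0<ρ : 0ℚ < ρ
      0<ρ = +-0< 0<1 0<e
      u = recip 0<ρ
      0<u = recip-0< 0<ρ
      uρ≡1 : u * ρ ≡ 1ℚ
      uρ≡1 = recip-inv 0<ρ
      g = λ x → weight P? u 1ℚ x * weight Q? ρ 1ℚ x
      -- The line z ↦ c₀ - c₁ z takes the value ρ at z = -1 and u = 1/ρ at z = 1; thus `c₀` and `c₁`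
      -- are the hyperbolic cosine and sine of ln ρ.
      c₀ = ½ * (ρ + u)
      c₁ = ½ * (ρ - u)
      N = ℕ→ℚ (length D)
      p = proportion P? D
      p′ = proportion Q? D

      ρ-u≡ : ρ - u ≡ e * (ρ + 1ℚ) * u
      ρ-u≡ = trans (cong (_- u) (sym (trans (cong (_* ρ) uρ≡1) (*-identityˡ ρ))))
        (solve 2 (λ u e → let ρ = con 1ℚ :+ e in u :* ρ :* ρ :- u := e :* (ρ :+ con 1ℚ) :* u) refl u e)

      0≤c₁ : 0ℚ ≤ c₁
      0≤c₁ = *-0≤ (<⇒≤ 0<½) (subst (0ℚ ≤_) (sym ρ-u≡)
        (*-0≤ (*-0≤ (<⇒≤ 0<e) (+-0≤ (<⇒≤ 0<ρ) 0≤1)) (<⇒≤ 0<u)))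

      -- Where P and Q agree the weight is 1 and the line has height at least `c₀`; here ρ + u - 2 =
      -- e² u because uρ = 1.
      1≤c₀ : 1ℚ ≤ c₀
      1≤c₀ = ≤-by (*-0≤ (<⇒≤ 0<½) (*-0≤ (square-0≤ e) (<⇒≤ 0<u))) (begin
        ½ * (ρ + u) - 1ℚ                        ≡⟨ solve 2 (λ u ρ → con ½ :* (ρ :+ u) :- con 1ℚ := con ½ :* (con 1ℚ :* ρ :+ u :- con 1ℚ :- con 1ℚ)) refl u ρ ⟩
        ½ * (1ℚ * ρ + u - 1ℚ - 1ℚ)              ≡⟨ cong (λ v → ½ * (v * ρ + u - v - v)) (sym uρ≡1) ⟩
        ½ * (u * ρ * ρ + u - u * ρ - u * ρ)     ≡⟨ solve 2 (λ u e → let ρ = con 1ℚ :+ e in con ½ :* (u :* ρ :* ρ :+ u :- u :* ρ :- u :* ρ) := con ½ :* (e :* e :* u)) refl u e ⟩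
        ½ * (e * e * u)                         ∎)
        where open ≡-Reasoning

      -- The chord of z ↦ ρ^(-z) through z = ±1, at z = [P] - [Q].

      chord : ∀ x → g x ≤ weight P? (c₀ - c₁) c₀ x + weight Q? c₁ 0ℚ x
      chord x with P? x | Q? x
      ... | yes _ | yes _ = ≤-trans (≤-reflexive uρ≡1) (≤-trans 1≤c₀ (≤-reflexive (solve 2 (λ a b → a := a :- b :+ b) refl c₀ c₁)))
      ... | yes _ | no  _ = ≤-reflexive (solve 2 (λ u ρ → u :* con 1ℚ := con ½ :* (ρ :+ u) :- con ½ :* (ρ :- u) :+ con 0ℚ) refl u ρ)
      ... | no  _ | yes _ = ≤-reflexive (solve 2 (λ u ρ → con 1ℚ :* ρ := con ½ :* (ρ :+ u) :+ con ½ :* (ρ :- u)) refl u ρ)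
      ... | no  _ | no  _ = ≤-trans 1≤c₀ (≤-reflexive (sym (+-identityʳ c₀)))

      sum≤ : sumOf g D ≤ N * rate e
      sum≤ = begin
        sumOf g D
          ≤⟨ sumOf-mono chord D ⟩
        sumOf (λ x → weight P? (c₀ - c₁) c₀ x + weight Q? c₁ 0ℚ x) D
          ≡⟨ sumOf-+ (weight P? (c₀ - c₁) c₀) (weight Q? c₁ 0ℚ) D ⟩
        sumOf (weight P? (c₀ - c₁) c₀) D + sumOf (weight Q? c₁ 0ℚ) D
          ≡⟨ cong₂ _+_ (sumOf-weight P? (c₀ - c₁) c₀ D) (sumOf-weight Q? c₁ 0ℚ D) ⟩
        N * (c₀ + (c₀ - c₁ - c₀) * p) + N * (0ℚ + (c₁ - 0ℚ) * p′)
          ≡⟨ solve 5 (λ n c d p p′ → n :* (c :+ (c :- d :- c) :* p) :+ n :* (con 0ℚ :+ (d :- con 0ℚ) :* p′)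
                                     := n :* (c :- d :* (p :- p′))) refl N c₀ c₁ p p′ ⟩
        N * (c₀ - c₁ * (p - p′))
          ≤⟨ *-monoˡ-≤ (ℕ→ℚ-0≤ (length D)) (≤-by (*-0≤ 0≤c₁ (0≤-diff (≮⇒≥ ≮)))
               (solve 5 (λ c d p p′ e → (c :- d :* e) :- (c :- d :* (p :- p′)) := d :* (p :- (p′ :+ e))) refl c₀ c₁ p p′ e)) ⟩
        N * (c₀ - c₁ * e)
          -- The choice ρ = 1 + e pays off: c₀ - c₁ e = ½ (1 - e) ρ + ½ (1 + e) u, where (1 - e) ρ =
          -- 1 - e² and (1 + e) u = 1.
          ≡⟨ cong (N *_) (solve 2 (λ u e → let ρ = con 1ℚ :+ e in
                con ½ :* (ρ :+ u) :- con ½ :* (ρ :- u) :* e := con ½ :* (con 1ℚ :- e :* e) :+ con ½ :* (u :* ρ)) refl u e) ⟩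
        N * (½ * (1ℚ - e * e) + ½ * (u * ρ))
          ≡⟨ cong (λ v → N * (½ * (1ℚ - e * e) + ½ * v)) uρ≡1 ⟩
        N * (½ * (1ℚ - e * e) + ½ * 1ℚ)
          ≡⟨ cong (N *_) (solve 1 (λ e → con ½ :* (con 1ℚ :- e :* e) :+ con ½ :* con 1ℚ := con 1ℚ :- con ½ :* (e :* e)) refl e) ⟩
        N * rate e ∎
        where open ≤-Reasoning

      powers : ∀ {k j} → k ℕ.≤ j → 1ℚ ≤ u ^ k * ρ ^ j
      powers {j = zero}  ℕ.z≤n = ≤-refl
      powers {j = suc j} ℕ.z≤n = ≤-trans (powers {zero} {j} ℕ.z≤n) (*-monoˡ-≤ {1ℚ} {ρ ^ j} {ρ ^ suc j} 0≤1
        (≤-by (*-0≤ (<⇒≤ 0<e) (^-0≤ j (<⇒≤ 0<ρ))) (solve 2 (λ e r → (con 1ℚ :+ e) :* r :- r := e :* r) refl e (ρ ^ j))))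
      powers {suc k} {suc j} (ℕ.s≤s k≤j) = ≤-trans (powers k≤j) (≤-reflexive (begin
        u ^ k * ρ ^ j                 ≡⟨ sym (*-identityˡ (u ^ k * ρ ^ j)) ⟩
        1ℚ * (u ^ k * ρ ^ j)          ≡⟨ cong (_* (u ^ k * ρ ^ j)) (sym uρ≡1) ⟩
        (u * ρ) * (u ^ k * ρ ^ j)     ≡⟨ solve 4 (λ u ρ a b → (u :* ρ) :* (a :* b) := (u :* a) :* (ρ :* b)) refl u ρ (u ^ k) (ρ ^ j) ⟩
        u ^ suc k * ρ ^ suc j         ∎))
        where open ≡-Reasoning

      prod≥ : ∀ S → proportion P? S ≤ proportion Q? S → 1ℚ ≤ prodOf g S
      prod≥ S fP≤fQ = begin
        1ℚ                                         ≤⟨ powers (ℕ→ℚ-cancel-≤ {count P? S} {count Q? S} counts) ⟩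
        u ^ count P? S * ρ ^ count Q? S            ≡⟨ cong₂ _*_ (pow u P?) (pow ρ Q?) ⟩
        prodOf (weight P? u 1ℚ) S * prodOf (weight Q? ρ 1ℚ) S  ≡⟨ sym (prodOf-* (weight P? u 1ℚ) (weight Q? ρ 1ℚ) S) ⟩
        prodOf g S                                 ∎
        where
        open ≤-Reasoning
        counts : ℕ→ℚ (count P? S) ≤ ℕ→ℚ (count Q? S)
        counts = subst₂ _≤_ (length*proportion P? S) (length*proportion Q? S) (*-monoˡ-≤ (ℕ→ℚ-0≤ (length S)) fP≤fQ)
        pow : ∀ v {R : Pred _ _} (R? : Decidable R) → v ^ count R? S ≡ prodOf (weight R? v 1ℚ) S
        pow v R? = sym (trans (prodOf-weight R? v 1ℚ S) (trans (cong (v ^ count R? S *_) (1^ (count (∁? R?) S))) (*-identityʳ (v ^ count R? S))))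

  -- The sample size

  private
    variable
      a b c d e p q u : ℚ

  -- With positive lower endpoints, the least of the four corner products of the interval
  -- multiplication is that of the lower endpoints.
  L-*ᵣ : ∀ {x y} → 0ℚ < a → 0ℚ < c → L x a → L y c → q < a * c → L (x *ᵣ y) q
  L-*ᵣ {a} {c} {q} {x} {y} 0<a 0<c La Lc q<ac =
    let (b , Ub) = U-inhab x ; (d , Ud) = U-inhab y
        a≤b = <⇒≤ (L<U x La Ub) ; c≤d = <⇒≤ (L<U y Lc Ud)
        0≤a = <⇒≤ 0<a ; 0≤c = <⇒≤ 0<c ; 0≤d = ≤-trans 0≤c c≤d
    in a , b , c , d , (La , Ub , Lc , Ud) , q<ac
     , <-≤-trans q<ac (*-monoˡ-≤ {a} {c} {d} 0≤a c≤d)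
     , <-≤-trans q<ac (*-monoʳ-≤ {c} {a} {b} 0≤c a≤b)
     , <-≤-trans q<ac (*-mono-≤-0≤ {a} {d} {b} {c} 0≤a 0≤d a≤b c≤d)

  U-*ᵣ : ∀ {x y} → 0ℚ < a → 0ℚ < c → L x a → U x b → L y c → U y d → b * d < q → U (x *ᵣ y) q
  U-*ᵣ {a} {c} {b} {d} {q} {x} {y} 0<a 0<c La Ub Lc Ud bd<q =
    let a≤b = <⇒≤ (L<U x La Ub) ; c≤d = <⇒≤ (L<U y Lc Ud)
        0≤a = <⇒≤ 0<a ; 0≤b = ≤-trans 0≤a a≤b ; 0≤d = ≤-trans (<⇒≤ 0<c) c≤d
    in a , b , c , d , (La , Ub , Lc , Ud)
     , ≤-<-trans (*-mono-≤-0≤ {a} {d} {b} {c} 0≤a 0≤d a≤b c≤d) bd<q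
     , ≤-<-trans (*-monoʳ-≤ {d} {a} {b} 0≤d a≤b) bd<q
     , ≤-<-trans (*-monoˡ-≤ {b} {c} {d} 0≤b c≤d) bd<q
     , bd<q

  -- The cut of the quotient asks for a rational r below 1/ε² with c < p r. Any r strictly between
  -- c/p and 1/u² serves, and c u² < p leaves room for one.
  L-÷ᵣ-square : ∀ {x ε} (0<x² : 0ᵣ <ᵣ ε *ᵣ ε) → 0ℚ < c → L x p → 0ℚ < e → L ε e → U ε u →
                c * (u * u) < p → L (x ÷ᵣ ε *ᵣ ε ⟨ 0<x² ⟩) c
  L-÷ᵣ-square {c} {p} {e} {u} {x} {ε} 0<ε² 0<c Lp 0<e Le Uu cuu<p =
    let 0<p = <-trans (*-0< 0<c 0<uu) cuu<p
        c/p<1/uu : c * recip 0<p < 1ℚ * recip 0<uu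
        c/p<1/uu = recip-< 0<p (subst (c <_) (solve 2 (λ p r → p :* r := con 1ℚ :* r :* p) refl p (recip 0<uu)) (<-recip 0<uu cuu<p))
        (r , c/p<r , r<1/uu) = <-dense c/p<1/uu
        0<r = <-trans (*-0< 0<c (recip-0< 0<p)) c/p<r
        ruu<1 : r * (u * u) < 1ℚ
        ruu<1 = subst (r * (u * u) <_) (recip-cancel 0<uu 1ℚ) (*-monoʳ-< 0<uu r<1/uu)
        -- That r lies below 1/ε² must be witnessed by an upper bound w of ε² with r w < 1, so w is
        -- taken between u² and 1/r.
        (w , uu<w , w<1/r) = <-dense (<-recip 0<r (subst (_< 1ℚ) (*-comm r (u * u)) ruu<1))
        rw<1 : r * w < 1ℚ
        rw<1 = subst₂ _<_ (*-comm w r) (recip-cancel 0<r 1ℚ) (*-monoʳ-< 0<r w<1/r)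
        c<pr : c < p * r
        c<pr = subst₂ _<_ (recip-cancel 0<p c) (*-comm r p) (*-monoʳ-< 0<p c/p<r)
    in L-*ᵣ {p} {r} {c} {x} {recipᵣ (ε *ᵣ ε) 0<ε²} 0<p 0<r Lp
         (w , U-*ᵣ {e} {e} {u} {u} {w} {ε} {ε} 0<e 0<e Le Uu Le Uu uu<w , rw<1) c<pr
    where
    0<u : 0ℚ < u
    0<u = <-trans 0<e (L<U ε Le Uu)
    0<uu : 0ℚ < u * u
    0<uu = *-0< 0<u 0<u

  -- Of the four corners only the product of the upper endpoints matters: a < a′, a′ r < b, and 1 <
  -- r l for some l below `δ`, hence a ≤ a r l ≤ a′ r d ≤ b d.
  U-÷ᵣ-≤ : ∀ {δ} (0<δ : 0ᵣ <ᵣ δ) → 0ℚ < a → U (ℚ→ℝ a ÷ᵣ δ ⟨ 0<δ ⟩) b → U δ d → a ≤ b * d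
  U-÷ᵣ-≤ {a} {b} {d} {δ} 0<δ 0<a
    (_ , a′ , _ , r , (_ , a<a′ , _ , (l , 0<l , Ll , 1<rl)) , _ , _ , _ , a′r<b) Ud = begin
    a              ≡⟨ sym (*-identityʳ a) ⟩
    a * 1ℚ         ≤⟨ *-monoˡ-≤ (<⇒≤ 0<a) (<⇒≤ 1<rl) ⟩
    a * (r * l)    ≤⟨ *-mono-≤-0≤ (<⇒≤ 0<a) (*-0≤ (<⇒≤ 0<r) (<⇒≤ 0<d)) (<⇒≤ a<a′) (*-monoˡ-≤ (<⇒≤ 0<r) (<⇒≤ l<d)) ⟩
    a′ * (r * d)   ≡⟨ sym (*-assoc a′ r d) ⟩
    a′ * r * d     ≤⟨ *-monoʳ-≤ (<⇒≤ 0<d) (<⇒≤ a′r<b) ⟩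
    b * d          ∎
    where
    open ≤-Reasoning
    l<d = L<U δ Ll Ud
    0<d = <-trans 0<l l<d
    0<r : 0ℚ < r
    0<r = *-cancelʳ-< {c = l} (<⇒≤ 0<l) (subst (_< r * l) (sym (*-zeroˡ l)) (<-trans 0<1 1<rl))

  -- The finite form of exp (t x) (1 - x)^t ≤ 1. For t > 0, 1 - x is 1 - l/t with l = t x, so
  -- `power-≤` applies.
  base-power-decay : ∀ {x} k t → 0ℚ ≤ x → x < 1ℚ → base (ℕ→ℚ t * x) k ^ suc k * (1ℚ - x) ^ t ≤ 1ℚ
  base-power-decay {x} k zero 0≤x x<1 = ≤-reflexive (begin
    base (0ℚ * x) k ^ suc k * 1ℚ   ≡⟨ *-identityʳ (base (0ℚ * x) k ^ suc k) ⟩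
    base (0ℚ * x) k ^ suc k        ≡⟨ cong (_^ suc k) (solve 2 (λ x v → con 1ℚ :+ con 0ℚ :* x :* v := con 1ℚ) refl x (unit k)) ⟩
    1ℚ ^ suc k                     ≡⟨ 1^ (suc k) ⟩
    1ℚ                             ∎)
    where open ≡-Reasoning
  base-power-decay {x} k (suc j) 0≤x x<1 =
    subst (λ b → base l k ^ suc k * b ^ suc j ≤ 1ℚ) eq
      (power-≤ {l} k j (+-mono-<-≤ 0<1 (*-0≤ (*-0≤ (ℕ→ℚ-0≤ (suc j)) 0≤x) (<⇒≤ (0<unit k)))) (subst (0ℚ <_) (sym eq) (0<-diff x<1)))
    where
    l = ℕ→ℚ (suc j) * x
    eq : base (- l) j ≡ 1ℚ - x
    eq = trans (solve 3 (λ n x v → con 1ℚ :+ (:- (n :* x)) :* v := con 1ℚ :- n :* (x :* v)) refl (ℕ→ℚ (suc j)) x (unit j))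
      (cong (λ l → 1ℚ - l) (*-unit-cancel j x))

  -- (1 + (l + h)/n)(1 - h/n) ≤ 1 + l/n, and (1 - h/n)ⁿ ≥ 1 - h.

  exp-decay : ∀ {x h} t → 0ℚ ≤ x → x < 1ℚ → 0ℚ < h → h < 1ℚ → L (expℚ (ℕ→ℚ t * x + h)) b →
              b * (1ℚ - h) * (1ℚ - x) ^ t ≤ 1ℚ
  exp-decay {b} {x} {h} t 0≤x x<1 0<h h<1 (k , 0<V , b<Vⁿ) = begin
    b * (1ℚ - h) * R                ≤⟨ *-monoʳ-≤ 0≤R (*-monoʳ-≤ (<⇒≤ (0<-diff h<1)) (<⇒≤ b<Vⁿ)) ⟩
    V ^ n * (1ℚ - h) * R            ≤⟨ *-monoʳ-≤ 0≤R (*-monoˡ-≤ (^-0≤ n (<⇒≤ 0<V)) 1-h≤) ⟩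
    V ^ n * (1ℚ + y) ^ n * R        ≡⟨ cong (_* R) (sym (Exp.^-distrib-* V (1ℚ + y) n)) ⟩
    (V * (1ℚ + y)) ^ n * R          ≤⟨ *-monoʳ-≤ 0≤R (^-mono-≤ n (*-0≤ (<⇒≤ 0<V) 0≤1+y) V[1+y]≤) ⟩
    base l k ^ n * R                ≤⟨ base-power-decay k t 0≤x x<1 ⟩
    1ℚ                              ∎
    where
    open ≤-Reasoning
    n = suc k
    l = ℕ→ℚ t * x
    V = base (l + h) k
    R = (1ℚ - x) ^ t
    0≤R = ^-0≤ t (<⇒≤ (0<-diff x<1))
    y = - h * unit k

    1+ny≡ : 1ℚ + ℕ→ℚ n * y ≡ 1ℚ - h
    1+ny≡ = cong (1ℚ +_) (*-unit-cancel k (- h))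

    0≤1+y : 0ℚ ≤ 1ℚ + y
    0≤1+y = 1+-0≤ k y (subst (0ℚ <_) (sym 1+ny≡) (0<-diff h<1))

    1-h≤ : 1ℚ - h ≤ (1ℚ + y) ^ n
    1-h≤ = subst (_≤ (1ℚ + y) ^ n) 1+ny≡ (bernoulli n 0≤1+y)

    V[1+y]≤ : V * (1ℚ + y) ≤ base l k
    V[1+y]≤ = ≤-by (*-0≤ (*-0≤ (+-0≤ (*-0≤ (ℕ→ℚ-0≤ t) 0≤x) (<⇒≤ 0<h)) (<⇒≤ (0<unit k))) (*-0≤ (<⇒≤ 0<h) (<⇒≤ (0<unit k))))
      (solve 3 (λ l h v → (con 1ℚ :+ l :* v) :- (con 1ℚ :+ (l :+ h) :* v) :* (con 1ℚ :+ (:- h) :* v)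
                          := ((l :+ h) :* v) :* (h :* v)) refl l h (unit k))

  U-min : ∀ x → U x p → U x q → ∃ λ r → U x r × r ≤ p × r ≤ q
  U-min {p} {q} x Up Uq with ≤-total p q
  ... | inj₁ p≤q = p , Up , ≤-refl , p≤q
  ... | inj₂ q≤p = q , Uq , q≤p , ≤-refl

  -- For e < u < 1 one has u² - e² ≤ 2 (u - e), so u - e < h/(1 + t) is close enough; dividing by 1
  -- + t allows for t = 0. Raising e to `e₀` and lowering u to `u₀` where necessary keeps both
  -- strictly between 0 and 1.
  close-squares : ∀ {ε h} t → 0ᵣ <ᵣ ε → ε <ᵣ 1ᵣ → 0ℚ < h → ∃₂ λ e u → 0ℚ < e × e < 1ℚ × L ε e × U ε u ×
                  ℕ→ℚ t * (½ * (u * u)) < ℕ→ℚ t * (½ * (e * e)) + h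
  close-squares {ε} {h} t (e₀ , 0<e₀ , Le₀) (u₀ , Uu₀ , u₀<1) 0<h =
    let (l , v , Ll , Uv , v<l+η) = approx ε 0<η
        (e , Le , e₀≤e , l≤e) = L-max ε Le₀ Ll
        (u , Uu , u≤u₀ , u≤v) = U-min ε Uu₀ Uv
        0<e = <-≤-trans 0<e₀ e₀≤e
        e<u = L<U ε Le Uu
        u<1 = ≤-<-trans u≤u₀ u₀<1
        u-e<η : u - e < η
        u-e<η = <-by (+-mono-<-≤ (0<-diff v<l+η) (+-0≤ (0≤-diff l≤e) (0≤-diff u≤v)))
          (solve 5 (λ l v e u η → η :- (u :- e) := (l :+ η :- v) :+ ((e :- l) :+ (v :- u))) refl l v e u η)
    in e , u , 0<e , <-trans e<u u<1 , Le , Uu , finish 0<e e<u u<1 u-e<η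
    where
    T = ℕ→ℚ t
    0<1+T : 0ℚ < 1ℚ + T
    0<1+T = +-mono-<-≤ 0<1 (ℕ→ℚ-0≤ t)
    η = h * recip 0<1+T
    0<η : 0ℚ < η
    0<η = *-0< 0<h (recip-0< 0<1+T)

    finish : ∀ {e u} → 0ℚ < e → e < u → u < 1ℚ → u - e < η → T * (½ * (u * u)) < T * (½ * (e * e)) + h
    finish {e} {u} 0<e e<u u<1 u-e<η = <-by
      (+-mono-<-≤ 0<η (*-0≤ (ℕ→ℚ-0≤ t) (+-0≤ (<⇒≤ (0<-diff u-e<η))
        (*-0≤ (<⇒≤ 0<½) (*-0≤ (<⇒≤ (0<-diff e<u)) (+-0≤ (<⇒≤ (0<-diff u<1)) (<⇒≤ (0<-diff (<-trans e<u u<1)))))))))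
      (trans (cong (λ h → T * (½ * (e * e)) + h - T * (½ * (u * u))) (sym (recip-cancel 0<1+T h)))
        (solve 4 (λ T e u η → T :* (con ½ :* (e :* e)) :+ η :* (con 1ℚ :+ T) :- T :* (con ½ :* (u :* u))
           := η :+ T :* ((η :- (u :- e)) :+ con ½ :* ((u :- e) :* ((con 1ℚ :- u) :+ (con 1ℚ :- e))))) refl T e u η))

  module _ {ε δ : ℝ} (0<ε : 0ᵣ <ᵣ ε) (ε<1 : ε <ᵣ 1ᵣ) (0<δ : 0ᵣ <ᵣ δ)
    {a : ℚ} (0<a : 0ᵣ <ᵣ ℚ→ℝ a) (0<ε² : 0ᵣ <ᵣ ε *ᵣ ε) (0<a/δ : 0ᵣ <ᵣ ℚ→ℝ a ÷ᵣ δ ⟨ 0<δ ⟩) (t : ℕ) where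

    private
      T = ℕ→ℚ t
      Λ = ln (ℚ→ℝ a ÷ᵣ δ ⟨ 0<δ ⟩) 0<a/δ

    -- If l were below `Λ`, a rational c with t/l < c < 2/u² would lie below 2/ε², so that c l > t
    -- would exhibit the product as greater than t.
    log-bound : (ℕ→ℝ 2 ÷ᵣ ε *ᵣ ε ⟨ 0<ε² ⟩) *ᵣ Λ ≤ᵣ ℕ→ℝ t →
                ∀ {e u l} → 0ℚ < e → L ε e → U ε u → T * (½ * (u * u)) < l → ¬ L Λ l
    log-bound X≤t {e} {u} {l} 0<e Le Uu Tu²<l Ll = 
      let (c , y<c , c<2/uu) = <-dense (<-recip 0<uu yuu<2)
          0<c = ≤-<-trans 0≤y y<c
          cuu<2 = subst (c * (u * u) <_) (recip-cancel 0<uu 2ℚ) (*-monoʳ-< 0<uu c<2/uu)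
          (p , cuu<p , p<2) = <-dense cuu<2
          T<cl = subst (_< c * l) (recip-cancel 0<l T) (*-monoʳ-< 0<l y<c)
          (q , T<q , q<cl) = <-dense T<cl
      in X≤t (q , T<q , L-*ᵣ {c} {l} {q} {ℕ→ℝ 2 ÷ᵣ ε *ᵣ ε ⟨ 0<ε² ⟩} {Λ} 0<c 0<l
           (L-÷ᵣ-square {c} {p} {e} {u} {ℕ→ℝ 2} {ε} 0<ε² 0<c p<2 0<e Le Uu cuu<p) Ll q<cl)
      where
      2ℚ = ℕ→ℚ 2
      0<u = <-trans 0<e (L<U ε Le Uu)
      0<uu = *-0< 0<u 0<u
      0<l : 0ℚ < l
      0<l = ≤-<-trans (*-0≤ (ℕ→ℚ-0≤ t) (*-0≤ (<⇒≤ 0<½) (<⇒≤ 0<uu))) Tu²<l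
      y = T * recip 0<l
      0≤y : 0ℚ ≤ y
      0≤y = *-0≤ (ℕ→ℚ-0≤ t) (<⇒≤ (recip-0< 0<l))
      yuu<2 : y * (u * u) < 2ℚ
      yuu<2 = *-cancelʳ-< {c = l} (<⇒≤ 0<l) (subst (_< 2ℚ * l) eq (*-monoˡ-< {2ℚ} (ℕ→ℚ-0< 1) Tu²<l))
        where
        eq : 2ℚ * (T * (½ * (u * u))) ≡ y * (u * u) * l
        eq = trans (cong (λ T → 2ℚ * (T * (½ * (u * u)))) (sym (recip-cancel 0<l T)))
          (solve 3 (λ y u l → con 2ℚ :* ((y :* l) :* (con ½ :* (u :* u))) := y :* (u :* u) :* l) refl y u l)

    -- By `log-bound`, locatedness of the logarithm can only place it below t e²/2 + h. So some b
    -- lies above a/δ and below exp (t e²/2 + h), and `exp-decay` gives a (1 - h) (1 - e²/2)^t ≤ d′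
    -- for a rational d′ strictly between `δ` and `d`.
    failure-bound : (ℕ→ℝ 2 ÷ᵣ ε *ᵣ ε ⟨ 0<ε² ⟩) *ᵣ Λ ≤ᵣ ℕ→ℝ t →
                    ∀ {d} → U δ d → ∃ λ e → 0ℚ < e × e < 1ℚ × L ε e × a * rate e ^ t < d
    failure-bound X≤t {d} Ud =
      let (d′ , d′<d , Ud′) = U-round δ Ud
          0<d = 0<U δ 0<δ Ud
          0<d′ = 0<U δ 0<δ Ud′
          -- Taking h below (d - d′)/d makes d′ < d (1 - h), which absorbs the slack h in the
          -- exponent.
          (h , 0<h , h<) = <-dense (*-0< (0<-diff d′<d) (recip-0< 0<d))
          hd<d-d′ = subst (h * d <_) (recip-cancel 0<d (d - d′)) (*-monoʳ-< 0<d h<)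
          h<1 = *-cancelʳ-< {c = d} {h} {1ℚ} (<⇒≤ 0<d) (<-trans hd<d-d′
                  (<-by 0<d′ (solve 2 (λ d d′ → con 1ℚ :* d :- (d :- d′) := d′) refl d d′)))
          (e , u , 0<e , e<1 , Le , Uu , Tuu<) = close-squares {ε} {h} t 0<ε ε<1 0<h
          (l , Tuu<l , l<) = <-dense Tuu<
      in e , 0<e , e<1 , Le ,
         conclude {d′} {h} {e} {l} 0<d′ hd<d-d′ 0<h h<1 0<e e<1 Ud′ (log-bound X≤t {e} {u} {l} 0<e Le Uu Tuu<l) (located Λ l<)
      where
      conclude : ∀ {d′ h e l} → 0ℚ < d′ → h * d < d - d′ → 0ℚ < h → h < 1ℚ → 0ℚ < e → e < 1ℚ → U δ d′ →
                 ¬ L Λ l → L Λ l ⊎ U Λ (T * (½ * (e * e)) + h) → a * rate e ^ t < d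
      conclude _ _ _ _ _ _ _ ¬Ll (inj₁ Ll) = contradiction Ll ¬Ll
      conclude {d′} {h} {e} 0<d′ hd< 0<h h<1 0<e e<1 Ud′ _ (inj₂ (b , Ub , Lb)) =
        *-cancelʳ-< {c = 1ℚ - h} (<⇒≤ 0<1-h) (begin-strict
          a * R * (1ℚ - h)             ≤⟨ *-monoʳ-≤ (<⇒≤ 0<1-h) (*-monoʳ-≤ 0≤R (U-÷ᵣ-≤ {a} {b} {d′} {δ} 0<δ 0<a′ Ub Ud′)) ⟩
          b * d′ * R * (1ℚ - h)        ≡⟨ solve 4 (λ b d R h → b :* d :* R :* h := d :* (b :* h :* R)) refl b d′ R (1ℚ - h) ⟩
          d′ * (b * (1ℚ - h) * R)      ≤⟨ *-monoˡ-≤ (<⇒≤ 0<d′) (exp-decay {b} {x} {h} t 0≤x x<1 0<h h<1 Lb) ⟩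
          d′ * 1ℚ                      <⟨ <-by (0<-diff hd<) (solve 3 (λ d d′ h → d :* (con 1ℚ :- h) :- d′ :* con 1ℚ := (d :- d′) :- h :* d) refl d d′ h) ⟩
          d * (1ℚ - h)                 ∎)
        where
        open ≤-Reasoning
        x = ½ * (e * e)
        R = rate e ^ t
        0<1-h = 0<-diff h<1
        0<a′ : 0ℚ < a
        0<a′ = let (_ , 0<q , q<a) = 0<a in <-trans 0<q q<a
        0≤x : 0ℚ ≤ x
        0≤x = *-0≤ (<⇒≤ 0<½) (square-0≤ e)
        x<1 : x < 1ℚ
        x<1 = <-by (+-mono-<-≤ (*-0< 0<½ 0<1) (*-0≤ (<⇒≤ 0<½) (*-0≤ (<⇒≤ (0<-diff e<1)) (+-0≤ 0≤1 (<⇒≤ 0<e)))))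
          (solve 1 (λ e → con 1ℚ :- con ½ :* (e :* e) := con ½ :* con 1ℚ :+ con ½ :* ((con 1ℚ :- e) :* (con 1ℚ :+ e))) refl e)
        0≤R : 0ℚ ≤ R
        0≤R = ^-0≤ t (<⇒≤ (0<-diff x<1))

  -- Rankings

  private
    variable
      n : ℕ

  count-++ : {P : Pred A ℓ} (P? : Decidable P) → ∀ xs ys → count P? (xs ++ ys) ≡ count P? xs ℕ.+ count P? ys
  count-++ P? xs ys = trans (cong length (List.filter-++ P? xs ys)) (List.length-++ (List.filter P? xs))

  count-split : {P : Pred A ℓ} (P? : Decidable P) → ∀ k xs →
                count P? xs ≡ count P? (take k xs) ℕ.+ count P? (drop k xs)
  count-split P? k xs = trans (cong (count P?) (sym (List.take++drop≡id k xs))) (count-++ P? (take k xs) (drop k xs))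

  count-take-≤ : {P : Pred A ℓ} (P? : Decidable P) → ∀ k xs → count P? (take k xs) ℕ.≤ count P? xs
  count-take-≤ P? k xs = subst (count P? (take k xs) ℕ.≤_) (sym (count-split P? k xs)) (ℕ.m≤m+n (count P? (take k xs)) (count P? (drop k xs)))

  count-none-drop : {P : Pred A ℓ} (P? : Decidable P) → ∀ k xs → All (λ x → ¬ P x) (drop k xs) →
                    count P? xs ≡ count P? (take k xs)
  count-none-drop P? k xs none = trans (count-split P? k xs)
    (trans (cong (count P? (take k xs) ℕ.+_) (cong length (List.filter-none P? none))) (ℕ.+-identityʳ (count P? (take k xs))))

  count-all : {P : Pred A ℓ} (P? : Decidable P) → ∀ {xs} → All P xs → count P? xs ≡ length xs
  count-all P? all = cong length (List.filter-all P? all)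

  count-↭ : {P : Pred A ℓ} (P? : Decidable P) → ∀ {xs ys} → xs ↭ ys → count P? xs ≡ count P? ys
  count-↭ P? xs↭ys = ↭.↭-length (↭.filter-↭ P? xs↭ys)

  length-take-≤ : ∀ k (xs : List A) → k ℕ.≤ length xs → length (take k xs) ≡ k
  length-take-≤ k xs k≤ = trans (List.length-take k xs) (ℕ.m≤n⇒m⊓n≡m k≤)

  ∈-take⊎drop : ∀ k {x : A} xs → x ∈ xs → x ∈ take k xs ⊎ x ∈ drop k xs
  ∈-take⊎drop k {x} xs x∈xs = ∈.∈-++⁻ (take k xs) (subst (x ∈_) (sym (List.take++drop≡id k xs)) x∈xs)

  drop-suc : ∀ {P : Pred A ℓ} k xs → All P (drop k xs) → All P (drop (suc k) xs)
  drop-suc zero    []       all       = []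
  drop-suc zero    (x ∷ xs) (_ ∷ all) = all
  drop-suc (suc k) []       all       = []
  drop-suc (suc k) (x ∷ xs) all       = drop-suc k xs all

  -- Positions count from 0, and the two parts share the entry at position k, whose value is `v`.
  -- The default 0 is never reached since k is below the length.
  nth-separates : ∀ (f : A → ℚ) k {xs} → AllPairs (λ x y → f y ≤ f x) xs → k ℕ.< length xs →
                  let v = fromMaybe 0ℚ (List.head (drop k (List.map f xs))) in
                  All (λ x → v ≤ f x) (take (suc k) xs) × All (λ x → f x ≤ v) (drop k xs)
  nth-separates f zero    (x≥ ∷ _)            _           = ≤-refl ∷ [] , ≤-refl ∷ x≥
  nth-separates f (suc k) {_ ∷ _ ∷ _} ((x≥y ∷ _) ∷ sorted) (ℕ.s≤s k<) =
    let (above , below) = nth-separates f k sorted k< in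
    ≤-trans (All.head above) x≥y ∷ above , below

  lookup-injective : ∀ {xs : List A} → Unique xs → ∀ i j → List.lookup xs i ≡ List.lookup xs j → i ≡ j
  lookup-injective (_ ∷ _)  zero    zero    _  = refl
  lookup-injective (x∉ ∷ _) zero    (suc j) eq = contradiction eq (All.lookup x∉ (∈.∈-lookup j))
  lookup-injective (x∉ ∷ _) (suc i) zero    eq = contradiction (sym eq) (All.lookup x∉ (∈.∈-lookup i))
  lookup-injective (_ ∷ u)  (suc i) (suc j) eq = cong suc (lookup-injective u i j eq)

  subsets-unique : ∀ n → Unique (subsets n)
  subsets-unique zero    = [] ∷ []
  subsets-unique (suc n) = Unique.++⁺
    (Unique.map⁺ Vec.∷-injectiveʳ (subsets-unique n))
    (Unique.map⁺ Vec.∷-injectiveʳ (subsets-unique n))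
    disjoint-heads
    where
    disjoint-heads : ∀ {x} → ¬ (x ∈ List.map (outside Vec.∷_) (subsets n) × x ∈ List.map (inside Vec.∷_) (subsets n))
    disjoint-heads (out , in′) with ∈.∈-map⁻ (outside Vec.∷_) out | ∈.∈-map⁻ (inside Vec.∷_) in′
    ... | _ , _ , refl | _ , _ , ()

  ≃ᵣ-refl : ∀ {x} → x ≃ᵣ x
  ≃ᵣ-refl {x} = (λ (_ , Uq , Lq) → disjoint x Lq Uq) , (λ (_ , Uq , Lq) → disjoint x Lq Uq)

  module _ (T : Dataset n) (w : ℕ) where

    private
      O = decreasingFrequency T

    ranking-↭ : ranking T w ↭ U-list n w
    ranking-↭ = Sort.sort-↭ O (U-list n w)

    length-ranking : length (ranking T w) ≡ ∣U∣ n w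
    length-ranking = ↭.↭-length ranking-↭

    ranking-decreasing : AllPairs (λ x y → frequency T y ≤ frequency T x) (ranking T w)
    ranking-decreasing = Sorted⇒AllPairs (DecTotalOrder.totalOrder O) (Sort.sort-↗ O (U-list n w))

    ranking-unique : Unique (ranking T w)
    ranking-unique = ↭ₛ.Unique-resp-↭ (setoid (Subset n)) (↭⇒↭ₛ (↭-sym ranking-↭))
      (Unique.filter⁺ (_∈U? w) (subsets-unique n))

    ∈-ranking⁻ : ∀ {x} → x ∈ ranking T w → x ∈U w
    ∈-ranking⁻ x∈ = proj₂ (∈.∈-filter⁻ (_∈U? w) {xs = subsets n} (↭.∈-resp-↭ ranking-↭ x∈))

    ∈-ranking⁺ : ∀ {x} → x ∈U w → x ∈ ranking T w
    ∈-ranking⁺ {x} x∈U = ↭.∈-resp-↭ (↭-sym ranking-↭) (U-list-complete x x∈U)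

    ranked rest : ℕ → List (Itemset n)
    ranked K = take K (ranking T w)
    rest   K = drop K (ranking T w)

    module _ {k : ℕ} (K≤m : suc k ℕ.≤ ∣U∣ n w) where

      K≤length : suc k ℕ.≤ length (ranking T w)
      K≤length = subst (suc k ℕ.≤_) (sym length-ranking) K≤m

      kth-≤-ranked : All (λ x → kthFrequency T (suc k) w ≤ frequency T x) (ranked (suc k))
      kth-≤-ranked = proj₁ (nth-separates (frequency T) k ranking-decreasing K≤length)

      ≤-kth : All (λ x → frequency T x ≤ kthFrequency T (suc k) w) (drop k (ranking T w))
      ≤-kth = proj₂ (nth-separates (frequency T) k ranking-decreasing K≤length)

      rest-≤-kth : All (λ x → frequency T x ≤ kthFrequency T (suc k) w) (rest (suc k))
      rest-≤-kth = drop-suc k (ranking T w) ≤-kth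

      -- Witnessed by the first K itemsets of the ranking, which are distinct because the ranking
      -- permutes a list without repetitions.
      TOPK-enough : HasAtLeast (suc k) (TOPK T (suc k) w)
      TOPK-enough = subst (λ m → HasAtLeast m (TOPK T (suc k) w)) (length-take-≤ (suc k) (ranking T w) K≤length)
        ((λ i → x i , ℚ→ℝ (frequency T (x i))) , member , λ i j eq _ → lookup-injective top-unique i j eq)
        where
        top = ranked (suc k)
        top-unique = Unique.take⁺ (suc k) ranking-unique

        x : Fin (length top) → Itemset n
        x = List.lookup top

        member : ∀ i → TOPK T (suc k) w (x i , ℚ→ℝ (frequency T (x i)))
        member i = ∈-ranking⁻ (subst (x i ∈_) (List.take++drop≡id (suc k) (ranking T w)) (∈.∈-++⁺ˡ {xs = top} (∈.∈-lookup i)))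
                 , ≃ᵣ-refl {ℚ→ℝ (frequency T (x i))}
                 , All.lookup kth-≤-ranked (∈.∈-lookup i)

  module _ (D S : Dataset n) (w : ℕ) {k : ℕ} (K≤m : suc k ℕ.≤ ∣U∣ n w) where

    private
      K = suc k
      v = kthFrequency S K w
      rD = ranking D w
      rS = ranking S w

      rD↭rS : rD ↭ rS
      rD↭rS = ↭-trans (ranking-↭ D w) (↭-sym (ranking-↭ S w))

    -- Otherwise K itemsets would lie strictly above the K-th frequency of S.
    overtaken : ∀ {x} → v ≤ frequency S x → ∃ λ y → y ∈ ranked D w K × frequency S y ≤ frequency S x
    overtaken {x} v≤fx with Any.any? (λ y → frequency S y ≤? frequency S x) (ranked D w K)
    ... | yes any = let (y , y∈ , le) = find any in y , y∈ , le
    ... | no none = contradiction (begin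
        suc k                          ≡⟨ sym (length-take-≤ K rD (K≤length D w K≤m)) ⟩
        length (ranked D w K)          ≡⟨ sym (count-all above? (All.map (λ ≰ → ≤-<-trans v≤fx (≰⇒> ≰)) (All.¬Any⇒All¬ (ranked D w K) none))) ⟩
        count above? (ranked D w K)    ≤⟨ count-take-≤ above? K rD ⟩
        count above? rD                ≡⟨ count-↭ above? rD↭rS ⟩
        -- Cut at `k` rather than K: the K-th entry has frequency `v` itself, so only the k entries
        -- before it can lie strictly above.
        count above? rS                ≡⟨ count-none-drop above? k rS (All.map (λ ≤v v< → <-irrefl refl (<-≤-trans v< ≤v)) (≤-kth S w K≤m)) ⟩
        count above? (take k rS)       ≤⟨ List.length-filter above? (take k rS) ⟩
        length (take k rS)             ≡⟨ length-take-≤ k rS (ℕ.<⇒≤ (K≤length S w K≤m)) ⟩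
        k                              ∎) ℕ.1+n≰n
      where
      open ℕ.≤-Reasoning
      above? : Decidable (λ y → v < frequency S y)
      above? y = v <? frequency S y

    -- Otherwise fewer than K itemsets would reach the K-th frequency of S.
    promoted : ∀ {x} → x ∈ ranked D w K → frequency S x < v → ∃ λ y → y ∈ rest D w K × v ≤ frequency S y
    promoted {x} x∈ fx<v with Any.any? (λ y → v ≤? frequency S y) (rest D w K)
    ... | yes any = let (y , y∈ , le) = find any in y , y∈ , le
    ... | no none = contradiction (begin-strict
        suc k                          ≡⟨ sym (length-take-≤ K rS (K≤length S w K≤m)) ⟩
        length (ranked S w K)          ≡⟨ sym (count-all reach? (kth-≤-ranked S w K≤m)) ⟩
        count reach? (ranked S w K)    ≤⟨ count-take-≤ reach? K rS ⟩
        count reach? rS                ≡⟨ count-↭ reach? (↭-sym rD↭rS) ⟩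
        count reach? rD                ≡⟨ count-none-drop reach? K rD (All.¬Any⇒All¬ (rest D w K) none) ⟩
        -- The inequality is strict because x is among the first K of `D` without reaching `v`.
        count reach? (ranked D w K)    <⟨ List.filter-notAll reach? (ranked D w K) (lose x∈ (λ v≤fx → <-irrefl refl (<-≤-trans fx<v v≤fx))) ⟩
        length (ranked D w K)          ≡⟨ length-take-≤ K rD (K≤length D w K≤m) ⟩
        suc k                          ∎) (ℕ.<-irrefl refl)
      where
      open ℕ.≤-Reasoning
      reach? : Decidable (λ y → v ≤ frequency S y)
      reach? y = v ≤? frequency S y

  -- From rational bounds on frequencies to an approximation over the reals

  ≤ᵣℚ⇒ : ∀ {g r q} → g ≤ᵣ ℚ→ℝ r → L g q → q ≤ r
  ≤ᵣℚ⇒ {g} {r} {q} g≤r Lq = ≮⇒≥ λ r<q → g≤r (q , r<q , Lq)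

  ℚ≤ᵣ⇒ : ∀ {g r q} → ℚ→ℝ r ≤ᵣ g → U g q → r ≤ q
  ℚ≤ᵣ⇒ {g} {r} {q} r≤g Uq = ≮⇒≥ λ q<r → r≤g (q , Uq , q<r)

  module _ (D S : Dataset n) (w : ℕ) {k : ℕ} (K≤m : suc k ℕ.≤ ∣U∣ n w) {ε : ℝ} {e : ℚ} (Le : L ε e) (0<e : 0ℚ < e) where

    private
      K = suc k
      fᴰ = frequency D
      fˢ = frequency S

    -- The first two hypotheses give P3. For P1, an x of W outside the first K of `D` has in the
    -- sample at least the frequency of some y among them, so f_D(y) < f_D(x) + e while f_D(y) is at
    -- least the K-th frequency. P2 is dual, with a y from outside the first K that reaches the K-th
    -- sample frequency.
    TOPK-approximates :
      (∀ {x} → x ∈U w → fˢ x ≤ fᴰ x + e) →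
      (∀ {x} → x ∈U w → fᴰ x - e ≤ fˢ x) →
      (∀ {x y} → x ∈ ranked D w K → y ∈ rest D w K → fˢ x ≤ fˢ y → fᴰ x < fᴰ y + e) →
      IsApproximation ε D K w (TOPK S K w)
    TOPK-approximates upper lower separated = record
      { enough   = TOPK-enough S w K≤m
      ; itemsets = λ x g (x∈U , _) → x∈U
      ; unitary  = λ x g (_ , (g≤f , f≤g) , _) →
            (λ (q , Uq , q<0) → <-irrefl refl (≤-<-trans (≤-trans (proportion-0≤ (x Subset.⊆?_) S) (ℚ≤ᵣ⇒ {g} f≤g Uq)) q<0))
          , (λ (q , 1<q , Lq) → <-irrefl refl (<-≤-trans 1<q (≤-trans (≤ᵣℚ⇒ {g} g≤f Lq) (proportion-≤1 (x Subset.⊆?_) S))))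
      ; P1       = λ x g (x∈U , _ , v≤f) → kth-e≤ (P1-rational x∈U v≤f)
      ; P2       = λ x x∈U x∉W → <kth+e (P2-rational x∈U (≰⇒> λ v≤f → x∉W (ℚ→ℝ (fˢ x) , x∈U , ≃ᵣ-refl {ℚ→ℝ (fˢ x)} , v≤f)))
      ; P3       = λ x g (x∈U , g≃f , _) → deviation {x} {g} x∈U g≃f
      }
      where
      vᴰ = kthFrequency D K w
      vˢ = kthFrequency S K w

      P1-rational : ∀ {x} → x ∈U w → vˢ ≤ fˢ x → vᴰ ≤ fᴰ x + e
      P1-rational {x} x∈U v≤f with ∈-take⊎drop K (ranking D w) (∈-ranking⁺ D w x∈U)
      ... | inj₁ x∈top  = ≤-trans (All.lookup (kth-≤-ranked D w K≤m) x∈top)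
        (≤-by (<⇒≤ 0<e) (solve 2 (λ f e → f :+ e :- f := e) refl (fᴰ x) e))
      ... | inj₂ x∈rest = let (y , y∈top , fy≤fx) = overtaken D S w K≤m v≤f in
        ≤-trans (All.lookup (kth-≤-ranked D w K≤m) y∈top) (<⇒≤ (separated y∈top x∈rest fy≤fx))

      P2-rational : ∀ {x} → x ∈U w → fˢ x < vˢ → fᴰ x < vᴰ + e
      P2-rational {x} x∈U f<v with ∈-take⊎drop K (ranking D w) (∈-ranking⁺ D w x∈U)
      ... | inj₂ x∈rest = ≤-<-trans (All.lookup (rest-≤-kth D w K≤m) x∈rest)
        (<-by 0<e (solve 2 (λ v e → v :+ e :- v := e) refl vᴰ e))
      ... | inj₁ x∈top  = let (y , y∈rest , v≤fy) = promoted D S w K≤m x∈top f<v in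
        <-≤-trans (separated x∈top y∈rest (<⇒≤ (<-≤-trans f<v v≤fy)))
          (+-monoˡ-≤ e (All.lookup (rest-≤-kth D w K≤m) y∈rest))

      kth-e≤ : ∀ {v f} → v ≤ f + e → ℚ→ℝ v -ᵣ ε ≤ᵣ ℚ→ℝ f
      kth-e≤ {v} {f} v≤f+e (q , f<q , (a , c , a<v , U-c , q<a+c)) =
        <-irrefl refl (<-trans f<q (<-≤-trans q<a+c (≤-by
          (+-0≤ (+-0≤ (<⇒≤ (0<-diff a<v)) (<⇒≤ (0<-diff (L<U ε Le U-c)))) (0≤-diff v≤f+e))
          (solve 5 (λ v f e a c → f :- (a :+ c) := (v :- a) :+ (:- c :- e) :+ (f :+ e :- v)) refl v f e a c))))

      <kth+e : ∀ {v f} → f < v + e → ℚ→ℝ f <ᵣ ℚ→ℝ v +ᵣ ε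
      <kth+e {v} {f} f<v+e =
        let (q , f<q , q<v+e) = <-dense f<v+e
            -- The cut of the sum needs a lower bound for each summand; with e serving for `ε`, the
            -- other must exceed q - e and stay below v.
            (a , q-e<a , a<v) = <-dense {q - e} {v} (<-by (0<-diff q<v+e) (solve 3 (λ q v e → v :- (q :- e) := v :+ e :- q) refl q v e))
        in q , f<q , a , e , a<v , Le
         , <-by (0<-diff q-e<a) (solve 3 (λ q a e → a :+ e :- q := a :- (q :- e)) refl q a e)

      -- A rational below the absolute value is below the difference or below its negative. The
      -- first case contradicts `upper`, the second `lower`, as soon as the rational also lies above
      -- `ε`.
      deviation : ∀ {x g} → x ∈U w → g ≃ᵣ ℚ→ℝ (fˢ x) → ∣ g -ᵣ ℚ→ℝ (fᴰ x) ∣ᵣ ≤ᵣ ε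
      deviation {x} {g} x∈U (g≤f , f≤g) (q , Uq , inj₁ (a , c , La , f<-c , q<a+c)) =
        <-irrefl refl (<-trans (L<U ε Le Uq) (<-≤-trans q<a+c (≤-by
          (+-0≤ (+-0≤ (0≤-diff (≤ᵣℚ⇒ {g} g≤f La)) (<⇒≤ (0<-diff f<-c))) (0≤-diff (upper x∈U)))
          (solve 5 (λ s d e a c → e :- (a :+ c) := (s :- a) :+ (:- c :- d) :+ (d :+ e :- s)) refl (fˢ x) (fᴰ x) e a c))))
      deviation {x} {g} x∈U (g≤f , f≤g) (q , Uq , inj₂ (b , d , Ub , -d<f , b+d<-q)) =
        <-irrefl refl (<-trans (L<U ε Le Uq) (<-≤-trans (<-by (0<-diff b+d<-q) (solve 3 (λ b d q → (:- (b :+ d)) :- q := :- q :- (b :+ d)) refl b d q)) (≤-by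
          (+-0≤ (+-0≤ (0≤-diff (ℚ≤ᵣ⇒ {g} f≤g Ub)) (<⇒≤ (0<-diff -d<f))) (0≤-diff (lower x∈U)))
          (solve 5 (λ s f e b d → e :- (:- (b :+ d)) := (b :- s) :+ (f :- :- d) :+ (s :- (f :- e))) refl (fˢ x) (fᴰ x) e b d))))

  -- The union bound

  length-cartesianProductWith : ∀ {B C : Set} (f : A → B → C) xs ys →
    length (List.cartesianProductWith f xs ys) ≡ length xs ℕ.* length ys
  length-cartesianProductWith f []       ys = refl
  length-cartesianProductWith f (x ∷ xs) ys = trans (List.length-++ (List.map (f x) ys))
    (cong₂ ℕ._+_ (List.length-map (f x) ys) (length-cartesianProductWith f xs ys))

  module _ (D : Dataset n) (w : ℕ) {k : ℕ} (K≤m : suc k ℕ.≤ ∣U∣ n w) (D≢[] : D ≢ []) where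

    module _ {e : ℚ} (0<e : 0ℚ < e) (e<1 : e < 1ℚ) where

      private
        K = suc k
        m = ∣U∣ n w
        top = ranked D w K
        low = rest D w K

        over = λ (x : Itemset n) → upper-tail 0<e e<1 (x Subset.⊆?_) D
        under = λ (x : Itemset n) → lower-tail 0<e e<1 (x Subset.⊆?_) D D≢[]
        inversion = λ (x y : Itemset n) → inversion-tail 0<e e<1 (x Subset.⊆?_) (y Subset.⊆?_) D

        gs₁ = List.map (λ x → proj₁ (over x)) (U-list n w)
        gs₂ = List.map (λ x → proj₁ (under x)) (U-list n w)
        gs₃ = List.cartesianProductWith (λ x y → proj₁ (inversion x y)) top low

      potentials : List (Itemset n → ℚ)
      potentials = gs₁ ++ gs₂ ++ gs₃

      length-potentials : length potentials ≡ 2 ℕ.* m ℕ.+ K ℕ.* (m ℕ.∸ K)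
      length-potentials = begin
        length potentials
          ≡⟨ trans (List.length-++ gs₁) (cong (length gs₁ ℕ.+_) (List.length-++ gs₂)) ⟩
        length gs₁ ℕ.+ (length gs₂ ℕ.+ length gs₃)
          ≡⟨ cong₂ (λ a b → a ℕ.+ (b ℕ.+ length gs₃)) (List.length-map (λ x → proj₁ (over x)) (U-list n w)) (List.length-map (λ x → proj₁ (under x)) (U-list n w)) ⟩
        m ℕ.+ (m ℕ.+ length gs₃)
          ≡⟨ cong (λ l → m ℕ.+ (m ℕ.+ l)) (trans (length-cartesianProductWith (λ x y → proj₁ (inversion x y)) top low)
               (cong₂ ℕ._*_ (length-take-≤ K (ranking D w) (K≤length D w K≤m))
                 (trans (List.length-drop K (ranking D w)) (cong (ℕ._∸ K) (length-ranking D w))))) ⟩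
        m ℕ.+ (m ℕ.+ K ℕ.* (m ℕ.∸ K))
          ≡⟨ sym (ℕ.+-assoc m m (K ℕ.* (m ℕ.∸ K))) ⟩
        (m ℕ.+ m) ℕ.+ K ℕ.* (m ℕ.∸ K)
          ≡⟨ cong (λ l → (m ℕ.+ l) ℕ.+ K ℕ.* (m ℕ.∸ K)) (sym (ℕ.+-identityʳ m)) ⟩
        2 ℕ.* m ℕ.+ K ℕ.* (m ℕ.∸ K) ∎
        where open ≡-Reasoning

      arePotentials : All (IsPotential (rate e) D) potentials
      arePotentials = All.++⁺ (All.map⁺ (All.universal (λ x → proj₁ (proj₂ (over x))) (U-list n w)))
        (All.++⁺ (All.map⁺ (All.universal (λ x → proj₁ (proj₂ (under x))) (U-list n w)))
          (All.cartesianProductWith⁺ (setoid (Itemset n)) (setoid (Itemset n)) (λ x y → proj₁ (inversion x y)) top low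
            (λ {x} {y} _ _ → proj₁ (proj₂ (inversion x y)))))

      small-potentials⇒approximation : ∀ {ε} → L ε e → ∀ S → All (λ g → prodOf g S < 1ℚ) potentials →
        IsApproximation ε D K w (TOPK S K w)
      small-potentials⇒approximation Le S all =
        let (all₁ , all₂₃) = All.++⁻ gs₁ all
            (all₂ , all₃)  = All.++⁻ gs₂ all₂₃
        in TOPK-approximates D S w K≤m Le 0<e
          (λ {x} x∈U → proj₂ (proj₂ (over x)) S (All.lookup (All.map⁻ all₁) (U-list-complete x x∈U)))
          (λ {x} x∈U → proj₂ (proj₂ (under x)) S (All.lookup (All.map⁻ all₂) (U-list-complete x x∈U)))
          (λ {x} {y} x∈top y∈low → proj₂ (proj₂ (inversion x y)) S
            (All.lookup all₃ (∈.∈-cartesianProductWith⁺ (λ x y → proj₁ (inversion x y)) x∈top y∈low)))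

    -- A failure of the bound provides a rational q above the proportion and below a + c, where a <
    -- 1 and - c lies above `δ`. Only then is e chosen, for d = - c, which is why `failure` lets e
    -- depend on d; the weights built from e then make the proportion exceed q.
    TOPK-probable : ∀ {ε δ} t →
      (∀ {d} → U δ d → ∃ λ e → 0ℚ < e × e < 1ℚ × L ε e × ℕ→ℚ (2 ℕ.* ∣U∣ n w ℕ.+ suc k ℕ.* (∣U∣ n w ℕ.∸ suc k)) * rate e ^ t < d) →
      Probability≥ (draws t D) (1ᵣ -ᵣ δ) (λ S → IsApproximation ε D (suc k) w (TOPK S (suc k) w))
    TOPK-probable {ε} {δ} t failure B? E⊆B (q , p<q , (a , c , a<1 , U-c , q<a+c)) =
      let (e , 0<e , e<1 , Le , Aβᵗ<d) = failure U-c
          1-Aβᵗ≤p = subst (λ g → 1ℚ - ℕ→ℚ g * rate e ^ t ≤ proportion B? (draws t D))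
            (length-potentials 0<e e<1)
            (proportion-draws-≥ {gs = potentials 0<e e<1} t D≢[] (arePotentials 0<e e<1) B?
              (λ S all → E⊆B (small-potentials⇒approximation 0<e e<1 {ε} Le S all)))
          Aβᵗ = ℕ→ℚ (2 ℕ.* ∣U∣ n w ℕ.+ suc k ℕ.* (∣U∣ n w ℕ.∸ suc k)) * rate e ^ t
          a+c<1-Aβᵗ : a + c < 1ℚ - Aβᵗ
          a+c<1-Aβᵗ = <-by (+-0< (0<-diff a<1) (0<-diff Aβᵗ<d))
            (solve 3 (λ a c b → (con 1ℚ :- b) :- (a :+ c) := (con 1ℚ :- a) :+ (:- c :- b)) refl a c Aβᵗ)
      in <-irrefl refl (<-trans q<a+c (<-trans a+c<1-Aβᵗ (≤-<-trans 1-Aβᵗ≤p p<q)))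


open import Data.List.Base using (List; [])
open import Data.Nat.Base using (ℕ; suc; _≤_; _+_; _*_; _∸_)
open import Data.Product using (_,_)
open import Relation.Binary.PropositionalEquality using (_≢_)
open Sampling using (failure-bound; TOPK-probable)

theorem1 : ∀ (n w K : ℕ) (D : Dataset n) → D ≢ [] → 1 ≤ w →
    let m = ∣U∣ n w in
    (1≤K : 1 ≤ K) (K≤m : K ≤ m) →
    (ε δ : ℝ) (0<ε : 0ᵣ <ᵣ ε) → ε <ᵣ 1ᵣ → (0<δ : 0ᵣ <ᵣ δ) → δ <ᵣ 1ᵣ →
    let 0<A = ℕ→ℝ-pos (2m+K[m-K]-pos 1≤K K≤m) in
    (t : ℕ) →
    IsCeiling
      ((ℕ→ℝ 2 ÷ᵣ (ε *ᵣ ε) ⟨ *ᵣ-pos {ε} {ε} 0<ε 0<ε ⟩) *ᵣ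
        ln (ℕ→ℝ (2 * m + K * (m ∸ K)) ÷ᵣ δ ⟨ 0<δ ⟩) (÷ᵣ-pos {ℕ→ℝ (2 * m + K * (m ∸ K))} {δ} 0<A 0<δ))
      t →
    Probability≥ (draws t D) (1ᵣ -ᵣ δ) (λ S → IsApproximation ε D K w (TOPK S K w))
theorem1 n w (suc k) D D≢[] _ 1≤K K≤m ε δ 0<ε ε<1 0<δ _ t (X≤t , _) =
  TOPK-probable D w K≤m D≢[] {ε} {δ} t
    (failure-bound {ε} {δ} 0<ε ε<1 0<δ 0<A (*ᵣ-pos {ε} {ε} 0<ε 0<ε)
      (÷ᵣ-pos {ℕ→ℝ (2 * ∣U∣ n w + suc k * (∣U∣ n w ∸ suc k))} {δ} 0<A 0<δ) t X≤t)
  where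
  0<A = ℕ→ℝ-pos (2m+K[m-K]-pos 1≤K K≤m)
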